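{- Let $\mathcal F[\sigma]$ be a fragment of logic corresponding to a local variety of finite monoids $\mathbf V$. Let $L$ be a regular language and $s$ its stability index. Then the following statements are equivalent: (1) $L$ belongs to $\mathcal F[\sigma,+1,\mathrm{MOD}]$; (2) $L$ belongs to $\mathcal F[\sigma,+1,\mathrm{MOD}^s]$; (3) the local monoids of the stable semigroup of $L$ belong to $\mathbf V$. Furthermore, if $\mathcal F[\sigma]$ is decidable, then so is $\mathcal F[\sigma,+1,\mathrm{MOD}]$.
   Context: Logic. A word $u$ over a finite alphabet $A$ is a set of positions $0,\dots,|u|-1$ labelled by letters. Formulas are monadic second order formulas over words; a signature $\sigma$ is a set of numerical predicates, and letter predicates $\mathbf a(x)$ (position $x$ carries letter $a$) are always available, for letters of any finite alphabet. A fragment of logic $\mathcal F[\sigma]$ is a set of closed formulas of $\mathrm{MSO}[\sigma]$ that contains the quantifier-free formulas and is closed under conjunction, disjunction and quantifier-free substitution (if $\varphi\in\mathcal F[\sigma]$ and $\psi(x_1,\dots,x_n)$ is a quantifier-free subformula of $\varphi$, then replacing $\psi$ by another quantifier-free formula over $\sigma$ with the same set of free variables gives a formula of $\mathcal F[\sigma]$). For a class of predicates $\sigma'$, the enrichment $\mathcal F[\sigma,\sigma']$ is the closure of $\mathcal F[\sigma]$ under quantifier-free substitutions with predicates ranging over $\sigma\cup\sigma'$. $\mathcal F[\sigma]$ also denotes the class of languages defined by its formulas. The symbol $+1$ denotes the class of descriptive local predicates $\mathbf a(x+k)$, $\mathbf a(\min+k)$, $\mathbf a(\max-k)$ for $k\ge0$,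 holding if the position $x+k$ (resp. the $k$-th position after the first one, the $k$-th position before the last one) is labelled by $a$. For $d\ge 1$, $\mathrm{MOD}^d$ consists of, for $0\le i<d$, the unary predicates $\mathbf{MOD}_i^d(x)$ (position $x$ is congruent to $i$ mod $d$) and the constants $\mathbf D_i^d$ (the length of the word is congruent to $i$ mod $d$); $\mathrm{MOD}=\bigcup_{d\ge1}\mathrm{MOD}^d$. A fragment is decidable if, given a regular language, one can decide whether it is definable by a formula of the fragment. Algebra. A variety of monoids is a nonempty class of finite monoids closed under division (quotients of submonoids) and finite direct products. $\mathcal F[\sigma]$ corresponds to $\mathbf V$ if the languages definable in $\mathcal F[\sigma]$ are exactly those recognized by a monoid of $\mathbf V$. For a morphism $\varphi:A^*\to M$ to a finite monoid, the stability index is the least positive integer $s$ with $\varphi(A^s)=\varphi(A^{2s})$, and the stable semigroup is the semigroup $\varphi(A^s)$. The stability index and stable semigroup of a regular language are those of its syntactic morphism. A local monoid of a semigroup $T$ is a monoid $eTe$ with $e$ an idempotent of $T$. Categories. Categories are finite; a monoid is a one-object category. A division of categories $\tau:C\to D$ is a map on objects together with, for each pair of objects $e,f$ of $C$, a relation $\tau:C(e,f)\to D(\tau(e),\tau(f))$ such that $\tau(x)\tau(y)\subseteq\tau(xy)$ for consecutive arrows $x,y$; $\tau(x)\ne\emptyset$ for every arrow $x$; $1_{\tau(e)}\in\tau(1_e)$ for every object $e$; and $\tau(x)\cap\tau(y)=\emptyset$ for distinct coterminal arrows $x,y$. $\mathbf{gV}$ is the class of all categories dividing a monoid of $\mathbf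 V$. $\ell\mathbf V$ is the class of all categories whose local monoids (the monoids $C(x,x)$, $x$ an object) are all in $\mathbf V$. $\mathbf V$ is local if $\mathbf{gV}=\ell\mathbf V$. -}

module Defs where

open import Level using (0ℓ; _⊔_) renaming (suc to lsuc)
open import Algebra.Bundles using (Monoid; Semigroup)
open import Algebra.Construct.DirectProduct using () renaming (monoid to _×ᴹ_)
open import Algebra.Morphism.Structures using (module MonoidMorphisms)
open import Data.Empty using (⊥)
open import Data.Fin.Base using (Fin; toℕ)
open import Data.Fin.Subset as Subset using (Subset; ⁅_⁆)
open import Data.List.Base as List using (List; []; _++_; length)
open import Data.List.Properties using (++-monoid; ++-assoc; length-++)
open import Data.Nat.Base using (ℕ; suc; _+_; _*_; _<_; _≤_)
open import Data.Nat.Properties using (+-identityʳ)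
open import Data.Product.Base using (Σ; Σ-syntax; ∃; ∃-syntax; _×_; _,_; proj₁)
open import Data.Sum.Base using (_⊎_; inj₁; inj₂; [_,_])
open import Data.Unit.Base using (⊤)
open import Data.Vec.Base as Vec using (Vec; []; _∷_; lookup; tail; toList)
open import Function.Base using (id)
open import Function.Bundles using (_⇔_; Inverse)
open import Function.Definitions using (Surjective)
open import Function.Properties.Equivalence using (⇔-isEquivalence)
open import Relation.Binary.Bundles using (Setoid)
open import Relation.Binary.Definitions using (_Respects_)
open import Relation.Binary.PropositionalEquality using (_≡_; refl; sym; trans; cong; cong₂; setoid)
open import Relation.Binary.Structures using (IsEquivalence)
open import Relation.Nullary using (¬_; Dec)
open import Relation.Unary using (Pred; Decidable; _≐_)

-- Finite alphabets are the sets Fin n.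

Word : ℕ → Set
Word n = List (Fin n)

Language : ℕ → Set₁
Language n = Pred (Word n) 0ℓ

Position : ∀ {n} → Word n → Set
Position u = Fin (length u)

-- In formulas, letters are drawn from ℕ, so that one set of formulas speaks
-- about words over every alphabet; the letter a is absent from words over
-- Fin n when a ≥ n.
CarriesAt : ∀ {n} → Word n → ℕ → ℕ → Set
CarriesAt u a j = Σ[ p ∈ Position u ] (toℕ p ≡ j × toℕ (List.lookup u p) ≡ a)

record Predicates : Set₁ where
  field
    Sym   : Set
    arity : Sym → ℕ
    Holds : ∀ {n} (R : Sym) (u : Word n) → Vec (Position u) (arity R) → Set

-- A signature consists of numerical predicates: their interpretation depends
-- on the word only through its length.
record Signature : Set₁ where
  field
    Sym   : Set
    arity : Sym → ℕ
    Holds : (R : Sym) (len : ℕ) → Vec (Fin len) (arity R) → Set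

numerical : Signature → Predicates
numerical σ = record
  { Sym   = Sym
  ; arity = arity
  ; Holds = λ R u → Holds R (length u)
  }
  where open Signature σ

infixr 5 _∪ᴾ_

_∪ᴾ_ : Predicates → Predicates → Predicates
P ∪ᴾ Q = record
  { Sym   = P.Sym ⊎ Q.Sym
  ; arity = [ P.arity , Q.arity ]
  ; Holds = λ { (inj₁ R) → P.Holds R ; (inj₂ R) → Q.Holds R }
  }
  where
  module P = Predicates P
  module Q = Predicates Q

⋃ᴾ : (I : Set) → (I → Predicates) → Predicates
⋃ᴾ I P = record
  { Sym   = Σ[ i ∈ I ] Predicates.Sym (P i)
  ; arity = λ (i , R) → Predicates.arity (P i) R
  ; Holds = λ (i , R) → Predicates.Holds (P i) R
  }

data LocalSym : Set where
  at-x+   : (a k : ℕ) → LocalSym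
  at-min+ : (a k : ℕ) → LocalSym
  at-max- : (a k : ℕ) → LocalSym

LOC : Predicates
LOC = record { Sym = LocalSym ; arity = ar ; Holds = holds }
  where
  ar : LocalSym → ℕ
  ar (at-x+   a k) = 1
  ar (at-min+ a k) = 0
  ar (at-max- a k) = 0

  holds : ∀ {n} (R : LocalSym) (u : Word n) → Vec (Position u) (ar R) → Set
  holds (at-x+   a k) u (x ∷ []) = CarriesAt u a (toℕ x + k)
  holds (at-min+ a k) u []       = CarriesAt u a k
  holds (at-max- a k) u []       = ∃[ j ] (suc (j + k) ≡ length u × CarriesAt u a j)

data ModSym (d : ℕ) : Set where
  MODˢ : Fin d → ModSym d
  Dˢ   : Fin d → ModSym d

MOD^ : ℕ → Predicates
MOD^ d = record { Sym = ModSym d ; arity = ar ; Holds = holds }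
  where
  ar : ModSym d → ℕ
  ar (MODˢ i) = 1
  ar (Dˢ i)   = 0

  -- As i < d, this is congruence modulo d.
  _≡ᵐ_ : ℕ → Fin d → Set
  m ≡ᵐ i = ∃[ q ] m ≡ toℕ i + q * d

  holds : ∀ {n} (R : ModSym d) (u : Word n) → Vec (Position u) (ar R) → Set
  holds (MODˢ i) u (x ∷ []) = toℕ x ≡ᵐ i
  holds (Dˢ i)   u []       = length u ≡ᵐ i

MOD : Predicates
MOD = ⋃ᴾ ℕ (λ d → MOD^ (suc d))

-- Formulas are taken up to renaming of bound variables: Formula P m p
-- has m first-order and p set variables in scope (de Bruijn indices).

infixr 6 _∧ᶠ_
infixr 5 _∨ᶠ_

data Formula (P : Predicates) (m p : ℕ) : Set where
  ⊤ᶠ ⊥ᶠ     : Formula P m p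
  letter    : (a : ℕ) (x : Fin m) → Formula P m p
  pred      : (R : Predicates.Sym P) → Vec (Fin m) (Predicates.arity P R) → Formula P m p
  member    : (X : Fin p) (x : Fin m) → Formula P m p
  ¬ᶠ_       : Formula P m p → Formula P m p
  _∧ᶠ_ _∨ᶠ_ : (φ ψ : Formula P m p) → Formula P m p
  ∃₁ ∀₁     : Formula P (suc m) p → Formula P m p
  ∃₂ ∀₂     : Formula P m (suc p) → Formula P m p

Closed : Predicates → Set
Closed P = Formula P 0 0

Sat : ∀ {P m p n} (u : Word n) → Vec (Position u) m → Vec (Subset (length u)) p →
      Formula P m p → Set
Sat         u ρ θ ⊤ᶠ           = ⊤
Sat         u ρ θ ⊥ᶠ           = ⊥
Sat         u ρ θ (letter a x) = toℕ (List.lookup u (lookup ρ x)) ≡ a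
Sat {P = P} u ρ θ (pred R xs)  = Predicates.Holds P R u (Vec.map (lookup ρ) xs)
Sat         u ρ θ (member X x) = lookup ρ x Subset.∈ lookup θ X
Sat         u ρ θ (¬ᶠ φ)       = ¬ Sat u ρ θ φ
Sat         u ρ θ (φ ∧ᶠ ψ)     = Sat u ρ θ φ × Sat u ρ θ ψ
Sat         u ρ θ (φ ∨ᶠ ψ)     = Sat u ρ θ φ ⊎ Sat u ρ θ ψ
Sat         u ρ θ (∃₁ φ)       = ∃[ x ] Sat u (x ∷ ρ) θ φ
Sat         u ρ θ (∀₁ φ)       = ∀ x → Sat u (x ∷ ρ) θ φ
Sat         u ρ θ (∃₂ φ)       = ∃[ X ] Sat u ρ (X ∷ θ) φ
Sat         u ρ θ (∀₂ φ)       = ∀ X → Sat u ρ (X ∷ θ) φ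

_⊨_ : ∀ {P n} → Word n → Closed P → Set
u ⊨ φ = Sat u [] [] φ

fv₁ : ∀ {P m p} → Formula P m p → Subset m
fv₁ ⊤ᶠ           = Subset.⊥
fv₁ ⊥ᶠ           = Subset.⊥
fv₁ (letter a x) = ⁅ x ⁆
fv₁ (pred R xs)  = Subset.⋃ (toList (Vec.map ⁅_⁆ xs))
fv₁ (member X x) = ⁅ x ⁆
fv₁ (¬ᶠ φ)       = fv₁ φ
fv₁ (φ ∧ᶠ ψ)     = fv₁ φ Subset.∪ fv₁ ψ
fv₁ (φ ∨ᶠ ψ)     = fv₁ φ Subset.∪ fv₁ ψ
fv₁ (∃₁ φ)       = tail (fv₁ φ)
fv₁ (∀₁ φ)       = tail (fv₁ φ)
fv₁ (∃₂ φ)       = fv₁ φ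
fv₁ (∀₂ φ)       = fv₁ φ

fv₂ : ∀ {P m p} → Formula P m p → Subset p
fv₂ ⊤ᶠ           = Subset.⊥
fv₂ ⊥ᶠ           = Subset.⊥
fv₂ (letter a x) = Subset.⊥
fv₂ (pred R xs)  = Subset.⊥
fv₂ (member X x) = ⁅ X ⁆
fv₂ (¬ᶠ φ)       = fv₂ φ
fv₂ (φ ∧ᶠ ψ)     = fv₂ φ Subset.∪ fv₂ ψ
fv₂ (φ ∨ᶠ ψ)     = fv₂ φ Subset.∪ fv₂ ψ
fv₂ (∃₁ φ)       = fv₂ φ
fv₂ (∀₁ φ)       = fv₂ φ
fv₂ (∃₂ φ)       = tail (fv₂ φ)
fv₂ (∀₂ φ)       = tail (fv₂ φ)

data QuantifierFree {P m p} : Formula P m p → Set where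
  ⊤ᶠ     : QuantifierFree ⊤ᶠ
  ⊥ᶠ     : QuantifierFree ⊥ᶠ
  letter : ∀ a x → QuantifierFree (letter a x)
  pred   : ∀ R xs → QuantifierFree (pred R xs)
  member : ∀ X x → QuantifierFree (member X x)
  ¬ᶠ_    : ∀ {φ} → QuantifierFree φ → QuantifierFree (¬ᶠ φ)
  _∧ᶠ_   : ∀ {φ ψ} → QuantifierFree φ → QuantifierFree ψ → QuantifierFree (φ ∧ᶠ ψ)
  _∨ᶠ_   : ∀ {φ ψ} → QuantifierFree φ → QuantifierFree ψ → QuantifierFree (φ ∨ᶠ ψ)

-- φ ⟿ φ′ : one occurrence of a quantifier-free subformula of φ is replaced by
-- a quantifier-free formula with the same free variables, yielding φ′.
data _⟿_ {P} : ∀ {m p} → Formula P m p → Formula P m p → Set where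
  replace : ∀ {m p} {ψ ψ′ : Formula P m p} → QuantifierFree ψ → QuantifierFree ψ′ →
            fv₁ ψ ≡ fv₁ ψ′ → fv₂ ψ ≡ fv₂ ψ′ → ψ ⟿ ψ′
  in-¬    : ∀ {m p} {φ φ′ : Formula P m p} → φ ⟿ φ′ → (¬ᶠ φ) ⟿ (¬ᶠ φ′)
  in-∧ˡ   : ∀ {m p} {φ φ′ ψ : Formula P m p} → φ ⟿ φ′ → (φ ∧ᶠ ψ) ⟿ (φ′ ∧ᶠ ψ)
  in-∧ʳ   : ∀ {m p} {φ ψ ψ′ : Formula P m p} → ψ ⟿ ψ′ → (φ ∧ᶠ ψ) ⟿ (φ ∧ᶠ ψ′)
  in-∨ˡ   : ∀ {m p} {φ φ′ ψ : Formula P m p} → φ ⟿ φ′ → (φ ∨ᶠ ψ) ⟿ (φ′ ∨ᶠ ψ)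
  in-∨ʳ   : ∀ {m p} {φ ψ ψ′ : Formula P m p} → ψ ⟿ ψ′ → (φ ∨ᶠ ψ) ⟿ (φ ∨ᶠ ψ′)
  in-∃₁   : ∀ {m p} {φ φ′ : Formula P (suc m) p} → φ ⟿ φ′ → ∃₁ φ ⟿ ∃₁ φ′
  in-∀₁   : ∀ {m p} {φ φ′ : Formula P (suc m) p} → φ ⟿ φ′ → ∀₁ φ ⟿ ∀₁ φ′
  in-∃₂   : ∀ {m p} {φ φ′ : Formula P m (suc p)} → φ ⟿ φ′ → ∃₂ φ ⟿ ∃₂ φ′
  in-∀₂   : ∀ {m p} {φ φ′ : Formula P m (suc p)} → φ ⟿ φ′ → ∀₂ φ ⟿ ∀₂ φ′

embed : ∀ {P Q m p} → Formula P m p → Formula (P ∪ᴾ Q) m p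
embed ⊤ᶠ           = ⊤ᶠ
embed ⊥ᶠ           = ⊥ᶠ
embed (letter a x) = letter a x
embed (pred R xs)  = pred (inj₁ R) xs
embed (member X x) = member X x
embed (¬ᶠ φ)       = ¬ᶠ embed φ
embed (φ ∧ᶠ ψ)     = embed φ ∧ᶠ embed ψ
embed (φ ∨ᶠ ψ)     = embed φ ∨ᶠ embed ψ
embed (∃₁ φ)       = ∃₁ (embed φ)
embed (∀₁ φ)       = ∀₁ (embed φ)
embed (∃₂ φ)       = ∃₂ (embed φ)
embed (∀₂ φ)       = ∀₂ (embed φ)

record IsFragment {f} (σ : Signature) (F : Pred (Closed (numerical σ)) f) : Set f where
  field
    quantifierFree : ∀ {φ} → QuantifierFree φ → F φ
    ∧-closed       : ∀ {φ ψ} → F φ → F ψ → F (φ ∧ᶠ ψ)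
    ∨-closed       : ∀ {φ ψ} → F φ → F ψ → F (φ ∨ᶠ ψ)
    ⟿-closed       : ∀ {φ φ′} → φ ⟿ φ′ → F φ → F φ′

data Enrich {f P} (F : Pred (Closed P) f) (Q : Predicates) : Pred (Closed (P ∪ᴾ Q)) f where
  base : ∀ {φ} → F φ → Enrich F Q (embed φ)
  step : ∀ {φ φ′} → φ ⟿ φ′ → Enrich F Q φ → Enrich F Q φ′

Definable : ∀ {f P n} → Pred (Closed P) f → Language n → Set f
Definable F L = ∃[ φ ] (F φ × ∀ u → L u ⇔ u ⊨ φ)

IsFinite : Setoid 0ℓ 0ℓ → Set
IsFinite S = ∃[ k ] Inverse S (setoid (Fin k))

-- M divides N when M is a quotient of a submonoid of N.
record _≺_ (M N : Monoid 0ℓ 0ℓ) : Set₁ where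
  private
    module M = Monoid M
    module N = Monoid N
  field
    sub : Monoid 0ℓ 0ℓ
  private
    module T = Monoid sub
  field
    ι            : T.Carrier → N.Carrier
    π            : T.Carrier → M.Carrier
    ι-mono       : MonoidMorphisms.IsMonoidMonomorphism T.rawMonoid N.rawMonoid ι
    π-homo       : MonoidMorphisms.IsMonoidHomomorphism T.rawMonoid M.rawMonoid π
    π-surjective : Surjective T._≈_ M._≈_ π

-- The empty product is covered by nonemptiness and closure under division.
-- Divisors of finite monoids are finite only classically, hence the finiteness
-- assumption in ≺-closed.
record IsVariety {v} (V : Pred (Monoid 0ℓ 0ℓ) v) : Set (lsuc 0ℓ ⊔ v) where
  field
    finite   : ∀ {M} → V M → IsFinite (Monoid.setoid M)
    nonempty : ∃ V
    ≺-closed : ∀ {M N} → IsFinite (Monoid.setoid M) → M ≺ N → V N → V M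
    ×-closed : ∀ {M N} → V M → V N → V (M ×ᴹ N)

IsMorphism : ∀ {n} (M : Monoid 0ℓ 0ℓ) → (Word n → Monoid.Carrier M) → Set
IsMorphism {n} M =
  MonoidMorphisms.IsMonoidHomomorphism (Monoid.rawMonoid (++-monoid (Fin n))) (Monoid.rawMonoid M)

-- The accepting subset of a finite monoid is given decidably, so that a proof
-- of recognition by a finite monoid is effective data.
record _Recognizes_ {n} (M : Monoid 0ℓ 0ℓ) (L : Language n) : Set₁ where
  open Monoid M using (Carrier; _≈_)
  field
    φ            : Word n → Carrier
    φ-morphism   : IsMorphism M φ
    Accept       : Pred Carrier 0ℓ
    Accept-resp  : Accept Respects _≈_
    Accept?      : Decidable Accept
    recognizes   : ∀ u → L u ⇔ Accept (φ u)

Regular : ∀ {n} → Language n → Set₁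
Regular L = ∃[ M ] (IsFinite (Monoid.setoid M) × M Recognizes L)

Corresponds : ∀ {f v P} → Pred (Closed P) f → Pred (Monoid 0ℓ 0ℓ) v → Set (lsuc 0ℓ ⊔ f ⊔ v)
Corresponds F V = ∀ {n} (L : Language n) → Definable F L ⇔ (∃[ M ] (V M × M Recognizes L))

-- A decision procedure receives a regular language through a recognizing
-- finite monoid.
DecidableFragment : ∀ {f P} → Pred (Closed P) f → Set (lsuc 0ℓ ⊔ f)
DecidableFragment F = ∀ {n} (L : Language n) → Regular L → Dec (Definable F L)

module _ {n} (M : Monoid 0ℓ 0ℓ) (φ : Word n → Monoid.Carrier M) where
  open Monoid M using (Carrier; _≈_)

  Image : ℕ → Pred Carrier 0ℓ
  Image k m = ∃[ w ] (length w ≡ k × φ w ≈ m)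

  IsStable : ℕ → Set
  IsStable s = Image s ≐ Image (2 * s)

  record IsStabilityIndex (s : ℕ) : Set where
    field
      positive : 0 < s
      stable   : IsStable s
      least    : ∀ t → 0 < t → IsStable t → s ≤ t

stableSemigroup : ∀ {n} (M : Monoid 0ℓ 0ℓ) (φ : Word n → Monoid.Carrier M) →
                  IsMorphism M φ → ∀ s → IsStable M φ s → Semigroup 0ℓ 0ℓ
stableSemigroup M φ φ-morphism s (_ , shrink) = record
  { Carrier     = Σ M.Carrier (Image M φ s)
  ; _≈_         = λ x y → proj₁ x M.≈ proj₁ y
  ; _∙_         = λ { (x , v , |v|≡s , φv≈x) (y , w , |w|≡s , φw≈y) →
      x M.∙ y ,
      shrink ( v ++ w
             , trans (length-++ v)
                 (trans (cong₂ _+_ |v|≡s |w|≡s) (cong (s +_) (sym (+-identityʳ s))))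
             , M.trans (homo v w) (M.∙-cong φv≈x φw≈y)) }
  ; isSemigroup = record
      { isMagma = record
          { isEquivalence = record { refl = M.refl ; sym = M.sym ; trans = M.trans }
          ; ∙-cong        = M.∙-cong
          }
      ; assoc = λ x y z → M.assoc (proj₁ x) (proj₁ y) (proj₁ z)
      }
  }
  where
  module M = Monoid M
  open MonoidMorphisms.IsMonoidHomomorphism φ-morphism using (homo)

-- The carrier of eTe consists of the x equal to e t e for some t.
localMonoid : (T : Semigroup 0ℓ 0ℓ) → let open Semigroup T in
              (e : Carrier) → e ∙ e ≈ e → Monoid 0ℓ 0ℓ
localMonoid T e idem = record
  { Carrier  = Σ[ x ∈ T.Carrier ] ∃[ t ] x T.≈ e T.∙ t T.∙ e
  ; _≈_      = λ x y → proj₁ x T.≈ proj₁ y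
  ; _∙_      = λ { (x , t , p) (y , t′ , q) → x T.∙ y , t T.∙ e T.∙ (e T.∙ t′) , closed p q }
  ; ε        = e , e , T.sym (T.trans (T.∙-congʳ idem) idem)
  ; isMonoid = record
      { isSemigroup = record
          { isMagma = record
              { isEquivalence = record { refl = T.refl ; sym = T.sym ; trans = T.trans }
              ; ∙-cong        = T.∙-cong
              }
          ; assoc = λ x y z → T.assoc (proj₁ x) (proj₁ y) (proj₁ z)
          }
      ; identity = (λ { (_ , _ , p) → unitˡ p }) , (λ { (_ , _ , p) → unitʳ p })
      }
  }
  where
  module T = Semigroup T

  closed : ∀ {x y t t′} → x T.≈ e T.∙ t T.∙ e → y T.≈ e T.∙ t′ T.∙ e →
           x T.∙ y T.≈ e T.∙ (t T.∙ e T.∙ (e T.∙ t′)) T.∙ e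
  closed p q = T.trans (T.∙-cong p q)
    (T.trans (T.sym (T.assoc _ _ _))
      (T.∙-congʳ (T.trans (T.∙-congʳ (T.assoc _ _ _)) (T.assoc _ _ _))))

  unitˡ : ∀ {x t} → x T.≈ e T.∙ t T.∙ e → e T.∙ x T.≈ x
  unitˡ p = T.trans (T.∙-congˡ p)
    (T.trans (T.sym (T.assoc _ _ _))
      (T.trans (T.∙-congʳ (T.trans (T.sym (T.assoc _ _ _)) (T.∙-congʳ idem))) (T.sym p)))

  unitʳ : ∀ {x t} → x T.≈ e T.∙ t T.∙ e → x T.∙ e T.≈ x
  unitʳ p = T.trans (T.∙-congʳ p)
    (T.trans (T.assoc _ _ _) (T.trans (T.∙-congˡ idem) (T.sym p)))

-- The syntactic monoid is carried by the words themselves, with syntactic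
-- congruence as its equality; the syntactic morphism is then the identity.

module _ {n} (L : Language n) where

  SyntacticCongruence : Word n → Word n → Set
  SyntacticCongruence u v = ∀ p q → L (p ++ u ++ q) ⇔ L (p ++ v ++ q)

  private
    _∼_ = SyntacticCongruence
    module E {a} = IsEquivalence (⇔-isEquivalence {a})

    ∼-isEquivalence : IsEquivalence _∼_
    ∼-isEquivalence = record
      { refl  = λ p q → E.refl
      ; sym   = λ u∼v p q → E.sym (u∼v p q)
      ; trans = λ u∼v v∼w p q → E.trans (u∼v p q) (v∼w p q)
      }

    module ∼ = IsEquivalence ∼-isEquivalence

    ++-cong : ∀ {u u′ v v′} → u ∼ u′ → v ∼ v′ → (u ++ v) ∼ (u′ ++ v′)
    ++-cong {u} {u′} {v} {v′} u∼u′ v∼v′ p q = E.trans left right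
      where
      left : L (p ++ (u ++ v) ++ q) ⇔ L (p ++ (u′ ++ v) ++ q)
      left rewrite ++-assoc u v q | ++-assoc u′ v q = u∼u′ p (v ++ q)

      right : L (p ++ (u′ ++ v) ++ q) ⇔ L (p ++ (u′ ++ v′) ++ q)
      right rewrite ++-assoc u′ v q | ++-assoc u′ v′ q
                  | sym (++-assoc p u′ (v ++ q)) | sym (++-assoc p u′ (v′ ++ q))
                  = v∼v′ (p ++ u′) q

  syntacticMonoid : Monoid 0ℓ 0ℓ
  syntacticMonoid = record
    { Carrier  = Word n
    ; _≈_      = _∼_
    ; _∙_      = _++_
    ; ε        = []
    ; isMonoid = record
        { isSemigroup = record
            { isMagma = record { isEquivalence = ∼-isEquivalence ; ∙-cong = ++-cong }
            ; assoc   = λ u v w → ∼.reflexive (++-assoc u v w)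
            }
        ; identity = (λ u → ∼.refl) , (λ u → ∼.reflexive (Monoid.identityʳ (++-monoid (Fin n)) u))
        }
    }

  syntacticMorphism : Word n → Monoid.Carrier syntacticMonoid
  syntacticMorphism = id

  syntacticMorphism-isMorphism : IsMorphism syntacticMonoid syntacticMorphism
  syntacticMorphism-isMorphism = record
    { isMagmaHomomorphism = record
        { isRelHomomorphism = record { cong = ∼.reflexive }
        ; homo              = λ u v → ∼.refl
        }
    ; ε-homo = ∼.refl
    }

  StabilityIndexOf : ℕ → Set
  StabilityIndexOf = IsStabilityIndex syntacticMonoid syntacticMorphism

  stableSemigroupOf : ∀ {s} → StabilityIndexOf s → Semigroup 0ℓ 0ℓ
  stableSemigroupOf {s} isIndex =
    stableSemigroup syntacticMonoid syntacticMorphism syntacticMorphism-isMorphism s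
      (IsStabilityIndex.stable isIndex)

LocalMonoidsIn : ∀ {v} → Semigroup 0ℓ 0ℓ → Pred (Monoid 0ℓ 0ℓ) v → Set v
LocalMonoidsIn T V = ∀ e (idem : e ∙ e ≈ e) → V (localMonoid T e idem)
  where open Semigroup T

-- Composition is written in diagrammatic order.
record Category : Set₁ where
  infixl 7 _∙_
  field
    Obj : Set
    Hom : Obj → Obj → Setoid 0ℓ 0ℓ

  Arrow : Obj → Obj → Set
  Arrow x y = Setoid.Carrier (Hom x y)

  infix 4 _≈_
  _≈_ : ∀ {x y} → Arrow x y → Arrow x y → Set
  _≈_ {x} {y} = Setoid._≈_ (Hom x y)

  field
    1#        : ∀ x → Arrow x x
    _∙_       : ∀ {x y z} → Arrow x y → Arrow y z → Arrow x z
    ∙-cong    : ∀ {x y z} {f f′ : Arrow x y} {g g′ : Arrow y z} →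
                f ≈ f′ → g ≈ g′ → f ∙ g ≈ f′ ∙ g′
    assoc     : ∀ {w x y z} (f : Arrow w x) (g : Arrow x y) (h : Arrow y z) →
                (f ∙ g) ∙ h ≈ f ∙ (g ∙ h)
    identityˡ : ∀ {x y} (f : Arrow x y) → 1# x ∙ f ≈ f
    identityʳ : ∀ {x y} (f : Arrow x y) → f ∙ 1# y ≈ f

IsFiniteCategory : Category → Set
IsFiniteCategory C = IsFinite (setoid Obj) × ∀ x y → IsFinite (Hom x y)
  where open Category C

oneObject : Monoid 0ℓ 0ℓ → Category
oneObject M = record
  { Obj       = ⊤
  ; Hom       = λ _ _ → M.setoid
  ; 1#        = λ _ → M.ε
  ; _∙_       = M._∙_
  ; ∙-cong    = M.∙-cong
  ; assoc     = M.assoc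
  ; identityˡ = M.identityˡ
  ; identityʳ = M.identityʳ
  }
  where module M = Monoid M

endomorphisms : (C : Category) → Category.Obj C → Monoid 0ℓ 0ℓ
endomorphisms C x = record
  { Carrier  = Arrow x x
  ; _≈_      = _≈_
  ; _∙_      = _∙_
  ; ε        = 1# x
  ; isMonoid = record
      { isSemigroup = record
          { isMagma = record { isEquivalence = Setoid.isEquivalence (Hom x x) ; ∙-cong = ∙-cong }
          ; assoc   = assoc
          }
      ; identity = identityˡ , identityʳ
      }
  }
  where open Category C

record _≺ᶜ_ (C D : Category) : Set₁ where
  private
    module C = Category C
    module D = Category D
  field
    obj        : C.Obj → D.Obj
    τ          : ∀ {e f} → C.Arrow e f → D.Arrow (obj e) (obj f) → Set
    τ-resp     : ∀ {e f} {x x′ : C.Arrow e f} {z z′ : D.Arrow (obj e) (obj f)} →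
                 x C.≈ x′ → z D.≈ z′ → τ x z → τ x′ z′
    τ-∙        : ∀ {e f g} {x : C.Arrow e f} {y : C.Arrow f g}
                 {z : D.Arrow (obj e) (obj f)} {w : D.Arrow (obj f) (obj g)} →
                 τ x z → τ y w → τ (x C.∙ y) (z D.∙ w)
    τ-total    : ∀ {e f} (x : C.Arrow e f) → ∃[ z ] τ x z
    τ-1        : ∀ e → τ (C.1# e) (D.1# (obj e))
    τ-disjoint : ∀ {e f} {x y : C.Arrow e f} → ¬ (x C.≈ y) →
                 ∀ z → ¬ (τ x z × τ y z)

-- The classes gV and ℓV; finiteness of the category is imposed in IsLocal.
DividesMonoidOf : ∀ {v} → Pred (Monoid 0ℓ 0ℓ) v → Pred Category (lsuc 0ℓ ⊔ v)
DividesMonoidOf V C = ∃[ M ] (V M × C ≺ᶜ oneObject M)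

LocallyIn : ∀ {v} → Pred (Monoid 0ℓ 0ℓ) v → Pred Category v
LocallyIn V C = ∀ x → V (endomorphisms C x)

IsLocal : ∀ {v} → Pred (Monoid 0ℓ 0ℓ) v → Set (lsuc 0ℓ ⊔ v)
IsLocal V = ∀ C → IsFiniteCategory C → DividesMonoidOf V C ⇔ LocallyIn V C

{-# OPTIONS --safe #-}
module Submission where

-- Mark every position of a word with its residue modulo d and with the next K
-- letters.  A predicate of LOC ∪ MOD becomes a set of marks, or a condition on
-- the first K letters, the last K letters and the length modulo d (the info of
-- the word).  So L is definable in the enrichment exactly when, for some d and K,
-- membership in L is determined by the info and by the image of the marked word
-- in a monoid N of V; we say that L is captured with modulus d.
--
-- If L is captured and e is an idempotent of the stable semigroup, represent e by
-- a word E longer than K of length divisible by d.  In E t₁ E t₂ … E tₖ E the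
-- marks of a block E t do not depend on the other blocks, so that eTe divides a
-- power of N.
--
-- Conversely, let the local monoids eTe be in V, and cut words into blocks of
-- length s.  By the pigeonhole principle, among any |M| + 1 consecutive suffixes of
-- the sequence of blocks (M finite, recognizing L) one is fixed on the left by an
-- idempotent, as can be seen from a bounded look-ahead.  The factors between such
-- places are arrows of the category of idempotents of T, which is in ℓV, hence
-- divides a monoid N of V; the product in N of images of these arrows determines
-- the composite arrow, and the info determines the two ends of the word.

open import Defs
open import Level using (0ℓ; _⊔_) renaming (suc to lsuc)
open import Algebra.Bundles using (Monoid; Semigroup)
open import Algebra.Construct.DirectProduct using () renaming (monoid to _×ᴹ_)
open import Algebra.Morphism.Structures using (module MonoidMorphisms)
open import Data.Bool.Base using (Bool; true)
open import Data.Empty using (⊥-elim)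
open import Data.Fin.Base as Fin using (Fin; zero; suc; toℕ; fromℕ<; cast; combine; remQuot; funToFin;
  finToFun)
open import Data.Fin.Properties as Fin using (pigeonhole; toℕ-fromℕ<; fromℕ<-cong; cast-trans;
  cast-is-id; remQuot-combine; combine-remQuot; combine-injective; finToFun-funToFin)
open import Data.Fin.Subset as Subset using (Subset; ⁅_⁆)
open import Data.Fin.Subset.Properties using (∪-idem; ∪-identityʳ; ∪-assoc)
open import Data.List.Base as List using (List; []; _∷_; _++_; _∷ʳ_; length; take; drop; reverse;
  filter; deduplicate; cartesianProductWith; allFin)
open import Data.List.Membership.Propositional using (_∈_)
open import Data.List.Membership.Propositional.Properties using (∈-allFin; ∈-lookup; ∈-filter⁺;
  ∈-filter⁻; ∈-cartesianProductWith⁺; ∈-cartesianProductWith⁻)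
import Data.List.Membership.Setoid as SetoidMembership
import Data.List.Membership.Setoid.Properties as SetoidMembershipₚ
open import Data.List.Properties using (++-assoc; ++-identityʳ; ++-monoid; ++-cancelˡ; ∷-injectiveˡ;
  ∷-injectiveʳ; length-++; length-take; length-drop; length-reverse; take++drop≡id; take-all;
  take-take; drop-drop; reverse-++; reverse-injective; unfold-reverse)
open import Data.List.Relation.Unary.All as All using (All)
open import Data.List.Relation.Unary.All.Properties using (all-filter)
open import Data.List.Relation.Unary.AllPairs using (AllPairs; []; _∷_)
open import Data.List.Relation.Unary.Any as Any using (Any; here; there)
open import Data.List.Relation.Unary.Any.Properties using (lookup-index; lookup-result)
import Data.List.Relation.Unary.Unique.DecSetoid.Properties as Unique
open import Data.Maybe.Base as Maybe using (Maybe; just; nothing)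
open import Data.Maybe.Properties using (just-injective)
open import Data.Nat.Base hiding (_⊔_; pred; compare)
open import Data.Nat.Divisibility using (_∣_; ∣-refl; ∣-trans; m∣m*n; n∣m*n)
open import Data.Nat.DivMod using (_%_; _/_; _mod_; %-distribˡ-+; m%n<n; m%n%n≡m%n; m<n⇒m%n≡m; n%n≡0;
  m*n%n≡0; [m+kn]%n≡m%n; m≡m%n+[m/n]*n; m∣n⇒o%n%m≡o%m)
open import Data.Nat.Properties
open import Data.Product.Base using (Σ-syntax; ∃; ∃-syntax; _×_; _,_; proj₁; proj₂)
open import Data.Sum.Base using (_⊎_; inj₁; inj₂)
open import Data.Unit.Base using (⊤; tt)
open import Data.Vec.Base as Vec using (Vec; []; _∷_; lookup; tabulate; tail; toList)
open import Data.Vec.Properties using (lookup∘tabulate; tabulate∘lookup; tabulate-cong; lookup-map;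
  map-cong; []=⇒lookup; lookup⇒[]=; length-toList)
open import Function.Base using (_∘_; id)
open import Function.Bundles using (Inverse; Equivalence; _⇔_; mk⇔)
open import Function.Construct.Identity using () renaming (inverse to idInverse)
open import Function.Properties.Equivalence using (⇔-isEquivalence)
open import Relation.Binary.Bundles using (Setoid; DecSetoid)
open import Relation.Binary.Construct.Closure.ReflexiveTransitive using (Star; ε; _◅_; _◅◅_; gmap)
open import Relation.Binary.Definitions using () renaming (Decidable to Decidable₂)
open import Relation.Binary.PropositionalEquality hiding ([_]; J; resp)
open import Relation.Binary.Structures using (IsEquivalence)
open import Relation.Nullary using (¬_; Dec; yes; no)
open import Relation.Nullary.Decidable using (map′; _×-dec_; _→-dec_; decidable-stable)
open import Relation.Unary using (Pred; Decidable)

open Equivalence using (to; from)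

-- Finiteness and decidability

-- Moduli are compared only through the local monoids: capture with any modulus puts them in `V`,
-- and from there capture is rebuilt with modulus `s`. Stability serves both directions: words of
-- length `s` and of length `k * s` have the same images, so an idempotent has representatives as
-- long and as divisible as desired, and products of blocks of length `s` stay in `T`.
--
-- A category is needed because the idempotents met along a word change from place to place: a
-- factor between two of them is an arrow, not an element of one local monoid. Locality sends all
-- these arrows into a single monoid of `V`. Arrows with different ends may then share an image, but
-- the first and the last idempotent, which tell in which hom-set the product is to be read, are
-- visible at the two ends of the word.
--
-- Everything has to be effective: formulas are obtained from decidable accepting sets. So syntactic
-- equality is tested on short contexts, images of homomorphisms are formed by pulling equality
-- back, and the existence of a word with given data is decided by pumping.

module _ (S : DecSetoid 0ℓ 0ℓ) where
  open DecSetoid S using (Carrier; _≈_)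
    renaming (_≟_ to _≈?_; setoid to ≈-setoid; refl to ≈-refl; sym to ≈-sym; trans to ≈-trans)
  open SetoidMembership ≈-setoid using () renaming (_∈_ to _∈ₛ_)

  private
    lookup-injective : ∀ {xs} → AllPairs (λ x y → ¬ (x ≈ y)) xs →
                       ∀ i j → List.lookup xs i ≈ List.lookup xs j → i ≡ j
    lookup-injective (_  ∷ _) zero    zero    _ = refl
    lookup-injective (px ∷ _) zero    (suc j) p =
        ⊥-elim (All.lookupₛ ≈-setoid (λ x≈y ¬z z≈y → ¬z (≈-trans z≈y (≈-sym x≈y))) px
        (SetoidMembershipₚ.∈-lookup ≈-setoid _ j) p)
    lookup-injective (px ∷ _) (suc i) zero    p =
        ⊥-elim (All.lookupₛ ≈-setoid (λ x≈y ¬z z≈y → ¬z (≈-trans z≈y (≈-sym x≈y))) px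
        (SetoidMembershipₚ.∈-lookup ≈-setoid _ i) (≈-sym p))
    lookup-injective (_  ∷ u) (suc i) (suc j) p = cong suc (lookup-injective u i j p)

  -- `IsFinite` asks for a bijection with some `Fin k`, so repetitions must first be removed from
  -- the enumeration; this takes decidable equality.
  enumerated⇒finite : ∀ xs → (∀ x → x ∈ₛ xs) → IsFinite ≈-setoid
  enumerated⇒finite xs complete = length ys , record
    { to        = position
    ; from      = List.lookup ys
    ; to-cong   = λ {x} {y} x≈y →
          unique _ _ (≈-trans (≈-sym (lookup-index (complete′ x))) (≈-trans x≈y (lookup-index (complete′ y))))
    ; from-cong = λ { refl → ≈-refl }
    ; inverse   = (λ {i} {x} x≈yᵢ → unique _ _ (≈-trans (≈-sym (lookup-index (complete′ x))) x≈yᵢ))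
                , (λ { {x} refl → ≈-sym (lookup-index (complete′ x)) })
    }
    where
    ys : List Carrier
    ys = deduplicate _≈?_ xs

    complete′ : ∀ x → x ∈ₛ ys
    complete′ x = SetoidMembershipₚ.∈-deduplicate⁺ ≈-setoid _≈?_ (λ c≈b a≈b → ≈-trans a≈b (≈-sym c≈b))
        (complete x)

    unique : ∀ i j → List.lookup ys i ≈ List.lookup ys j → i ≡ j
    unique = lookup-injective (Unique.deduplicate-! S xs)

    position : Carrier → Fin (length ys)
    position x = Any.index (complete′ x)

  surjection⇒finite : ∀ {k} (f : Fin k → Carrier) → (∀ x → ∃[ i ] f i ≈ x) → IsFinite ≈-setoid
  surjection⇒finite f onto = enumerated⇒finite (List.tabulate f) (λ x → let i , fi≈x = onto x in
    SetoidMembershipₚ.∈-resp-≈ ≈-setoid fi≈x (SetoidMembershipₚ.∈-tabulate⁺ ≈-setoid i))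

finite⇒decidable : ∀ {S : Setoid 0ℓ 0ℓ} → IsFinite S → Decidable₂ (Setoid._≈_ S)
finite⇒decidable {S} (_ , inv) x y = map′ to-injective I.to-cong (I.to x Fin.≟ I.to y)
  where
  module I = Inverse inv

  to-injective : I.to x ≡ I.to y → Setoid._≈_ S x y
  to-injective p = Setoid.trans S (Setoid.sym S (I.strictlyInverseʳ x))
      (Setoid.trans S (I.from-cong p) (I.strictlyInverseʳ y))

words : ∀ {n} → ℕ → List (Word n)
words zero    = [] ∷ []
words (suc k) = cartesianProductWith _∷_ (allFin _) (words k)

words-complete : ∀ {n} (w : Word n) → w ∈ words (length w)
words-complete []      = here refl
words-complete (x ∷ w) = ∈-cartesianProductWith⁺ _∷_ (∈-allFin x) (words-complete w)

words-sound : ∀ {n} k {w : Word n} → w ∈ words k → length w ≡ k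
words-sound zero    (here refl) = refl
words-sound (suc k) w∈ with ∈-cartesianProductWith⁻ _∷_ (allFin _) (words k) w∈
... | _ , _ , _ , v∈ , refl = cong suc (words-sound k v∈)

anyWord? : ∀ {n k} {P : Pred (Word n) 0ℓ} → Decidable P → Dec (∃[ w ] (length w ≡ k × P w))
anyWord? {k = k} {P} P? = map′ found lost (Any.any? P? (words k))
  where
  found : Any P (words k) → ∃[ w ] (length w ≡ k × P w)
  found p = Any.lookup p , words-sound k (∈-lookup (Any.index p)) , lookup-result p
  lost : ∃[ w ] (length w ≡ k × P w) → Any P (words k)
  lost (w , refl , p) = Any.map (λ { refl → p }) (words-complete w)

allWords? : ∀ {n k p} {P : Pred (Word n) p} → Decidable P → Dec (∀ w → length w ≡ k → P w)
allWords? {k = k} P? = map′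
  (λ { ps w refl → All.lookup ps (words-complete w) })
  (λ p → All.tabulate (λ {w} w∈ → p w (words-sound k w∈)))
  (All.all? P? (words k))

-- Pumping down: a word of length at least k has two suffixes with the same code.
module _ {n k} (code : Word n → Fin k)
         (code-∷ : ∀ x {u v} → code u ≡ code v → code (x ∷ u) ≡ code (x ∷ v)) where

  private
    code-++ : ∀ w {u v} → code u ≡ code v → code (w ++ u) ≡ code (w ++ v)
    code-++ []      p = p
    code-++ (x ∷ w) p = code-∷ x (code-++ w p)

    pumpDown : ∀ w → k ≤ length w → ∃[ v ] (length v < length w × code v ≡ code w)
    pumpDown w k≤|w| with pigeonhole (n<1+n k) (λ i → code (drop (toℕ i) w))
    ... | i , j , i<j , same =
      take (toℕ i) w ++ drop (toℕ j) w , shorter ,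
      trans (code-++ (take (toℕ i) w) (sym same)) (cong code (take++drop≡id (toℕ i) w))
      where
      j≤|w| : toℕ j ≤ length w
      j≤|w| = ≤-trans (≤-pred (Fin.toℕ<n j)) k≤|w|

      shorter : length (take (toℕ i) w ++ drop (toℕ j) w) < length w
      shorter = begin-strict
        length (take (toℕ i) w ++ drop (toℕ j) w)        ≡⟨ length-++ (take (toℕ i) w) ⟩
        length (take (toℕ i) w) + length (drop (toℕ j) w)
            ≡⟨ cong₂ _+_ (length-take (toℕ i) w) (length-drop (toℕ j) w) ⟩
        toℕ i ⊓ length w + (length w ∸ toℕ j)            ≤⟨ +-monoˡ-≤ _ (m⊓n≤m (toℕ i) (length w)) ⟩
        toℕ i + (length w ∸ toℕ j)                       <⟨ +-monoˡ-< _ i<j ⟩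
        toℕ j + (length w ∸ toℕ j)                       ≡⟨ m+[n∸m]≡n j≤|w| ⟩
        length w                                         ∎
        where open ≤-Reasoning

  -- The word is rebuilt from its last letter on. A new letter can raise the length to `k` at most,
  -- and then pumping down brings it below `k` again.
  shorten : ∀ u → ∃[ v ] (length v < k × code v ≡ code u)
  shorten []      = [] , ≤-trans (s≤s z≤n) (Fin.toℕ<n (code [])) , refl
  shorten (x ∷ u) with shorten u
  ... | v , |v|<k , v≡u with suc (length v) <? k
  ...   | yes |xv|<k = x ∷ v , |xv|<k , code-∷ x v≡u
  ...   | no  |xv|≮k with pumpDown (x ∷ v) (≮⇒≥ |xv|≮k)
  ...     | w , |w|<|xv| , w≡xv = w , ≤-trans |w|<|xv| |v|<k , trans w≡xv (code-∷ x v≡u)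

  -- A property that depends only on the code has a witness shorter than `k` as soon as it has one,
  -- so finitely many words need to be searched.
  reachable? : ∀ {P : Pred (Word n) 0ℓ} → Decidable P → (∀ {u v} → code u ≡ code v → P u → P v) → Dec (∃ P)
  reachable? {P} P? P-resp = map′
    (λ { (_ , _ , w , _ , p) → w , p })
    (λ { (u , p) → let v , |v|<k , v≡u = shorten u in
                   length v , |v|<k , v , refl , P-resp (sym v≡u) p })
    (anyUpTo? (λ l → anyWord? {k = l} P?) k)

-- A sequence whose terms determine their successors and that takes finitely
-- many values has two equal terms of indices a and a + p; then s = a p works.
module _ {k} (_≈_ : ℕ → ℕ → Set) (code : ℕ → Fin k)
         (≈-trans : ∀ {a b c} → a ≈ b → b ≈ c → a ≈ c)
         (code⇒≈ : ∀ {a b} → code a ≡ code b → a ≈ b)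
         (≈-suc : ∀ {a b} → a ≈ b → suc a ≈ suc b) where

  idempotentIndex : ∃[ s ] (0 < s × s ≈ (2 * s))
  -- Indices are shifted by one so that `a`, hence `s = a * p`, is positive. As `a ≤ s`, the index
  -- `s` lies in the periodic part, and adding `a` periods leads from `s` to `2 * s`.
  idempotentIndex with pigeonhole (n<1+n k) (λ i → code (suc (toℕ i)))
  ... | i , j , i<j , same = s , *-mono-≤ (s≤s (z≤n {toℕ i})) (m<n⇒0<n∸m i<j) ,
      subst (s ≈_) (cong (s +_) (sym (+-identityʳ s))) (periods a a≤s)
    where
    a p s : ℕ
    a = suc (toℕ i)
    p = toℕ j ∸ toℕ i
    s = a * p

    a≤s : a ≤ s
    a≤s = m≤m*n a p {{>-nonZero (m<n⇒0<n∸m i<j)}}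

    shift : ∀ c {a b} → a ≈ b → (c + a) ≈ (c + b)
    shift zero    r = r
    shift (suc c) r = ≈-suc (shift c r)

    period : ∀ {x} → a ≤ x → x ≈ (x + p)
    period {x} a≤x = subst₂ _≈_ (m∸n+n≡m a≤x) eq (shift (x ∸ a) (code⇒≈ same))
      where
      eq : x ∸ a + suc (toℕ j) ≡ x + p
      eq = begin
        x ∸ a + suc (toℕ j)        ≡⟨ cong (λ z → x ∸ a + suc z) (sym (m+[n∸m]≡n (<⇒≤ i<j))) ⟩
        x ∸ a + (a + p)            ≡⟨ sym (+-assoc (x ∸ a) a p) ⟩
        x ∸ a + a + p              ≡⟨ cong (_+ p) (m∸n+n≡m a≤x) ⟩
        x + p                      ∎
        where open ≡-Reasoning

    periods : ∀ m {x} → a ≤ x → x ≈ (x + m * p)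
    periods zero    {x} a≤x = subst (x ≈_) (sym (+-identityʳ x)) (code⇒≈ refl)
    periods (suc m) {x} a≤x = ≈-trans (period a≤x) (subst ((x + p) ≈_) (+-assoc x p (m * p))
        (periods m (m≤n⇒m≤n+o p a≤x)))

-- Homomorphisms into a variety

IsHom : (X N : Monoid 0ℓ 0ℓ) → (Monoid.Carrier X → Monoid.Carrier N) → Set
IsHom X N = MonoidMorphisms.IsMonoidHomomorphism (Monoid.rawMonoid X) (Monoid.rawMonoid N)

mkHom : ∀ (X N : Monoid 0ℓ 0ℓ) {h} → let module X = Monoid X ; module N = Monoid N in
        (∀ {x y} → x X.≈ y → h x N.≈ h y) → (∀ x y → h (x X.∙ y) N.≈ h x N.∙ h y) → h X.ε N.≈ N.ε →
            IsHom X N h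
mkHom X N cong homo ε-homo = record
  { isMagmaHomomorphism = record { isRelHomomorphism = record { cong = cong } ; homo = homo }
  ; ε-homo = ε-homo }

-- The image of `h` is represented by the carrier of `X` with the equality of `N` pulled back along
-- `h`. Then `h` is injective by definition, and the kernel condition makes `π` respect the new
-- equality.
≺-intro : ∀ (X : Monoid 0ℓ 0ℓ) {M N : Monoid 0ℓ 0ℓ} →
    let module X = Monoid X ; module M = Monoid M ; module N = Monoid N in
          ∀ (π : X.Carrier → M.Carrier) (h : X.Carrier → N.Carrier) → IsHom X M π → IsHom X N h →
          (∀ m → ∃[ x ] π x M.≈ m) → (∀ {x y} → h x N.≈ h y → π x M.≈ π y) → M ≺ N
≺-intro X {M} {N} π h π-hom h-hom π-onto kernel = record
  { sub = record
    { Carrier = X.Carrier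
    ; _≈_ = λ x y → h x N.≈ h y
    ; _∙_ = X._∙_
    ; ε = X.ε
    ; isMonoid = record
      { isSemigroup = record
        { isMagma = record
          { isEquivalence = record { refl = N.refl ; sym = N.sym ; trans = N.trans }
          ; ∙-cong = λ {x} {y} {u} {v} p q →
                N.trans (H.homo x u) (N.trans (N.∙-cong p q) (N.sym (H.homo y v))) }
        ; assoc = λ x y z → H.⟦⟧-cong (X.assoc x y z) }
      ; identity = (λ x → H.⟦⟧-cong (X.identityˡ x)) , (λ x → H.⟦⟧-cong (X.identityʳ x)) } }
  ; ι = h
  ; π = π
  ; ι-mono = record
    { isMonoidHomomorphism = record
      { isMagmaHomomorphism = record { isRelHomomorphism = record { cong = id } ; homo = H.homo }
      ; ε-homo = H.ε-homo }
    ; injective = id }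
  ; π-homo = record
    { isMagmaHomomorphism = record { isRelHomomorphism = record { cong = kernel } ; homo = P.homo }
    ; ε-homo = P.ε-homo }
  ; π-surjective = λ m → let x , πx≈m = π-onto m in x , λ hz≈hx → M.trans (kernel hz≈hx) πx≈m
  }
  where
  module X = Monoid X
  module M = Monoid M
  module N = Monoid N
  module H = MonoidMorphisms.IsMonoidHomomorphism h-hom
  module P = MonoidMorphisms.IsMonoidHomomorphism π-hom

record HomInto {v} (V : Pred (Monoid 0ℓ 0ℓ) v) (X : Monoid 0ℓ 0ℓ) : Set (lsuc 0ℓ ⊔ v) where
  field
    target : Monoid 0ℓ 0ℓ
    in-V   : V target
    hom    : Monoid.Carrier X → Monoid.Carrier target
    isHom  : IsHom X target hom

  Kernel : Monoid.Carrier X → Monoid.Carrier X → Set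
  Kernel x y = Monoid._≈_ target (hom x) (hom y)

module _ {v} {V : Pred (Monoid 0ℓ 0ℓ) v} (isVariety : IsVariety V) where
  open IsVariety isVariety

  -- The product of the targets handles finitely many homomorphisms at once; for the empty family
  -- the constant map to the unit of some member of `V` serves.
  jointHom : ∀ {X : Monoid 0ℓ 0ℓ} {k} (fam : Fin k → HomInto V X) →
             Σ[ J ∈ HomInto V X ] (∀ {x y} → HomInto.Kernel J x y → ∀ i → HomInto.Kernel (fam i) x y)
  jointHom {X} {zero} fam = record
    { target = N ; in-V = proj₂ nonempty ; hom = λ _ → N.ε
    ; isHom = mkHom X N (λ _ → N.refl) (λ _ _ → N.sym (N.identityˡ N.ε)) N.refl } , λ _ ()
    where
    N = proj₁ nonempty
    module N = Monoid N
  jointHom {X} {suc k} fam with jointHom (fam ∘ suc)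
  ... | J , J-kernel = record
    { target = H₀.target ×ᴹ J.target
    ; in-V = ×-closed H₀.in-V J.in-V
    ; hom = λ x → H₀.hom x , J.hom x
    ; isHom = mkHom X (H₀.target ×ᴹ J.target) (λ p → I₀.⟦⟧-cong p , I.⟦⟧-cong p) (λ x y → I₀.homo x y ,
          I.homo x y) (I₀.ε-homo , I.ε-homo)
    } , λ { (p , q) zero → p ; (p , q) (suc i) → J-kernel q i }
    where
    module H₀ = HomInto (fam zero)
    module J = HomInto J
    module I₀ = MonoidMorphisms.IsMonoidHomomorphism H₀.isHom
    module I = MonoidMorphisms.IsMonoidHomomorphism J.isHom

-- Regular languages

-- A recognizing finite monoid with numbered elements: equality of numbers is a decidable congruence
-- of finite index, finer than the syntactic one.
record FiniteIndex {n} (L : Language n) : Set where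
  field
    index     : ℕ
    ψ         : Word n → Fin index
    ψ-++      : ∀ {u u′ v v′} → ψ u ≡ ψ u′ → ψ v ≡ ψ v′ → ψ (u ++ v) ≡ ψ (u′ ++ v′)
    L-resp    : ∀ {u v} → ψ u ≡ ψ v → L u → L v
    L?        : Decidable L

regular⇒finiteIndex : ∀ {n} {L : Language n} → Regular L → FiniteIndex L
regular⇒finiteIndex {n} {L} (M , (k , inv) , rec) = record
  { index  = k
  ; ψ      = ψ
  ; ψ-++   = λ {u} {u′} {v} {v′} p q → I.to-cong (M.trans (H.homo u v)
               (M.trans (M.∙-cong (ψ⇒≈ p) (ψ⇒≈ q)) (M.sym (H.homo u′ v′))))
  ; L-resp = λ {u} {v} p Lu → from (recognizes v) (Accept-resp (ψ⇒≈ p) (to (recognizes u) Lu))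
  ; L?     = λ u → map′ (from (recognizes u)) (to (recognizes u)) (Accept? (φ u))
  }
  where
  module M = Monoid M
  module I = Inverse inv
  open _Recognizes_ rec
  module H = MonoidMorphisms.IsMonoidHomomorphism φ-morphism

  ψ : Word n → Fin k
  ψ u = I.to (φ u)

  ψ⇒≈ : ∀ {u v} → ψ u ≡ ψ v → φ u M.≈ φ v
  ψ⇒≈ {u} {v} p = M.trans (M.sym (I.strictlyInverseʳ (φ u)))
      (M.trans (I.from-cong p) (I.strictlyInverseʳ (φ v)))

_⇔-dec_ : ∀ {a b} {A : Set a} {B : Set b} → Dec A → Dec B → Dec (A ⇔ B)
A? ⇔-dec B? = map′ (λ (f , g) → mk⇔ f g) (λ e → to e , from e) ((A? →-dec B?) ×-dec (B? →-dec A?))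

module RegularLanguage {n} {L : Language n} (fin : FiniteIndex L) where
  open FiniteIndex fin public

  private
    _∼_ : Word n → Word n → Set
    u ∼ v = SyntacticCongruence L u v

  ψ⇒∼ : ∀ {u v} → ψ u ≡ ψ v → SyntacticCongruence L u v
  ψ⇒∼ p x y = mk⇔ (L-resp (ψ-++ {x} refl (ψ-++ {v = y} p refl)))
      (L-resp (ψ-++ {x} refl (ψ-++ {v = y} (sym p) refl)))

  private
    short : ∀ u → ∃[ v ] (length v < index × ψ v ≡ ψ u)
    short = shorten ψ (λ x → ψ-++ refl)

  abstract
    -- It suffices to test contexts that are short.
    _∼?_ : Decidable₂ (SyntacticCongruence L)
    u ∼? v = map′ extend (λ u∼v _ p _ _ q _ → u∼v p q)
      (allUpTo? (λ i → allWords?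
          (λ p → allUpTo? (λ j → allWords? {k = j} (λ q → L? (p ++ u ++ q) ⇔-dec L? (p ++ v ++ q)))
          index)) index)
      where
      extend : (∀ {i} → i < index → ∀ p → length p ≡ i → ∀ {j} → j < index → ∀ q → length q ≡ j →
                L (p ++ u ++ q) ⇔ L (p ++ v ++ q)) → u ∼ v
      extend hyp p q =
        let p′ , |p′| , p′≡p = short p
            q′ , |q′| , q′≡q = short q
            e = hyp |p′| p′ refl |q′| q′ refl
        in mk⇔ (λ Lu → L-resp (ψ-++ p′≡p (ψ-++ refl q′≡q))
            (to e (L-resp (ψ-++ (sym p′≡p) (ψ-++ refl (sym q′≡q))) Lu)))
               (λ Lv → L-resp (ψ-++ p′≡p (ψ-++ refl q′≡q))
                   (from e (L-resp (ψ-++ (sym p′≡p) (ψ-++ refl (sym q′≡q))) Lv)))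

  private
    bit : ∀ {p} {P : Set p} → Dec P → Fin 2
    bit (yes _) = zero
    bit (no _)  = suc zero

    bit⁻ : ∀ {p q} {P : Set p} {Q : Set q} (P? : Dec P) (Q? : Dec Q) → bit P? ≡ bit Q? → P → Q
    bit⁻ (yes _) (yes q) _ _ = q
    bit⁻ (no ¬p) _       _ p with () ← ¬p p
    bit⁻ (yes _) (no _)  ()

    _≲_ : ℕ → ℕ → Set
    a ≲ b = ∀ w → length w ≡ a → ∃[ w′ ] (length w′ ≡ b × ψ w′ ≡ ψ w)

    -- The set of values of `ψ` on the words of length `a`, as a bit vector. There are `2 ^ index`
    -- such sets, and each determines the one for `suc a`.
    code : ℕ → Fin (2 ^ index)
    code a = funToFin (λ i → bit (anyWord? {k = a} (λ w → ψ w Fin.≟ i)))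

    code⇒≲ : ∀ {a b} → code a ≡ code b → a ≲ b
    code⇒≲ {a} {b} p w |w|≡a = bit⁻ (anyWord? (λ w′ → ψ w′ Fin.≟ ψ w))
        (anyWord? (λ w′ → ψ w′ Fin.≟ ψ w)) bits (w , |w|≡a , refl)
      where
      bits : bit (anyWord? {k = a} (λ w′ → ψ w′ Fin.≟ ψ w)) ≡ bit (anyWord? {k = b} (λ w′ → ψ w′ Fin.≟ ψ w))
      bits = trans (sym (finToFun-funToFin _ (ψ w))) (trans (cong (λ c → finToFun c (ψ w)) p)
          (finToFun-funToFin _ (ψ w)))

    ≲-trans : ∀ {a b c} → a ≲ b → b ≲ c → a ≲ c
    ≲-trans p q w |w| = let w′ , |w′| , e = p w |w| ; w″ , |w″| , e′ = q w′ |w′| in w″ , |w″| , trans e′ e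

    ≲-suc : ∀ {a b} → a ≲ b → suc a ≲ suc b
    ≲-suc p (x ∷ w) |xw| = let w′ , |w′| , e = p w (suc-injective |xw|) in x ∷ w′ , cong suc |w′| ,
        ψ-++ {u = x ∷ []} refl e

    ≲⇒⊆ : ∀ {a b} → a ≲ b → ∀ {m} → Image (syntacticMonoid L) id a m → Image (syntacticMonoid L) id b m
    ≲⇒⊆ p (w , |w| , w∼m) = let w′ , |w′| , e = p w |w| in
      w′ , |w′| , Monoid.trans (syntacticMonoid L) (ψ⇒∼ e) w∼m

  -- Supplies an exponent to the decision procedure, which is given only a recognizing monoid. It is
  -- found on the images under `ψ` and passes to the coarser syntactic congruence.
  stableIndex : ∃[ s ] (0 < s × IsStable (syntacticMonoid L) id s)
  stableIndex =
    let s , 0<s , p , q = idempotentIndex (λ a b → a ≲ b × b ≲ a) code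
                            (λ (p , q) (p′ , q′) → ≲-trans p p′ , ≲-trans q′ q)
                            (λ p → code⇒≲ p , code⇒≲ (sym p))
                            (λ (p , q) → ≲-suc p , ≲-suc q)
    in s , 0<s , ≲⇒⊆ p , ≲⇒⊆ q

-- Words truncated to a prefix

take-pred : ∀ {A : Set} k {u v : List A} → take (suc k) u ≡ take (suc k) v → take k u ≡ take k v
take-pred zero    _ = refl
take-pred (suc k) {[]}    {[]}    _ = refl
take-pred (suc k) {[]}    {_ ∷ _} ()
take-pred (suc k) {_ ∷ _} {[]}    ()
take-pred (suc k) {_ ∷ _} {_ ∷ _} p = cong₂ _∷_ (∷-injectiveˡ p) (take-pred k (∷-injectiveʳ p))

take-congʳ : ∀ {A : Set} k (w : List A) {u v} → take k u ≡ take k v → take k (w ++ u) ≡ take k (w ++ v)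
take-congʳ k       []      p = p
take-congʳ zero    (x ∷ w) p = refl
take-congʳ (suc k) (x ∷ w) p = cong (x ∷_) (take-congʳ k w (take-pred k p))

take-congˡ : ∀ {A : Set} k {u v : List A} w → take k u ≡ take k v → take k (u ++ w) ≡ take k (v ++ w)
take-congˡ zero    w p = refl
take-congˡ (suc k) {[]}    {[]}    w p = refl
take-congˡ (suc k) {[]}    {_ ∷ _} w ()
take-congˡ (suc k) {_ ∷ _} {[]}    w ()
take-congˡ (suc k) {_ ∷ _} {_ ∷ _} w p = cong₂ _∷_ (∷-injectiveˡ p) (take-congˡ k w (∷-injectiveʳ p))

take-++-≤ : ∀ {A : Set} k (u : List A) v → k ≤ length u → take k (u ++ v) ≡ take k u
take-++-≤ zero    u       v _ = refl
take-++-≤ (suc k) (x ∷ u) v (s≤s k≤|u|) = cong (x ∷_) (take-++-≤ k u v k≤|u|)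

-- Fin (size n k) numbers the words of length at most k over Fin n.
size : ℕ → ℕ → ℕ
size n zero    = 1
size n (suc k) = suc (n * size n k)

window : ∀ {n} k → Word n → Fin (size n k)
window zero    u       = zero
window (suc k) []      = zero
window (suc k) (x ∷ u) = suc (combine x (window k u))

unwindow : ∀ {n} k → Fin (size n k) → Word n
unwindow     zero    c       = []
unwindow     (suc k) zero    = []
unwindow {n} (suc k) (suc c) = let x , c′ = remQuot {n} (size n k) c in x ∷ unwindow k c′

unwindow-window : ∀ {n} k (u : Word n) → unwindow k (window k u) ≡ take k u
unwindow-window zero    u       = refl
unwindow-window (suc k) []      = refl
unwindow-window (suc k) (x ∷ u) = trans
  (cong (λ (y , c) → y ∷ unwindow k c) (remQuot-combine x (window k u))) (cong (x ∷_) (unwindow-window k u))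

window-unwindow : ∀ {n} k (c : Fin (size n k)) → window k (unwindow k c) ≡ c
window-unwindow     zero    zero    = refl
window-unwindow     (suc k) zero    = refl
window-unwindow {n} (suc k) (suc c) =
  cong suc (trans (cong (combine (proj₁ (remQuot {n} (size n k) c))) (window-unwindow k _))
      (combine-remQuot {n} (size n k) c))

window-cong : ∀ {n} k {u v : Word n} → take k u ≡ take k v → window k u ≡ window k v
window-cong k {u} {v} p = begin
  window k u                          ≡⟨ window-unwindow k (window k u) ⟨
  window k (unwindow k (window k u))
      ≡⟨ cong (window k) (trans (unwindow-window k u) (trans p (sym (unwindow-window k v)))) ⟩
  window k (unwindow k (window k v))  ≡⟨ window-unwindow k (window k v) ⟩
  window k v                          ∎
  where open ≡-Reasoning

-- Residues

mod-% : ∀ {d} m m′ → m % suc d ≡ m′ % suc d → m mod suc d ≡ m′ mod suc d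
mod-% m m′ p = fromℕ<-cong _ _ p _ _

%-mod : ∀ {d} m m′ → m mod suc d ≡ m′ mod suc d → m % suc d ≡ m′ % suc d
%-mod m m′ p = trans (sym (toℕ-fromℕ< _)) (trans (cong toℕ p) (toℕ-fromℕ< _))

mod-+ : ∀ {d} m m′ k k′ → m mod suc d ≡ m′ mod suc d → k mod suc d ≡ k′ mod suc d →
    (m + k) mod suc d ≡ (m′ + k′) mod suc d
mod-+ {d} m m′ k k′ p q = mod-% (m + k) (m′ + k′) (trans (%-distribˡ-+ m k (suc d))
  (trans (cong₂ (λ x y → (x + y) % suc d) (%-mod m m′ p) (%-mod k k′ q)) (sym (%-distribˡ-+ m′ k′ (suc d)))))

-- Marked words

module _ {n : ℕ} (d K : ℕ) where

  Mark : ℕ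
  Mark = suc d * size n K

  -- enc r u z marks each position of u, the first being numbered r, with its
  -- residue and with the K letters starting there; z is what follows u.
  enc : ℕ → Word n → Word n → Word Mark
  enc r []      z = []
  enc r (x ∷ u) z = combine (r mod suc d) (window K (x ∷ u ++ z)) ∷ enc (suc r) u z

  length-enc : ∀ r u z → length (enc r u z) ≡ length u
  length-enc r []      z = refl
  length-enc r (x ∷ u) z = cong suc (length-enc (suc r) u z)

  enc-++ : ∀ r u v z → enc r (u ++ v) z ≡ enc r u (v ++ z) ++ enc (r + length u) v z
  enc-++ r []      v z = cong (λ m → enc m v z) (sym (+-identityʳ r))
  enc-++ r (x ∷ u) v z = cong₂ _∷_
    (cong (λ w → combine (r mod suc d) (window K (x ∷ w))) (++-assoc u v z))
    (trans (enc-++ (suc r) u v z) (cong (λ m → enc (suc r) u (v ++ z) ++ enc m v z)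
        (sym (+-suc r (length u)))))

  enc-residue : ∀ {r r′} u z → r mod suc d ≡ r′ mod suc d → enc r u z ≡ enc r′ u z
  enc-residue []      z p = refl
  enc-residue {r} {r′} (x ∷ u) z p = cong₂ _∷_ (cong (λ c → combine c _) p)
      (enc-residue u z (mod-+ 1 1 r r′ refl p))

  enc-context : ∀ r u {z z′} → take K z ≡ take K z′ → enc r u z ≡ enc r u z′
  enc-context r []      p = refl
  enc-context r (x ∷ u) p =
      cong₂ _∷_ (cong (combine (r mod suc d)) (window-cong K (take-congʳ K (x ∷ u) p)))
      (enc-context (suc r) u p)

  lookup-enc : ∀ r u z (p : Position u) q → toℕ q ≡ toℕ p →
               List.lookup (enc r u z) q ≡ combine ((r + toℕ p) mod suc d) (window K (drop (toℕ p) u ++ z))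
  lookup-enc r (x ∷ u) z zero    zero    _ = cong (λ m → combine (m mod suc d) _) (sym (+-identityʳ r))
  lookup-enc r (x ∷ u) z (suc p) (suc q) e =
    trans (lookup-enc (suc r) u z p q (suc-injective e))
        (cong (λ m → combine (m mod suc d) (window K (drop (toℕ p) u ++ z))) (sym (+-suc r (toℕ p))))

  Info : ℕ
  Info = size n K * size n K * suc d

  info : Word n → Fin Info
  info u = combine (combine (window K u) (window K (reverse u))) (length u mod suc d)

  split : Fin Info → (Fin (size n K) × Fin (size n K)) × Fin (suc d)
  split c = let b , r = remQuot {size n K * size n K} (suc d) c in remQuot {size n K} (size n K) b , r

  split-info : ∀ u → split (info u) ≡ ((window K u , window K (reverse u)) , length u mod suc d)
  split-info u = trans
    (cong (λ (b , r) → remQuot {size n K} (size n K) b , r)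
        (remQuot-combine (combine (window K u) (window K (reverse u))) (length u mod suc d)))
    (cong (λ b → b , (length u mod suc d)) (remQuot-combine (window K u) (window K (reverse u))))

  prefixOf suffixOf : Fin Info → Word n
  prefixOf c = unwindow K (proj₁ (proj₁ (split c)))
  suffixOf c = unwindow K (proj₂ (proj₁ (split c)))

  residueOf : Fin Info → Fin (suc d)
  residueOf c = proj₂ (split c)

  prefixOf-info : ∀ u → prefixOf (info u) ≡ take K u
  prefixOf-info u = trans (cong (λ x → unwindow K (proj₁ (proj₁ x))) (split-info u)) (unwindow-window K u)

  suffixOf-info : ∀ u → suffixOf (info u) ≡ take K (reverse u)
  suffixOf-info u = trans (cong (λ x → unwindow K (proj₂ (proj₁ x))) (split-info u))
      (unwindow-window K (reverse u))

  residueOf-info : ∀ u → residueOf (info u) ≡ length u mod suc d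
  residueOf-info u = cong proj₂ (split-info u)

  info-cong : ∀ {u v} → take K u ≡ take K v → take K (reverse u) ≡ take K (reverse v) →
              length u mod suc d ≡ length v mod suc d → info u ≡ info v
  info-cong p q r = cong₂ combine (cong₂ combine (window-cong K p) (window-cong K q)) r

  info-unique : ∀ u c → take K u ≡ prefixOf c → take K (reverse u) ≡ suffixOf c →
      length u mod suc d ≡ residueOf c → info u ≡ c
  info-unique u c p q r = trans
    (cong₂ combine (trans (cong₂ combine (window≡ p) (window≡ q))
        (combine-remQuot {size n K} (size n K) (proj₁ (remQuot {size n K * size n K} (suc d) c)))) r)
    (combine-remQuot {size n K * size n K} (suc d) c)
    where
    window≡ : ∀ {w : Word n} {b} → take K w ≡ unwindow K b → window K w ≡ b
    window≡ {w} e = trans (sym (window-unwindow K (window K w)))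
        (trans (cong (window K) (trans (unwindow-window K w) e)) (window-unwindow K _))

record Captured {v} (V : Pred (Monoid 0ℓ 0ℓ) v) {n} (L : Language n) (d : ℕ) : Set (lsuc 0ℓ ⊔ v) where
  field
    K        : ℕ
    J        : HomInto V (++-monoid (Fin (Mark {n} d K)))
    captures : ∀ u v → info d K u ≡ info d K v → HomInto.Kernel J (enc d K 0 u []) (enc d K 0 v []) →
        L u → L v

-- Letters at given places

carriesAt? : ∀ {n} (u : Word n) a j → Dec (CarriesAt u a j)
carriesAt? []      a j       = no λ ()
carriesAt? (x ∷ u) a zero    = map′ (λ p → zero , refl , p) (λ { (zero , refl , p) → p }) (toℕ x ≟ a)
carriesAt? (x ∷ u) a (suc j) = map′ (λ (p , e , q) → suc p , cong suc e , q)
    (λ { (suc p , e , q) → p , suc-injective e , q }) (carriesAt? u a j)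

carriesAt-∷ : ∀ {n x} {u : Word n} {a j} → CarriesAt (x ∷ u) a (suc j) ⇔ CarriesAt u a j
carriesAt-∷ = mk⇔ (λ { (suc p , e , q) → p , suc-injective e , q }) (λ (p , e , q) → suc p , cong suc e , q)

carriesAt-take : ∀ {n} k (u : Word n) {a j} → j < k → CarriesAt (take k u) a j ⇔ CarriesAt u a j
carriesAt-take (suc k) []      _ = mk⇔ (λ { (() , _) }) (λ { (() , _) })
carriesAt-take (suc k) (x ∷ u) {j = zero}  _ = mk⇔ (λ { (zero , p) → zero , p }) (λ { (zero , p) → zero , p })
carriesAt-take (suc k) (x ∷ u) {j = suc j} (s≤s j<k) = mk⇔
  (λ p → from (carriesAt-∷ {x = x}) (to (carriesAt-take k u j<k) (to (carriesAt-∷ {x = x}) p)))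
  (λ p → from (carriesAt-∷ {x = x}) (from (carriesAt-take k u j<k) (to (carriesAt-∷ {x = x}) p)))

carriesAt-drop : ∀ {n} i (u : Word n) {a j} → CarriesAt (drop i u) a j ⇔ CarriesAt u a (i + j)
carriesAt-drop zero    u       = mk⇔ id id
carriesAt-drop (suc i) []      = mk⇔ (λ { (() , _) }) (λ { (() , _) })
carriesAt-drop (suc i) (x ∷ u) = mk⇔
  (λ p → from (carriesAt-∷ {x = x}) (to (carriesAt-drop i u) p))
  (λ p → from (carriesAt-drop i u) (to (carriesAt-∷ {x = x}) p))

carriesAt-∷ʳ⁺ˡ : ∀ {n} (u : Word n) x {a j} → CarriesAt u a j → CarriesAt (u ∷ʳ x) a j
carriesAt-∷ʳ⁺ˡ (y ∷ u) x (zero  , p)     = zero , p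
carriesAt-∷ʳ⁺ˡ (y ∷ u) x (suc p , refl , q) = from (carriesAt-∷ {x = y}) (carriesAt-∷ʳ⁺ˡ u x (p , refl , q))

carriesAt-∷ʳ⁺ʳ : ∀ {n} (u : Word n) x → CarriesAt (u ∷ʳ x) (toℕ x) (length u)
carriesAt-∷ʳ⁺ʳ []      x = zero , refl , refl
carriesAt-∷ʳ⁺ʳ (y ∷ u) x = from (carriesAt-∷ {x = y}) (carriesAt-∷ʳ⁺ʳ u x)

carriesAt-∷ʳ⁻ : ∀ {n} (u : Word n) x {a j} → CarriesAt (u ∷ʳ x) a j →
    CarriesAt u a j ⊎ (j ≡ length u × toℕ x ≡ a)
carriesAt-∷ʳ⁻ []      x (zero , refl , q) = inj₂ (refl , q)
carriesAt-∷ʳ⁻ (y ∷ u) x (zero , p) = inj₁ (zero , p)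
carriesAt-∷ʳ⁻ (y ∷ u) x (suc p , refl , q) with carriesAt-∷ʳ⁻ u x (p , refl , q)
... | inj₁ r        = inj₁ (from (carriesAt-∷ {x = y}) r)
... | inj₂ (e , r) = inj₂ (cong suc e , r)

-- Turns predicates counted from the last position into conditions on a prefix of the reversed word,
-- so that both ends of a word are treated alike.
carriesAt-reverse : ∀ {n} (u : Word n) {a k} →
                    (∃[ j ] (suc (j + k) ≡ length u × CarriesAt u a j)) ⇔ CarriesAt (reverse u) a k
carriesAt-reverse []      = mk⇔ (λ ()) (λ { (() , _) })
carriesAt-reverse (x ∷ u) {a} {k} rewrite unfold-reverse x u = mk⇔ forth back
  where
  forth : (∃[ j ] (suc (j + k) ≡ suc (length u) × CarriesAt (x ∷ u) a j)) → CarriesAt (reverse u ∷ʳ x) a k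
  forth (zero  , e , zero , refl , refl) =
    subst (CarriesAt (reverse u ∷ʳ x) a) (trans (length-reverse u) (sym (suc-injective e)))
        (carriesAt-∷ʳ⁺ʳ (reverse u) x)
  forth (suc j , e , c) = carriesAt-∷ʳ⁺ˡ (reverse u) x
    (to (carriesAt-reverse u) (j , suc-injective e , to (carriesAt-∷ {x = x}) c))

  back : CarriesAt (reverse u ∷ʳ x) a k → ∃[ j ] (suc (j + k) ≡ suc (length u) × CarriesAt (x ∷ u) a j)
  back c with carriesAt-∷ʳ⁻ (reverse u) x c
  ... | inj₁ c′ = let j , e , r = from (carriesAt-reverse u) c′ in
                  suc j , cong suc e , from (carriesAt-∷ {x = x}) r
  ... | inj₂ (e , p) = zero , cong suc (trans e (length-reverse u)) , zero , refl , p

-- Substitution of quantifier-free formulas for atoms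

-- A replacement step must keep the free variables, so a formula meant to replace an atom carries
-- the proof that its first-order variables are exactly `S` and that it has no set variables.
record QFFormula (P : Predicates) (m p : ℕ) (S : Subset m) : Set where
  field
    formula : Formula P m p
    qf      : QuantifierFree formula
    fv₁≡    : fv₁ formula ≡ S
    fv₂≡    : fv₂ formula ≡ Subset.⊥

open QFFormula

record Interpretation (P P′ : Predicates) : Set where
  private module P = Predicates P
  field
    letterᴵ : ∀ {m p} → ℕ → (x : Fin m) → QFFormula P′ m p ⁅ x ⁆
    predᴵ   : ∀ {m p} (R : P.Sym) (xs : Vec (Fin m) (P.arity R)) →
              QFFormula P′ m p (Subset.⋃ (toList (Vec.map ⁅_⁆ xs)))

letterQF : ∀ {P m p} → ℕ → (x : Fin m) → QFFormula P m p ⁅ x ⁆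
letterQF a x = record { formula = letter a x ; qf = letter a x ; fv₁≡ = refl ; fv₂≡ = refl }

predQF : ∀ {P m p} (R : Predicates.Sym P) (xs : Vec (Fin m) (Predicates.arity P R)) →
         QFFormula P m p (Subset.⋃ (toList (Vec.map ⁅_⁆ xs)))
predQF R xs = record { formula = pred R xs ; qf = pred R xs ; fv₁≡ = refl ; fv₂≡ = refl }

module _ {P P′} (I : Interpretation P P′) where
  open Interpretation I

  sub : ∀ {m p} → Formula P m p → Formula P′ m p
  sub ⊤ᶠ           = ⊤ᶠ
  sub ⊥ᶠ           = ⊥ᶠ
  sub (letter a x) = formula (letterᴵ a x)
  sub (pred R xs)  = formula (predᴵ R xs)
  sub (member X x) = member X x
  sub (¬ᶠ φ)       = ¬ᶠ sub φ
  sub (φ ∧ᶠ ψ)     = sub φ ∧ᶠ sub ψ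
  sub (φ ∨ᶠ ψ)     = sub φ ∨ᶠ sub ψ
  sub (∃₁ φ)       = ∃₁ (sub φ)
  sub (∀₁ φ)       = ∀₁ (sub φ)
  sub (∃₂ φ)       = ∃₂ (sub φ)
  sub (∀₂ φ)       = ∀₂ (sub φ)

  sub-qf : ∀ {m p} {φ : Formula P m p} → QuantifierFree φ → QuantifierFree (sub φ)
  sub-qf ⊤ᶠ           = ⊤ᶠ
  sub-qf ⊥ᶠ           = ⊥ᶠ
  sub-qf (letter a x) = qf (letterᴵ a x)
  sub-qf (pred R xs)  = qf (predᴵ R xs)
  sub-qf (member X x) = member X x
  sub-qf (¬ᶠ q)       = ¬ᶠ sub-qf q
  sub-qf (q ∧ᶠ r)     = sub-qf q ∧ᶠ sub-qf r
  sub-qf (q ∨ᶠ r)     = sub-qf q ∨ᶠ sub-qf r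

  sub-fv₁ : ∀ {m p} (φ : Formula P m p) → fv₁ (sub φ) ≡ fv₁ φ
  sub-fv₁ ⊤ᶠ           = refl
  sub-fv₁ ⊥ᶠ           = refl
  sub-fv₁ (letter a x) = fv₁≡ (letterᴵ a x)
  sub-fv₁ (pred R xs)  = fv₁≡ (predᴵ R xs)
  sub-fv₁ (member X x) = refl
  sub-fv₁ (¬ᶠ φ)       = sub-fv₁ φ
  sub-fv₁ (φ ∧ᶠ ψ)     = cong₂ Subset._∪_ (sub-fv₁ φ) (sub-fv₁ ψ)
  sub-fv₁ (φ ∨ᶠ ψ)     = cong₂ Subset._∪_ (sub-fv₁ φ) (sub-fv₁ ψ)
  sub-fv₁ (∃₁ φ)       = cong tail (sub-fv₁ φ)
  sub-fv₁ (∀₁ φ)       = cong tail (sub-fv₁ φ)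
  sub-fv₁ (∃₂ φ)       = sub-fv₁ φ
  sub-fv₁ (∀₂ φ)       = sub-fv₁ φ

  sub-fv₂ : ∀ {m p} (φ : Formula P m p) → fv₂ (sub φ) ≡ fv₂ φ
  sub-fv₂ ⊤ᶠ           = refl
  sub-fv₂ ⊥ᶠ           = refl
  sub-fv₂ (letter a x) = fv₂≡ (letterᴵ a x)
  sub-fv₂ (pred R xs)  = fv₂≡ (predᴵ R xs)
  sub-fv₂ (member X x) = refl
  sub-fv₂ (¬ᶠ φ)       = sub-fv₂ φ
  sub-fv₂ (φ ∧ᶠ ψ)     = cong₂ Subset._∪_ (sub-fv₂ φ) (sub-fv₂ ψ)
  sub-fv₂ (φ ∨ᶠ ψ)     = cong₂ Subset._∪_ (sub-fv₂ φ) (sub-fv₂ ψ)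
  sub-fv₂ (∃₁ φ)       = sub-fv₂ φ
  sub-fv₂ (∀₁ φ)       = sub-fv₂ φ
  sub-fv₂ (∃₂ φ)       = cong tail (sub-fv₂ φ)
  sub-fv₂ (∀₂ φ)       = cong tail (sub-fv₂ φ)

  sub-⟿ : ∀ {m p} {φ φ′ : Formula P m p} → φ ⟿ φ′ → sub φ ⟿ sub φ′
  sub-⟿ (replace {ψ = ψ} {ψ′} q q′ e₁ e₂) = replace (sub-qf q) (sub-qf q′)
    (trans (sub-fv₁ ψ) (trans e₁ (sym (sub-fv₁ ψ′)))) (trans (sub-fv₂ ψ) (trans e₂ (sym (sub-fv₂ ψ′))))
  sub-⟿ (in-¬ r)  = in-¬ (sub-⟿ r)
  sub-⟿ (in-∧ˡ r) = in-∧ˡ (sub-⟿ r)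
  sub-⟿ (in-∧ʳ r) = in-∧ʳ (sub-⟿ r)
  sub-⟿ (in-∨ˡ r) = in-∨ˡ (sub-⟿ r)
  sub-⟿ (in-∨ʳ r) = in-∨ʳ (sub-⟿ r)
  sub-⟿ (in-∃₁ r) = in-∃₁ (sub-⟿ r)
  sub-⟿ (in-∀₁ r) = in-∀₁ (sub-⟿ r)
  sub-⟿ (in-∃₂ r) = in-∃₂ (sub-⟿ r)
  sub-⟿ (in-∀₂ r) = in-∀₂ (sub-⟿ r)

module _ {P} (I : Interpretation P P) where
  open Interpretation I

  -- Simultaneous substitution is a chain of replacements of single atoms, so closure under `_⟿_`
  -- gives closure under `sub`.
  ⟿*-sub : ∀ {m p} (φ : Formula P m p) → Star _⟿_ φ (sub I φ)
  ⟿*-sub ⊤ᶠ           = ε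
  ⟿*-sub ⊥ᶠ           = ε
  ⟿*-sub (letter a x) = replace (letter a x) (qf ψ) (sym (fv₁≡ ψ)) (sym (fv₂≡ ψ)) ◅ ε
    where ψ = letterᴵ a x
  ⟿*-sub (pred R xs)  = replace (pred R xs) (qf ψ) (sym (fv₁≡ ψ)) (sym (fv₂≡ ψ)) ◅ ε
    where ψ = predᴵ R xs
  ⟿*-sub (member X x) = ε
  ⟿*-sub (¬ᶠ φ)       = gmap _ in-¬ (⟿*-sub φ)
  ⟿*-sub (φ ∧ᶠ ψ)     = gmap _ in-∧ˡ (⟿*-sub φ) ◅◅ gmap _ in-∧ʳ (⟿*-sub ψ)
  ⟿*-sub (φ ∨ᶠ ψ)     = gmap _ in-∨ˡ (⟿*-sub φ) ◅◅ gmap _ in-∨ʳ (⟿*-sub ψ)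
  ⟿*-sub (∃₁ φ)       = gmap _ in-∃₁ (⟿*-sub φ)
  ⟿*-sub (∀₁ φ)       = gmap _ in-∀₁ (⟿*-sub φ)
  ⟿*-sub (∃₂ φ)       = gmap _ in-∃₂ (⟿*-sub φ)
  ⟿*-sub (∀₂ φ)       = gmap _ in-∀₂ (⟿*-sub φ)

_∘embed : ∀ {P Q P′} → Interpretation (P ∪ᴾ Q) P′ → Interpretation P P′
I ∘embed = record { letterᴵ = letterᴵ ; predᴵ = λ R → predᴵ (inj₁ R) }
  where open Interpretation I

sub-embed : ∀ {P Q P′} (I : Interpretation (P ∪ᴾ Q) P′) {m p} (φ : Formula P m p) →
    sub I (embed φ) ≡ sub (I ∘embed) φ
sub-embed I ⊤ᶠ           = refl
sub-embed I ⊥ᶠ           = refl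
sub-embed I (letter a x) = refl
sub-embed I (pred R xs)  = refl
sub-embed I (member X x) = refl
sub-embed I (¬ᶠ φ)       = cong ¬ᶠ_ (sub-embed I φ)
sub-embed I (φ ∧ᶠ ψ)     = cong₂ _∧ᶠ_ (sub-embed I φ) (sub-embed I ψ)
sub-embed I (φ ∨ᶠ ψ)     = cong₂ _∨ᶠ_ (sub-embed I φ) (sub-embed I ψ)
sub-embed I (∃₁ φ)       = cong ∃₁ (sub-embed I φ)
sub-embed I (∀₁ φ)       = cong ∀₁ (sub-embed I φ)
sub-embed I (∃₂ φ)       = cong ∃₂ (sub-embed I φ)
sub-embed I (∀₂ φ)       = cong ∀₂ (sub-embed I φ)

Over : ∀ {P m p} → (Predicates.Sym P → Set) → Formula P m p → Set
Over D ⊤ᶠ           = ⊤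
Over D ⊥ᶠ           = ⊤
Over D (letter a x) = ⊤
Over D (pred R xs)  = D R
Over D (member X x) = ⊤
Over D (¬ᶠ φ)       = Over D φ
Over D (φ ∧ᶠ ψ)     = Over D φ × Over D ψ
Over D (φ ∨ᶠ ψ)     = Over D φ × Over D ψ
Over D (∃₁ φ)       = Over D φ
Over D (∀₁ φ)       = Over D φ
Over D (∃₂ φ)       = Over D φ
Over D (∀₂ φ)       = Over D φ

over-mono : ∀ {P m p} {D D′ : Predicates.Sym P → Set} → (∀ {R} → D R → D′ R) → (φ : Formula P m p) →
    Over D φ → Over D′ φ
over-mono f ⊤ᶠ           o = tt
over-mono f ⊥ᶠ           o = tt
over-mono f (letter a x) o = tt
over-mono f (pred R xs)  o = f o
over-mono f (member X x) o = tt
over-mono f (¬ᶠ φ)       o = over-mono f φ o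
over-mono f (φ ∧ᶠ ψ)     (o , o′) = over-mono f φ o , over-mono f ψ o′
over-mono f (φ ∨ᶠ ψ)     (o , o′) = over-mono f φ o , over-mono f ψ o′
over-mono f (∃₁ φ)       o = over-mono f φ o
over-mono f (∀₁ φ)       o = over-mono f φ o
over-mono f (∃₂ φ)       o = over-mono f φ o
over-mono f (∀₂ φ)       o = over-mono f φ o

over-all : ∀ {P m p} {D : Predicates.Sym P → Set} → (∀ R → D R) → (φ : Formula P m p) → Over D φ
over-all f ⊤ᶠ           = tt
over-all f ⊥ᶠ           = tt
over-all f (letter a x) = tt
over-all f (pred R xs)  = f R
over-all f (member X x) = tt
over-all f (¬ᶠ φ)       = over-all f φ
over-all f (φ ∧ᶠ ψ)     = over-all f φ , over-all f ψ
over-all f (φ ∨ᶠ ψ)     = over-all f φ , over-all f ψ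
over-all f (∃₁ φ)       = over-all f φ
over-all f (∀₁ φ)       = over-all f φ
over-all f (∃₂ φ)       = over-all f φ
over-all f (∀₂ φ)       = over-all f φ

-- Satisfaction in a word and in a relabelled word of the same length

module _ {n n′} (u : Word n) (v : Word n′) (e : length u ≡ length v) where

  SameValues : ∀ {m} → Vec (Position u) m → Vec (Position v) m → Set
  SameValues ρ ρ′ = ∀ i → toℕ (lookup ρ′ i) ≡ toℕ (lookup ρ i)

  SameSets : ∀ {p} → Vec (Subset (length u)) p → Vec (Subset (length v)) p → Set
  SameSets θ θ′ = ∀ i x → x Subset.∈ lookup θ i ⇔ cast e x Subset.∈ lookup θ′ i

private
  module _ {n n′} (u : Word n) (v : Word n′) (e : length u ≡ length v) where

    values-∷ : ∀ {m x y} {ρ : Vec (Position u) m} {ρ′ : Vec (Position v) m} → toℕ y ≡ toℕ x →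
               SameValues u v e ρ ρ′ → SameValues u v e (x ∷ ρ) (y ∷ ρ′)
    values-∷ p s zero    = p
    values-∷ p s (suc i) = s i

    sets-∷ : ∀ {p X Y} {θ : Vec (Subset (length u)) p} {θ′ : Vec (Subset (length v)) p} →
             (∀ x → x Subset.∈ X ⇔ cast e x Subset.∈ Y) → SameSets u v e θ θ′ → SameSets u v e (X ∷ θ)
                 (Y ∷ θ′)
    sets-∷ p s zero    = p
    sets-∷ p s (suc i) = s i

    ∈-tabulate : ∀ {k} (f : Fin k → Bool) x → x Subset.∈ tabulate f ⇔ f x ≡ true
    ∈-tabulate f x = mk⇔ (λ p → trans (sym (lookup∘tabulate f x)) ([]=⇒lookup p))
                         (λ p → lookup⇒[]= x _ (trans (lookup∘tabulate f x) p))

    push : Subset (length u) → Subset (length v)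
    push X = tabulate (λ y → lookup X (cast (sym e) y))

    pull : Subset (length v) → Subset (length u)
    pull Y = tabulate (λ x → lookup Y (cast e x))

    push-∈ : ∀ X x → x Subset.∈ X ⇔ cast e x Subset.∈ push X
    push-∈ X x = mk⇔
      (λ p → from (∈-tabulate _ (cast e x)) (trans (cong (lookup X) back) ([]=⇒lookup p)))
      (λ p → lookup⇒[]= x X (trans (cong (lookup X) (sym back)) (to (∈-tabulate _ (cast e x)) p)))
      where
      back : cast (sym e) (cast e x) ≡ x
      back = trans (cast-trans e (sym e) x) (cast-is-id refl x)

    pull-∈ : ∀ Y x → x Subset.∈ pull Y ⇔ cast e x Subset.∈ Y
    pull-∈ Y x = mk⇔
      (λ p → lookup⇒[]= _ Y (to (∈-tabulate _ x) p))
      (λ p → from (∈-tabulate _ x) ([]=⇒lookup p))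

module _ {n n′} (u : Word n) (v : Word n′) (e : length u ≡ length v) {P P′} (I : Interpretation P P′)
         (Fits : Predicates.Sym P → Set) where
  open Interpretation I

  Faithful : Set
  Faithful = ∀ {m p} (ρ : Vec (Position u) m) ρ′ θ (θ′ : Vec (Subset (length v)) p) → SameValues u v e ρ ρ′ →
             (∀ a x → Sat {P} {p = p} u ρ θ (letter a x) ⇔ Sat v ρ′ θ′ (formula (letterᴵ a x))) ×
             (∀ R xs → Fits R → Sat {P} {p = p} u ρ θ (pred R xs) ⇔ Sat v ρ′ θ′ (formula (predᴵ R xs)))

  -- Positions of the two words correspond under `cast`, and sets of positions under `push` and
  -- `pull`. Both kinds of quantifiers therefore range over matching values, and only atoms have to
  -- be compared.
  sub-sat : Faithful → ∀ {m p} {ρ : Vec (Position u) m} {ρ′ θ} {θ′ : Vec (Subset (length v)) p}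
      (φ : Formula P m p) →
            Over Fits φ → SameValues u v e ρ ρ′ → SameSets u v e θ θ′ → Sat u ρ θ φ ⇔ Sat v ρ′ θ′ (sub I φ)
  sub-sat h ⊤ᶠ _ _ _ = mk⇔ id id
  sub-sat h ⊥ᶠ _ _ _ = mk⇔ id id
  sub-sat h {ρ = ρ} {ρ′} {θ} {θ′} (letter a x) _ s t = proj₁ (h ρ ρ′ θ θ′ s) a x
  sub-sat h {ρ = ρ} {ρ′} {θ} {θ′} (pred R xs) o s t = proj₂ (h ρ ρ′ θ θ′ s) R xs o
  sub-sat h {ρ = ρ} {ρ′} {θ} {θ′} (member X x) _ s t =
    subst (λ z → lookup ρ x Subset.∈ lookup θ X ⇔ z Subset.∈ lookup θ′ X)
      (Fin.toℕ-injective (trans (Fin.toℕ-cast e _) (sym (s x)))) (t X (lookup ρ x))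
  sub-sat h (¬ᶠ φ) o s t = mk⇔ (λ ¬a b → ¬a (from ih b)) (λ ¬b a → ¬b (to ih a))
    where ih = sub-sat h φ o s t
  sub-sat h (φ ∧ᶠ ψ) (o , o′) s t = mk⇔ (λ (a , b) → to ih a , to ih′ b) (λ (a , b) → from ih a , from ih′ b)
    where ih = sub-sat h φ o s t ; ih′ = sub-sat h ψ o′ s t
  sub-sat h (φ ∨ᶠ ψ) (o , o′) s t = mk⇔ (λ { (inj₁ a) → inj₁ (to ih a) ; (inj₂ b) → inj₂ (to ih′ b) })
                                       (λ { (inj₁ a) → inj₁ (from ih a) ; (inj₂ b) → inj₂ (from ih′ b) })
    where ih = sub-sat h φ o s t ; ih′ = sub-sat h ψ o′ s t
  sub-sat h (∃₁ φ) o s t = mk⇔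
    (λ (x , a) → cast e x , to (sub-sat h φ o (values-∷ u v e (Fin.toℕ-cast e x) s) t) a)
    (λ (y , a) → cast (sym e) y , from (sub-sat h φ o (values-∷ u v e (sym (Fin.toℕ-cast (sym e) y)) s) t) a)
  sub-sat h (∀₁ φ) o s t = mk⇔
    (λ f y → to (sub-sat h φ o (values-∷ u v e (sym (Fin.toℕ-cast (sym e) y)) s) t) (f (cast (sym e) y)))
    (λ f x → from (sub-sat h φ o (values-∷ u v e (Fin.toℕ-cast e x) s) t) (f (cast e x)))
  sub-sat h (∃₂ φ) o s t = mk⇔
    (λ (X , a) → push u v e X , to (sub-sat h φ o s (sets-∷ u v e (push-∈ u v e X) t)) a)
    (λ (Y , a) → pull u v e Y , from (sub-sat h φ o s (sets-∷ u v e (pull-∈ u v e Y) t)) a)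
  sub-sat h (∀₂ φ) o s t = mk⇔
    (λ f Y → to (sub-sat h φ o s (sets-∷ u v e (pull-∈ u v e Y) t)) (f (pull u v e Y)))
    (λ f X → from (sub-sat h φ o s (sets-∷ u v e (push-∈ u v e X) t)) (f (push u v e X)))

  sub-⊨ : Faithful → ∀ φ → Over Fits φ → u ⊨ φ ⇔ v ⊨ sub I φ
  sub-⊨ h φ o = sub-sat h φ o (λ ()) (λ ())

-- Numerical predicates see only the length and the positions, so they keep their truth value
-- between a word and its marked version.
numerical-resp : ∀ (σ : Signature) {ℓ ℓ′} → ℓ ≡ ℓ′ → ∀ R {xs : Vec (Fin ℓ) (Signature.arity σ R)}
    {ys : Vec (Fin ℓ′) (Signature.arity σ R)} →
                 (∀ i → toℕ (lookup ys i) ≡ toℕ (lookup xs i)) → Signature.Holds σ R ℓ xs ⇔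
                     Signature.Holds σ R ℓ′ ys
numerical-resp σ {ℓ} refl R {xs} {ys} p = mk⇔ (subst (Signature.Holds σ R ℓ) eq)
    (subst (Signature.Holds σ R ℓ) (sym eq))
  where
  eq : xs ≡ ys
  eq = trans (sym (tabulate∘lookup xs)) (trans (tabulate-cong (λ i → Fin.toℕ-injective (sym (p i))))
      (tabulate∘lookup ys))

-- Enrichments

private
  enrich-⟿* : ∀ {f P Q} {F : Pred (Closed P) f} {φ ψ : Closed (P ∪ᴾ Q)} → Star _⟿_ φ ψ → Enrich F Q φ →
      Enrich F Q ψ
  enrich-⟿* ε        φ∈ = φ∈
  enrich-⟿* (r ◅ rs) φ∈ = enrich-⟿* rs (step r φ∈)

module _ {f σ} {F : Pred (Closed (numerical σ)) f} (isFragment : IsFragment σ F) where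
  open IsFragment isFragment

  private
    fragment-⟿* : ∀ {φ ψ} → Star _⟿_ φ ψ → F φ → F ψ
    fragment-⟿* ε        φ∈ = φ∈
    fragment-⟿* (r ◅ rs) φ∈ = fragment-⟿* rs (⟿-closed r φ∈)

  -- Interpreting the added predicates by formulas over `σ` leads from the enrichment back into `F`:
  -- each step of the derivation is mapped to a replacement step.
  sub-fragment : ∀ {Q} (I : Interpretation (numerical σ ∪ᴾ Q) (numerical σ)) {φ} → Enrich F Q φ → F (sub I φ)
  sub-fragment I (base {φ} φ∈) = subst F (sym (sub-embed I φ)) (fragment-⟿* (⟿*-sub (I ∘embed) φ) φ∈)
  sub-fragment I (step r φ∈)   = ⟿-closed (sub-⟿ I r) (sub-fragment I φ∈)

  module _ {Q : Predicates} where

    -- With no variables in scope all sets of free variables coincide, so `⊤ᶠ` may be replaced by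
    -- any quantifier-free formula.
    enrich-qf : ∀ {φ} → QuantifierFree φ → Enrich F Q φ
    enrich-qf {φ} q = step (replace ⊤ᶠ q (empty _) (empty _)) (base (quantifierFree ⊤ᶠ))
      where
      empty : (S : Subset 0) → Subset.⊥ ≡ S
      empty [] = refl

    enrich-∧ : ∀ {φ ψ} → Enrich F Q φ → Enrich F Q ψ → Enrich F Q (φ ∧ᶠ ψ)
    enrich-∧ (base φ∈)   (base ψ∈)   = base (∧-closed φ∈ ψ∈)
    enrich-∧ (base φ∈)   (step r ψ∈) = step (in-∧ʳ r) (enrich-∧ (base φ∈) ψ∈)
    enrich-∧ (step r φ∈) ψ∈          = step (in-∧ˡ r) (enrich-∧ φ∈ ψ∈)

    enrich-∨ : ∀ {φ ψ} → Enrich F Q φ → Enrich F Q ψ → Enrich F Q (φ ∨ᶠ ψ)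
    enrich-∨ (base φ∈)   (base ψ∈)   = base (∨-closed φ∈ ψ∈)
    enrich-∨ (base φ∈)   (step r ψ∈) = step (in-∨ʳ r) (enrich-∨ (base φ∈) ψ∈)
    enrich-∨ (step r φ∈) ψ∈          = step (in-∨ˡ r) (enrich-∨ φ∈ ψ∈)

    -- `_⟿_` relates formulas over one and the same set of predicates. Hence `I` is extended by the
    -- identity on `Q` and applied to the embedded formula.
    enrich-sub : ∀ (I : Interpretation (numerical σ) (numerical σ ∪ᴾ Q)) {φ} → F φ → Enrich F Q (sub I φ)
    enrich-sub I {φ} φ∈ = subst (Enrich F Q) (sub-embed I⁺ φ) (enrich-⟿* (⟿*-sub I⁺ (embed φ)) (base φ∈))
      where
      open Interpretation I
      I⁺ : Interpretation (numerical σ ∪ᴾ Q) (numerical σ ∪ᴾ Q)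
      I⁺ = record { letterᴵ = letterᴵ ; predᴵ = λ { (inj₁ R) → predᴵ R ; (inj₂ R) → predQF (inj₂ R) } }


private
  _⨾_ : ∀ {A B C : Set} → A ⇔ B → B ⇔ C → A ⇔ C
  _⨾_ = IsEquivalence.trans ⇔-isEquivalence

  ⇔-sym : ∀ {A B : Set} → A ⇔ B → B ⇔ A
  ⇔-sym = IsEquivalence.sym ⇔-isEquivalence

-- Decidable sets of letters as formulas

-- The letter n, absent from words over Fin n, keeps x free in the empty disjunction.
oneOf : ∀ {P m p n} → List (Fin n) → (x : Fin m) → QFFormula P m p ⁅ x ⁆
oneOf {n = n} []       x = letterQF n x
oneOf         (b ∷ bs) x = record
  { formula = letter (toℕ b) x ∨ᶠ formula rest
  ; qf = letter (toℕ b) x ∨ᶠ qf rest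
  ; fv₁≡ = trans (cong (⁅ x ⁆ Subset.∪_) (fv₁≡ rest)) (∪-idem ⁅ x ⁆)
  ; fv₂≡ = trans (cong (Subset.⊥ Subset.∪_) (fv₂≡ rest)) (∪-idem Subset.⊥)
  }
  where rest = oneOf bs x

oneOf-sat : ∀ {P m p n} (v : Word n) ρ θ (bs : List (Fin n)) x →
            List.lookup v (lookup ρ x) ∈ bs ⇔ Sat {P} v ρ θ (formula (oneOf {P} {m} {p} bs x))
oneOf-sat v ρ θ []       x = mk⇔ (λ ()) (λ p → ⊥-elim (<⇒≢ (Fin.toℕ<n _) p))
oneOf-sat v ρ θ (b ∷ bs) x = mk⇔
  (λ { (here refl) → inj₁ refl ; (there i) → inj₂ (to (oneOf-sat v ρ θ bs x) i) })
  (λ { (inj₁ p) → here (Fin.toℕ-injective p) ; (inj₂ s) → there (from (oneOf-sat v ρ θ bs x) s) })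

module _ {n} {T : Pred (Fin n) 0ℓ} (T? : Decidable T) where

  satisfying : ∀ {P m p} → (x : Fin m) → QFFormula P m p ⁅ x ⁆
  satisfying x = oneOf (filter T? (allFin n)) x

  satisfying-sat : ∀ {P m p} (v : Word n) ρ θ x →
                   T (List.lookup v (lookup ρ x)) ⇔ Sat {P} v ρ θ (formula (satisfying {P} {m} {p} x))
  satisfying-sat v ρ θ x = mk⇔ (∈-filter⁺ T? (∈-allFin _))
      (λ i → proj₂ (∈-filter⁻ T? {xs = allFin n} i)) ⨾ oneOf-sat v ρ θ _ x

constant : ∀ {P m p} {A : Set} → Dec A → QFFormula P m p Subset.⊥
constant (yes _) = record { formula = ⊤ᶠ ; qf = ⊤ᶠ ; fv₁≡ = refl ; fv₂≡ = refl }
constant (no _)  = record { formula = ⊥ᶠ ; qf = ⊥ᶠ ; fv₁≡ = refl ; fv₂≡ = refl }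

constant-sat : ∀ {P m p n} {A : Set} (A? : Dec A) (v : Word n) ρ θ → A ⇔
    Sat {P} v ρ θ (formula (constant {P} {m} {p} A?))
constant-sat (yes a) v ρ θ = mk⇔ (λ _ → tt) (λ _ → a)
constant-sat (no ¬a) v ρ θ = mk⇔ ¬a ⊥-elim

unary : ∀ {P m p} {x : Fin m} → QFFormula P m p ⁅ x ⁆ →
    QFFormula P m p (Subset.⋃ (toList (Vec.map ⁅_⁆ (x ∷ []))))
unary {x = x} ψ = record { formula = formula ψ ; qf = qf ψ ; fv₁≡ =
    trans (fv₁≡ ψ) (sym (∪-identityʳ ⁅ x ⁆)) ; fv₂≡ = fv₂≡ ψ }

congruent⇔ : ∀ {d} m (i : Fin (suc d)) → (∃[ q ] m ≡ toℕ i + q * suc d) ⇔ m % suc d ≡ toℕ i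
congruent⇔ {d} m i = mk⇔
  (λ { (q , refl) → trans ([m+kn]%n≡m%n (toℕ i) q (suc d)) (m<n⇒m%n≡m (Fin.toℕ<n i)) })
  (λ p → m / suc d , trans (m≡m%n+[m/n]*n m (suc d)) (cong (_+ m / suc d * suc d) p))

carriesAt-lookup : ∀ {n} (u : Word n) (p : Position u) {a} → toℕ (List.lookup u p) ≡ a ⇔ CarriesAt u a (toℕ p)
carriesAt-lookup u p = mk⇔ (λ e → p , refl , e)
  (λ (q , e , r) → subst (λ z → toℕ (List.lookup u z) ≡ _) (Fin.toℕ-injective e) r)

-- From formulas to monoids

LocMod : Signature → Predicates
LocMod σ = numerical σ ∪ᴾ (LOC ∪ᴾ MOD)

Bounded : (σ : Signature) (K d : ℕ) → Predicates.Sym (LocMod σ) → Set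
Bounded σ K d (inj₁ R) = ⊤
Bounded σ K d (inj₂ (inj₁ (at-x+ a k)))   = k < K
Bounded σ K d (inj₂ (inj₁ (at-min+ a k))) = k < K
Bounded σ K d (inj₂ (inj₁ (at-max- a k))) = k < K
Bounded σ K d (inj₂ (inj₂ (d′ , _)))      = suc d′ ∣ suc d

bounded-mono : ∀ {σ K K′ d d′} → K ≤ K′ → suc d ∣ suc d′ → ∀ {R} → Bounded σ K d R → Bounded σ K′ d′ R
bounded-mono p q {inj₁ R} b = tt
bounded-mono p q {inj₂ (inj₁ (at-x+ a k))}   b = ≤-trans b p
bounded-mono p q {inj₂ (inj₁ (at-min+ a k))} b = ≤-trans b p
bounded-mono p q {inj₂ (inj₁ (at-max- a k))} b = ≤-trans b p
bounded-mono p q {inj₂ (inj₂ (d , _))}       b = ∣-trans b q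

module _ {σ : Signature} where

  private
    HasBounds : ∀ {m p} → Formula (LocMod σ) m p → Set
    HasBounds φ = Σ[ K ∈ ℕ ] Σ[ d ∈ ℕ ] Over (Bounded σ K d) φ

    both : ∀ {m p m′ p′} (φ : Formula (LocMod σ) m p) (ψ : Formula (LocMod σ) m′ p′) → HasBounds φ →
        HasBounds ψ →
           Σ[ K ∈ ℕ ] Σ[ d ∈ ℕ ] Over (Bounded σ K d) φ × Over (Bounded σ K d) ψ
    -- `d′ + d * suc d′` is the predecessor of `suc d * suc d′`, a common multiple of the two
    -- moduli.
    both φ ψ (K , d , o) (K′ , d′ , o′) = K + K′ , d′ + d * suc d′ ,
      over-mono (bounded-mono {σ} (m≤m+n K K′) (m∣m*n {suc d} (suc d′))) φ o ,
      over-mono (bounded-mono {σ} (m≤n+m K′ K) (n∣m*n (suc d) {suc d′})) ψ o′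

  bounds : ∀ {m p} (φ : Formula (LocMod σ) m p) → Σ[ K ∈ ℕ ] Σ[ d ∈ ℕ ] Over (Bounded σ K d) φ
  bounds ⊤ᶠ           = 0 , 0 , tt
  bounds ⊥ᶠ           = 0 , 0 , tt
  bounds (letter a x) = 0 , 0 , tt
  bounds (pred (inj₁ R) xs) = 0 , 0 , tt
  bounds (pred (inj₂ (inj₁ (at-x+ a k))) xs)   = suc k , 0 , ≤-refl
  bounds (pred (inj₂ (inj₁ (at-min+ a k))) xs) = suc k , 0 , ≤-refl
  bounds (pred (inj₂ (inj₁ (at-max- a k))) xs) = suc k , 0 , ≤-refl
  bounds (pred (inj₂ (inj₂ (d , _))) xs)       = 0 , d , ∣-refl
  bounds (member X x) = 0 , 0 , tt
  bounds (¬ᶠ φ)       = bounds φ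
  bounds (φ ∧ᶠ ψ)     = both φ ψ (bounds φ) (bounds ψ)
  bounds (φ ∨ᶠ ψ)     = both φ ψ (bounds φ) (bounds ψ)
  bounds (∃₁ φ)       = bounds φ
  bounds (∀₁ φ)       = bounds φ
  bounds (∃₂ φ)       = bounds φ
  bounds (∀₂ φ)       = bounds φ

module _ (σ : Signature) {n : ℕ} (d K : ℕ) where

  private
    windowAt : Fin (Mark {n} d K) → Word n
    windowAt b = unwindow K (proj₂ (remQuot {suc d} (size n K) b))

    residueAt : Fin (Mark {n} d K) → Fin (suc d)
    residueAt b = proj₁ (remQuot {suc d} (size n K) b)

  -- What depends on a position is read from its mark; conditions on the whole word become
  -- constants, fixed by `c`. This is why there is one interpretation for each info.
  decode : Fin (Info {n} d K) → Interpretation (LocMod σ) (numerical σ)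
  decode c = record
    { letterᴵ = λ a x → satisfying (λ b → carriesAt? (windowAt b) a 0) x
    ; predᴵ   = λ { (inj₁ R) xs → predQF R xs
                  ; (inj₂ (inj₁ (at-x+ a k))) (x ∷ []) →
                        unary (satisfying (λ b → carriesAt? (windowAt b) a k) x)
                  ; (inj₂ (inj₁ (at-min+ a k))) [] → constant (carriesAt? (prefixOf d K c) a k)
                  ; (inj₂ (inj₁ (at-max- a k))) [] → constant (carriesAt? (suffixOf d K c) a k)
                  ; (inj₂ (inj₂ (d′ , MODˢ i))) (x ∷ []) →
                        unary (satisfying (λ b → toℕ (residueAt b) % suc d′ ≟ toℕ i) x)
                  ; (inj₂ (inj₂ (d′ , Dˢ i))) [] → constant (toℕ (residueOf {n} d K c) % suc d′ ≟ toℕ i)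
                  }
    }

  module _ (u : Word n) where

    private
      v = enc d K 0 u []

      lookup-v : ∀ {m} {ρ : Vec (Position u) m} {ρ′} → SameValues u v (sym (length-enc d K 0 u [])) ρ
          ρ′ → ∀ x →
                 remQuot {suc d} (size n K) (List.lookup v (lookup ρ′ x)) ≡
                 (toℕ (lookup ρ x) mod suc d , window K (drop (toℕ (lookup ρ x)) u))
      lookup-v {ρ = ρ} s x = trans (cong (remQuot {suc d} (size n K)) (lookup-enc d K 0 u [] _ _ (s x)))
        (trans (remQuot-combine _ _) (cong (λ w → toℕ (lookup ρ x) mod suc d , window K w)
            (++-identityʳ (drop (toℕ (lookup ρ x)) u))))

      window-v : ∀ {m} {ρ : Vec (Position u) m} {ρ′} → SameValues u v (sym (length-enc d K 0 u [])) ρ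
          ρ′ → ∀ x {a k} → k < K →
                 CarriesAt u a (toℕ (lookup ρ x) + k) ⇔ CarriesAt (windowAt (List.lookup v (lookup ρ′ x))) a k
      window-v {ρ = ρ} {ρ′} s x {a} {k} k<K = subst (λ w → CarriesAt u a (toℕ (lookup ρ x) + k) ⇔
          CarriesAt w a k)
        (sym (trans (cong (λ b → unwindow K (proj₂ b)) (lookup-v {ρ = ρ} {ρ′} s x))
            (unwindow-window K (drop (toℕ (lookup ρ x)) u))))
        (⇔-sym (carriesAt-take K _ k<K ⨾ carriesAt-drop (toℕ (lookup ρ x)) u))

      residue : ∀ m {d′} (i : Fin (suc d′)) → suc d′ ∣ suc d →
                (∃[ q ] m ≡ toℕ i + q * suc d′) ⇔ toℕ (m mod suc d) % suc d′ ≡ toℕ i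
      residue m {d′} i d′∣d rewrite toℕ-fromℕ< (m%n<n m (suc d)) | m∣n⇒o%n%m≡o%m (suc d′) (suc d) m
          d′∣d = congruent⇔ m i

    -- The letter at a position is the first letter of its window, whence the condition `0 < K`.
    decode-faithful : 0 < K → Faithful u v (sym (length-enc d K 0 u [])) (decode (info d K u)) (Bounded σ K d)
    decode-faithful 0<K ρ ρ′ θ θ′ s = letters , preds
      where
      letters : ∀ a x → Sat {LocMod σ} u ρ θ (letter a x) ⇔
          Sat v ρ′ θ′ (formula (Interpretation.letterᴵ (decode (info d K u)) a x))
      letters a x = (carriesAt-lookup u (lookup ρ x) ⨾
        subst (λ j → CarriesAt u a j ⇔ CarriesAt (windowAt (List.lookup v (lookup ρ′ x))) a 0)
            (+-identityʳ _) (window-v {ρ = ρ} {ρ′} s x 0<K)) ⨾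
        satisfying-sat (λ b → carriesAt? (windowAt b) a 0) v ρ′ θ′ x

      preds : ∀ R xs → Bounded σ K d R →
              Sat {LocMod σ} u ρ θ (pred R xs) ⇔
                  Sat v ρ′ θ′ (formula (Interpretation.predᴵ (decode (info d K u)) R xs))
      preds (inj₁ R) xs _ = numerical-resp σ (sym (length-enc d K 0 u [])) R
        (λ i → trans (cong toℕ (lookup-map i (lookup ρ′) xs))
            (trans (s (lookup xs i)) (cong toℕ (sym (lookup-map i (lookup ρ) xs)))))
      preds (inj₂ (inj₁ (at-x+ a k))) (x ∷ []) k<K =
        window-v {ρ = ρ} {ρ′} s x k<K ⨾ satisfying-sat (λ b → carriesAt? (windowAt b) a k) v ρ′ θ′ x
      preds (inj₂ (inj₁ (at-min+ a k))) [] k<K =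
        subst (λ w → CarriesAt u a k ⇔ CarriesAt w a k) (sym (prefixOf-info d K u))
            (⇔-sym (carriesAt-take K u k<K)) ⨾
        constant-sat (carriesAt? (prefixOf d K (info d K u)) a k) v ρ′ θ′
      preds (inj₂ (inj₁ (at-max- a k))) [] k<K =
        (carriesAt-reverse u ⨾
         subst (λ w → CarriesAt (List.reverse u) a k ⇔ CarriesAt w a k) (sym (suffixOf-info d K u))
             (⇔-sym (carriesAt-take K _ k<K))) ⨾
        constant-sat (carriesAt? (suffixOf d K (info d K u)) a k) v ρ′ θ′
      preds (inj₂ (inj₂ (d′ , MODˢ i))) (x ∷ []) d′∣d =
        subst (λ r → (∃[ q ] toℕ (lookup ρ x) ≡ toℕ i + q * suc d′) ⇔ toℕ r % suc d′ ≡ toℕ i)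
            (sym (cong proj₁ (lookup-v {ρ = ρ} {ρ′} s x)))
          (residue (toℕ (lookup ρ x)) i d′∣d) ⨾
        satisfying-sat (λ b → toℕ (residueAt b) % suc d′ ≟ toℕ i) v ρ′ θ′ x
      preds (inj₂ (inj₂ (d′ , Dˢ i))) [] d′∣d =
        subst (λ r → (∃[ q ] length u ≡ toℕ i + q * suc d′) ⇔ toℕ r % suc d′ ≡ toℕ i)
            (sym (residueOf-info d K u))
          (residue (length u) i d′∣d) ⨾
        constant-sat (toℕ (residueOf {n} d K (info d K u)) % suc d′ ≟ toℕ i) v ρ′ θ′

-- For each of the finitely many infos `c`, the decoded formula defines a language of marked words
-- recognized in `V`. The info of a word selects the formula that applies, and the product of the
-- monoids evaluates all of them.
definable⇒captured : ∀ {f v} (σ : Signature) (F : Pred (Closed (numerical σ)) f) (V : Pred (Monoid 0ℓ 0ℓ) v) →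
                     IsFragment σ F → IsVariety V → Corresponds F V →
                     ∀ {n} (L : Language n) → Definable (Enrich F (LOC ∪ᴾ MOD)) L → ∃[ d ] Captured V L d
definable⇒captured σ F V isFragment isVariety corresponds {n} L (φ , φ∈ , L⇔φ) with bounds {σ} φ
... | K₀ , d , o = d , record
  { K = K
  ; J = proj₁ joint
  ; captures = λ u v same ker Lu →
      let c = info d K u
          open _Recognizes_ (proj₂ (proj₂ (recognizer c))) hiding (φ)
          accepted = to (recognizes _) (to (translate u) (to (L⇔φ u) Lu))
      in from (L⇔φ v) (from (translate v) (subst (λ c → enc d K 0 v [] ⊨ sub (decode σ d K c) φ) same
           (from (recognizes _) (Accept-resp (proj₂ joint ker c) accepted))))
  }
  where
  K : ℕ
  K = suc K₀

  recognizer : ∀ c → ∃[ M ] (V M × M Recognizes (λ w → w ⊨ sub (decode σ d K c) φ))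
  recognizer c = to (corresponds _) (sub (decode σ d K c) φ , sub-fragment isFragment (decode σ d K c)
      φ∈ , λ _ → mk⇔ id id)

  translate : ∀ u → u ⊨ φ ⇔ enc d K 0 u [] ⊨ sub (decode σ d K (info d K u)) φ
  translate u = sub-⊨ u (enc d K 0 u []) (sym (length-enc d K 0 u [])) (decode σ d K (info d K u))
      (Bounded σ K d) (decode-faithful σ d K u (s≤s z≤n)) φ
    (over-mono (bounded-mono {σ} (n≤1+n K₀) ∣-refl) φ o)

  joint = jointHom isVariety (λ c → let M , M∈V , rec = recognizer c in record
    { target = M ; in-V = M∈V ; hom = _Recognizes_.φ rec ; isHom = _Recognizes_.φ-morphism rec })

-- Formulas describing a prefix

-- Descriptions of a prefix may degenerate to `⊤ᶠ` or `⊥ᶠ`, without free variables, so only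
-- inclusion in `S` is asked for. In `_∧ᵠ_` the other conjunct restores equality.
record QFBelow (P : Predicates) (m p : ℕ) (S : Subset m) : Set where
  field
    formulaᵇ : Formula P m p
    qfᵇ      : QuantifierFree formulaᵇ
    fv₁⊆     : S Subset.∪ fv₁ formulaᵇ ≡ S
    fv₂ᵇ     : fv₂ formulaᵇ ≡ Subset.⊥

open QFBelow

⊤ᵇ ⊥ᵇ : ∀ {P m p S} → QFBelow P m p S
⊤ᵇ {S = S} = record { formulaᵇ = ⊤ᶠ ; qfᵇ = ⊤ᶠ ; fv₁⊆ = ∪-identityʳ S ; fv₂ᵇ = refl }
⊥ᵇ {S = S} = record { formulaᵇ = ⊥ᶠ ; qfᵇ = ⊥ᶠ ; fv₁⊆ = ∪-identityʳ S ; fv₂ᵇ = refl }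

_∧ᵇ_ : ∀ {P m p S} → QFBelow P m p S → QFBelow P m p S → QFBelow P m p S
_∧ᵇ_ {S = S} α β = record
  { formulaᵇ = formulaᵇ α ∧ᶠ formulaᵇ β
  ; qfᵇ = qfᵇ α ∧ᶠ qfᵇ β
  ; fv₁⊆ = trans (sym (∪-assoc S _ _)) (trans (cong (Subset._∪ _) (fv₁⊆ α)) (fv₁⊆ β))
  ; fv₂ᵇ = trans (cong₂ Subset._∪_ (fv₂ᵇ α) (fv₂ᵇ β)) (∪-idem Subset.⊥) }

below : ∀ {P m p S} → QFFormula P m p S → QFBelow P m p S
below {S = S} ψ = record { formulaᵇ = formula ψ ; qfᵇ = qf ψ ; fv₁⊆ =
    trans (cong (S Subset.∪_) (fv₁≡ ψ)) (∪-idem S) ; fv₂ᵇ = fv₂≡ ψ }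

¬ᵇ_ : ∀ {P m p S} → QFBelow P m p S → QFBelow P m p S
¬ᵇ ψ = record { formulaᵇ = ¬ᶠ formulaᵇ ψ ; qfᵇ = ¬ᶠ qfᵇ ψ ; fv₁⊆ = fv₁⊆ ψ ; fv₂ᵇ = fv₂ᵇ ψ }

_∧ᵠ_ : ∀ {P m p S} → QFFormula P m p S → QFBelow P m p S → QFFormula P m p S
ψ ∧ᵠ β = record
  { formula = formula ψ ∧ᶠ formulaᵇ β
  ; qf = qf ψ ∧ᶠ qfᵇ β
  ; fv₁≡ = trans (cong (Subset._∪ _) (fv₁≡ ψ)) (fv₁⊆ β)
  ; fv₂≡ = trans (cong₂ Subset._∪_ (fv₂≡ ψ) (fv₂ᵇ β)) (∪-idem Subset.⊥) }

module _ {P : Predicates} {m p : ℕ} {S : Subset m} where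

  noneOf : ∀ {n} → (ℕ → QFFormula P m p S) → List (Fin n) → QFBelow P m p S
  noneOf at []       = ⊤ᵇ
  noneOf at (a ∷ as) = (¬ᵇ below (at (toℕ a))) ∧ᵇ noneOf at as

  -- at a k says that the letter a is found k places further.
  startsWith : ∀ {n} → (ℕ → ℕ → QFFormula P m p S) → ℕ → Word n → QFBelow P m p S
  startsWith     at zero    []      = ⊤ᵇ
  startsWith     at zero    (_ ∷ _) = ⊥ᵇ
  -- The described word has ended, which is expressed by saying that no letter of the alphabet
  -- occurs at this place.
  startsWith {n} at (suc k) []      = noneOf (λ a → at a 0) (allFin n)
  startsWith     at (suc k) (a ∷ l) = below (at (toℕ a) 0) ∧ᵇ startsWith (λ a k → at a (suc k)) k l

  module _ {n} (u : Word n) (ρ : Vec (Position u) m) (θ : Vec (Subset (length u)) p) where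

    noneOf-sat : ∀ {n′} (at : ℕ → QFFormula P m p S) (as : List (Fin n′)) →
                 Sat u ρ θ (formulaᵇ (noneOf at as)) ⇔ (∀ {a} → a ∈ as → ¬ Sat u ρ θ (formula (at (toℕ a))))
    noneOf-sat at []       = mk⇔ (λ _ ()) (λ _ → tt)
    noneOf-sat at (a ∷ as) = mk⇔
      (λ { (¬a , s) (here refl) → ¬a ; (¬a , s) (there i) → to (noneOf-sat at as) s i })
      (λ h → h (here refl) , from (noneOf-sat at as) (λ i → h (there i)))

    startsWith-sat : ∀ {n′} at k (v l : Word n′) → (∀ a k → Sat u ρ θ (formula (at a k)) ⇔ CarriesAt v a k) →
                     Sat u ρ θ (formulaᵇ (startsWith at k l)) ⇔ take k v ≡ l
    startsWith-sat at zero    v       []      h = mk⇔ (λ _ → refl) (λ _ → tt)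
    startsWith-sat at zero    v       (_ ∷ _) h = mk⇔ (λ ()) (λ ())
    startsWith-sat {n′} at (suc k) []      []      h = mk⇔ (λ _ → refl)
      (λ _ → from (noneOf-sat (λ a → at a 0) (allFin n′)) (λ _ s → case-[] (to (h _ 0) s)))
      where
      case-[] : ∀ {n a j} → ¬ CarriesAt {n} [] a j
      case-[] (() , _)
    startsWith-sat at (suc k) (y ∷ v) []      h = mk⇔
      (λ s → ⊥-elim (to (noneOf-sat (λ a → at a 0) (allFin _)) s (∈-allFin y)
          (from (h _ 0) (zero , refl , refl)))) (λ ())
    startsWith-sat at (suc k) []      (a ∷ l) h = mk⇔ (λ (s , _) → ⊥-elim (case-[] (to (h _ 0) s))) (λ ())
      where
      case-[] : ∀ {n a j} → ¬ CarriesAt {n} [] a j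
      case-[] (() , _)
    startsWith-sat at (suc k) (y ∷ v) (a ∷ l) h = mk⇔
      (λ (s , t) → cong₂ _∷_ (head≡ (to (h _ 0) s)) (to rest t))
      (λ { refl → from (h _ 0) (zero , refl , refl) , from rest refl })
      where
      rest = startsWith-sat (λ a k → at a (suc k)) k v l (λ a k → h a (suc k) ⨾ carriesAt-∷ {x = y})

      head≡ : CarriesAt (y ∷ v) (toℕ a) 0 → y ≡ a
      head≡ (zero , _ , e) = Fin.toℕ-injective e

-- From monoids to formulas

module _ (σ : Signature) {n : ℕ} (d K : ℕ) where

  private
    Q P : Predicates
    Q = LOC ∪ᴾ MOD^ (suc d)
    P = numerical σ ∪ᴾ Q

    ahead : ∀ {m p} (x : Fin m) → ℕ → ℕ → QFFormula P m p (Subset.⋃ (toList (Vec.map ⁅_⁆ (x ∷ []))))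
    ahead x a k = predQF (inj₂ (inj₁ (at-x+ a k))) (x ∷ [])

    not-unary : ∀ {m p} {x : Fin m} → QFFormula P m p (Subset.⋃ (toList (Vec.map ⁅_⁆ (x ∷ [])))) →
        QFFormula P m p ⁅ x ⁆
    not-unary {x = x} ψ = record { formula = formula ψ ; qf = qf ψ ; fv₁≡ =
        trans (fv₁≡ ψ) (∪-identityʳ ⁅ x ⁆) ; fv₂≡ = fv₂≡ ψ }

    marked : ∀ {m p} → Fin (suc d) → Word n → (x : Fin m) → QFFormula P m p ⁅ x ⁆
    marked r w x = not-unary (predQF (inj₂ (inj₂ (MODˢ r))) (x ∷ []) ∧ᵠ startsWith (ahead x) K w)

    mark : ∀ {m p} b → Dec (b < Mark {n} d K) → (x : Fin m) → QFFormula P m p ⁅ x ⁆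
    mark b (yes b<) x = let r , w = remQuot {suc d} (size n K) (fromℕ< b<) in marked r (unwindow K w) x
    -- A number that is not a mark must hold nowhere while `x` stays free: the letter `n`, absent
    -- from words over `Fin n`, does this.
    mark b (no _)   x = letterQF n x

    marked-sat : ∀ {m p} (u : Word n) ρ (θ : Vec (Subset (length u)) p) r w (x : Fin m) →
                 Sat u ρ θ (formula (marked {m} {p} r w x)) ⇔
                     (toℕ (lookup ρ x) mod suc d ≡ r × take K (drop (toℕ (lookup ρ x)) u) ≡ w)
    marked-sat u ρ θ r w x = mk⇔ (λ (s , t) → to res s , to win t) (λ (s , t) → from res s , from win t)
      where
      i = toℕ (lookup ρ x)

      res : (∃[ q ] i ≡ toℕ r + q * suc d) ⇔ i mod suc d ≡ r
      res = congruent⇔ i r ⨾ mk⇔ (λ e → Fin.toℕ-injective (trans (toℕ-fromℕ< (m%n<n i (suc d))) e))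
                                 (λ e → trans (sym (toℕ-fromℕ< (m%n<n i (suc d)))) (cong toℕ e))

      win = startsWith-sat u ρ θ (ahead x) K (drop i u) w (λ a k → ⇔-sym (carriesAt-drop i u))

  encode : Interpretation (numerical σ) P
  encode = record { letterᴵ = λ b x → mark b (b <? Mark {n} d K) x ; predᴵ = λ R → predQF (inj₁ R) }

  encode-faithful : ∀ u → Faithful (enc d K 0 u []) u (length-enc d K 0 u []) encode (λ _ → ⊤)
  encode-faithful u ρ ρ′ θ θ′ s = letters , λ R xs _ → numerical-resp σ (length-enc d K 0 u []) R
      (λ i → trans (cong toℕ (lookup-map i (lookup ρ′) xs))
          (trans (s (lookup xs i)) (cong toℕ (sym (lookup-map i (lookup ρ) xs)))))
    where
    v = enc d K 0 u []

    letters : ∀ b x → toℕ (List.lookup v (lookup ρ x)) ≡ b ⇔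
        Sat u ρ′ θ′ (formula (mark b (b <? Mark {n} d K) x))
    letters b x with b <? Mark {n} d K
    ... | no b≮  = mk⇔ (λ { refl → ⊥-elim (b≮ (Fin.toℕ<n _)) }) (λ e → ⊥-elim (<⇒≢ (Fin.toℕ<n _) e))
    ... | yes b< = mk⇔ forth back ⨾ ⇔-sym (marked-sat u ρ′ θ′ r (unwindow K w) x)
      where
      i = toℕ (lookup ρ′ x)
      rw = remQuot {suc d} (size n K) (fromℕ< b<)
      r = proj₁ rw
      w = proj₂ rw

      letter≡ : List.lookup v (lookup ρ x) ≡ combine (i mod suc d) (window K (drop i u))
      letter≡ = trans (lookup-enc d K 0 u [] (lookup ρ′ x) (lookup ρ x) (sym (s x)))
                      (cong (λ z → combine (i mod suc d) (window K z)) (++-identityʳ (drop i u)))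

      forth : toℕ (List.lookup v (lookup ρ x)) ≡ b → i mod suc d ≡ r × take K (drop i u) ≡ unwindow K w
      forth e = cong proj₁ split≡ , trans (sym (unwindow-window K (drop i u)))
          (cong (λ z → unwindow K (proj₂ z)) split≡)
        where
        split≡ : (i mod suc d , window K (drop i u)) ≡ rw
        split≡ = trans (sym (remQuot-combine (i mod suc d) (window K (drop i u))))
          (cong (remQuot {suc d} (size n K))
              (trans (sym letter≡) (Fin.toℕ-injective (trans e (sym (toℕ-fromℕ< b<))))))

      back : i mod suc d ≡ r × take K (drop i u) ≡ unwindow K w → toℕ (List.lookup v (lookup ρ x)) ≡ b
      back (p , q) = trans
          (cong toℕ (trans letter≡
          (trans (cong₂ combine p window≡) (combine-remQuot {suc d} (size n K) (fromℕ< b<))))) (toℕ-fromℕ< b<)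
        where
        window≡ : window K (drop i u) ≡ w
        window≡ = trans (sym (window-unwindow K _))
            (trans (cong (window K) (trans (unwindow-window K (drop i u)) q)) (window-unwindow K w))

  hasInfo : Fin (Info {n} d K) → Formula P 0 0
  hasInfo c = pred (inj₂ (inj₂ (Dˢ (residueOf {n} d K c)))) [] ∧ᶠ
              (formulaᵇ (startsWith (λ a k → predQF (inj₂ (inj₁ (at-min+ a k))) []) K (prefixOf d K c)) ∧ᶠ
               formulaᵇ (startsWith (λ a k → predQF (inj₂ (inj₁ (at-max- a k))) []) K (suffixOf d K c)))

  hasInfo-qf : ∀ c → QuantifierFree (hasInfo c)
  hasInfo-qf c = pred _ _ ∧ᶠ (qfᵇ (startsWith _ K (prefixOf d K c)) ∧ᶠ qfᵇ (startsWith _ K (suffixOf d K c)))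

  hasInfo-sat : ∀ u c → u ⊨ hasInfo c ⇔ info d K u ≡ c
  hasInfo-sat u c = mk⇔
    (λ (r , p , q) → info-unique d K u c (to pre p) (to suf q) (to res r))
    (λ { refl → from res (sym (residueOf-info d K u)) , from pre (sym (prefixOf-info d K u)) ,
        from suf (sym (suffixOf-info d K u)) })
    where
    pre = startsWith-sat u [] [] (λ a k → predQF (inj₂ (inj₁ (at-min+ a k))) []) K u (prefixOf d K c)
        (λ a k → mk⇔ id id)
    suf = startsWith-sat u [] [] (λ a k → predQF (inj₂ (inj₁ (at-max- a k))) []) K (reverse u)
        (suffixOf d K c) (λ a k → carriesAt-reverse u)

    res : (∃[ q ] length u ≡ toℕ (residueOf {n} d K c) + q * suc d) ⇔ length u mod suc d ≡ residueOf d K c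
    res = congruent⇔ (length u) (residueOf d K c) ⨾
      mk⇔ (λ e → Fin.toℕ-injective (trans (toℕ-fromℕ< (m%n<n (length u) (suc d))) e))
          (λ e → trans (sym (toℕ-fromℕ< (m%n<n (length u) (suc d)))) (cong toℕ e))

-- For fixed info `c`, the marked words having the same value as some word of `L` with info `c` form
-- a language recognized in `V`, hence defined by a formula of `F`. Encoding this formula over
-- `Fin n` and guarding it by `hasInfo` gives a clause, and `L` is the disjunction of these clauses.
captured⇒definable : ∀ {f v} (σ : Signature) (F : Pred (Closed (numerical σ)) f) (V : Pred (Monoid 0ℓ 0ℓ) v) →
                     IsFragment σ F → IsVariety V → Corresponds F V →
                     ∀ {n} (L : Language n) → FiniteIndex L → ∀ d → Captured V L d →
                         Definable (Enrich F (LOC ∪ᴾ MOD^ (suc d))) L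
captured⇒definable σ F V isFragment isVariety corresponds {n} L fin d cap =
  disjunction (allFin _) , disjunction-∈ (allFin _) , λ u → mk⇔ (sound u) (complete u)
  where
  open Captured cap
  open HomInto J
  open FiniteIndex fin
  module N = Monoid target
  module H = MonoidMorphisms.IsMonoidHomomorphism isHom
  N-finite = IsVariety.finite isVariety in-V
  module I = Inverse (proj₂ N-finite)

  Accepts : Fin (Info {n} d K) → N.Carrier → Set
  Accepts c z = ∃[ v ] (info d K v ≡ c × hom (enc d K 0 v []) N.≈ z × L v)

  value : ℕ → Word n → N.Carrier
  value r u = hom (enc d K r u [])

  values : Word n → Fin (suc d) → Fin (proj₁ N-finite)
  values u r = I.to (value (toℕ r) u)

  code : Word n → Fin (Info {n} d K * index * proj₁ N-finite ^ suc d)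
  code u = combine (combine (info d K u) (ψ u)) (funToFin (values u))

  -- A letter put in front shifts the residues of the remaining positions. Values are therefore
  -- compared for all starting residues, which makes the relation compatible with `x ∷_`, as pumping
  -- requires.
  record Alike (u v : Word n) : Set where
    field
      info≡  : info d K u ≡ info d K v
      ψ≡     : ψ u ≡ ψ v
      value≈ : ∀ r → value r u N.≈ value r v

  code⇒alike : ∀ {u v} → code u ≡ code v → Alike u v
  code⇒alike {u} {v} p = record
    { info≡ = proj₁ pieces
    ; ψ≡ = proj₂ pieces
    ; value≈ = λ r → N.trans (reduce r u) (N.trans (values≈ (r mod suc d)) (N.sym (reduce r v)))
    }
    where
    outer = combine-injective (combine (info d K u) (ψ u)) (funToFin (values u))
        (combine (info d K v) (ψ v)) (funToFin (values v)) p
    pieces = combine-injective (info d K u) (ψ u) (info d K v) (ψ v) (proj₁ outer)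

    values≈ : ∀ (r : Fin (suc d)) → value (toℕ r) u N.≈ value (toℕ r) v
    values≈ r = N.trans (N.sym (I.strictlyInverseʳ _)) (N.trans (I.from-cong same) (I.strictlyInverseʳ _))
      where
      same : values u r ≡ values v r
      same = trans (sym (finToFun-funToFin (values u) r))
        (trans (cong (λ c → finToFun c r) (proj₂ outer)) (finToFun-funToFin (values v) r))

    reduce : ∀ r w → value r w N.≈ value (toℕ (r mod suc d)) w
    reduce r w = N.reflexive (cong hom (enc-residue d K w [] (mod-% r (toℕ (r mod suc d))
      (trans (sym (m%n%n≡m%n r (suc d))) (cong (_% suc d) (sym (toℕ-fromℕ< (m%n<n r (suc d)))))))))

  alike⇒code : ∀ {u v} → Alike u v → code u ≡ code v
  alike⇒code {u} {v} p = cong₂ combine (cong₂ combine info≡ ψ≡) (funToFin-cong {f = values u} {values v}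
      (λ r → I.to-cong (value≈ (toℕ r))))
    where
    open Alike p
    funToFin-cong : ∀ {m k} {f g : Fin m → Fin k} → (∀ i → f i ≡ g i) → funToFin f ≡ funToFin g
    funToFin-cong {zero}  _ = refl
    funToFin-cong {suc m} {_} {f} {g} h = cong₂ combine (h zero)
        (funToFin-cong {m} {_} {f ∘ suc} {g ∘ suc} (λ i → h (suc i)))

  take-info : ∀ {u v} → info d K u ≡ info d K v → take K u ≡ take K v
  take-info {u} {v} e = trans (sym (prefixOf-info d K u))
      (trans (cong (prefixOf d K) e) (prefixOf-info d K v))

  info-∷ : ∀ x {u v} → info d K u ≡ info d K v → info d K (x ∷ u) ≡ info d K (x ∷ v)
  info-∷ x {u} {v} e = info-cong d K {x ∷ u} {x ∷ v} (take-congʳ K (x ∷ []) (take-info e))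
    (subst₂ (λ y z → take K y ≡ take K z) (sym (unfold-reverse x u)) (sym (unfold-reverse x v))
      (take-congˡ K (x ∷ [])
          (trans (sym (suffixOf-info d K u)) (trans (cong (suffixOf d K) e) (suffixOf-info d K v)))))
    (mod-+ 1 1 (length u) (length v) refl
        (trans (sym (residueOf-info d K u)) (trans (cong (residueOf d K) e) (residueOf-info d K v))))

  alike-∷ : ∀ x {u v} → Alike u v → Alike (x ∷ u) (x ∷ v)
  alike-∷ x {u} {v} p = record
    { info≡ = info-∷ x info≡
    ; ψ≡ = ψ-++ {x ∷ []} refl ψ≡
    ; value≈ = λ r → N.trans (H.homo (_ ∷ []) (enc d K (suc r) u []))
        (N.trans (N.∙-cong (N.reflexive (cong (λ w → hom (combine (r mod suc d) w ∷ []))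
            (window-cong K (take-congʳ K (x ∷ []) (take-congˡ K [] (take-info info≡))))))
                           (value≈ (suc r)))
                 (N.sym (H.homo (_ ∷ []) (enc d K (suc r) v [])))) }
    where open Alike p

  -- Recognition asks for a decidable accepting set, but `Accepts` quantifies over all words. Alike
  -- words satisfy it together and `code` takes finitely many values, so a search among short words
  -- decides it.
  accepts? : ∀ c → Decidable (Accepts c)
  accepts? c z = reachable? code (λ x p → alike⇒code (alike-∷ x (code⇒alike p)))
    (λ v → (info d K v Fin.≟ c) ×-dec (finite⇒decidable N-finite (hom (enc d K 0 v [])) z ×-dec L? v))
    (λ p (i , e , Lu) → let open Alike (code⇒alike p) in
      trans (sym info≡) i , N.trans (N.sym (value≈ 0)) e , L-resp ψ≡ Lu)

  described : ∀ c → Definable F (λ w → Accepts c (hom w))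
  described c = from (corresponds _) (target , in-V , record
    { φ = hom ; φ-morphism = isHom ; Accept = Accepts c
    ; Accept-resp = λ x≈y (v , i , e , Lv) → v , i , N.trans e x≈y , Lv
    ; Accept? = accepts? c ; recognizes = λ _ → mk⇔ id id })

  clause : Fin (Info {n} d K) → Closed (numerical σ ∪ᴾ (LOC ∪ᴾ MOD^ (suc d)))
  clause c = hasInfo σ d K c ∧ᶠ sub (encode σ {n} d K) (proj₁ (described c))

  disjunction : List (Fin (Info {n} d K)) → Closed (numerical σ ∪ᴾ (LOC ∪ᴾ MOD^ (suc d)))
  disjunction []       = ⊥ᶠ
  disjunction (c ∷ cs) = clause c ∨ᶠ disjunction cs

  disjunction-∈ : ∀ cs → Enrich F (LOC ∪ᴾ MOD^ (suc d)) (disjunction cs)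
  disjunction-∈ []       = enrich-qf isFragment ⊥ᶠ
  disjunction-∈ (c ∷ cs) = enrich-∨ isFragment
    (enrich-∧ isFragment (enrich-qf isFragment (hasInfo-qf σ d K c))
        (enrich-sub isFragment (encode σ {n} d K) (proj₁ (proj₂ (described c)))))
    (disjunction-∈ cs)

  clause-sat : ∀ u c → u ⊨ clause c ⇔ (info d K u ≡ c × Accepts c (value 0 u))
  clause-sat u c = mk⇔
    (λ (p , q) → to (hasInfo-sat σ d K u c) p , from (sem (enc d K 0 u [])) (from translate q))
    (λ (p , q) → from (hasInfo-sat σ d K u c) p , to translate (to (sem (enc d K 0 u [])) q))
    where
    sem = proj₂ (proj₂ (described c))
    translate = sub-⊨ (enc d K 0 u []) u (length-enc d K 0 u []) (encode σ {n} d K) (λ _ → ⊤)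
        (encode-faithful σ d K u)
      (proj₁ (described c)) (over-all (λ _ → tt) (proj₁ (described c)))

  sound : ∀ u → L u → u ⊨ disjunction (allFin _)
  sound u Lu = pick (allFin _) (∈-allFin (info d K u))
    where
    pick : ∀ cs → info d K u ∈ cs → u ⊨ disjunction cs
    pick (c ∷ cs) (here refl) = inj₁ (from (clause-sat u c) (refl , u , refl , N.refl , Lu))
    pick (c ∷ cs) (there i)   = inj₂ (pick cs i)

  complete : ∀ u → u ⊨ disjunction (allFin _) → L u
  complete u = any (allFin _)
    where
    any : ∀ cs → u ⊨ disjunction cs → L u
    any (c ∷ cs) (inj₂ s) = any cs s
    any (c ∷ cs) (inj₁ s) with to (clause-sat u c) s
    ... | i , v , j , e , Lv = captures v u (trans j (sym i)) e Lv

-- The stable semigroup, and from capture to its local monoids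

module StableSemigroup {n} (L : Language n) (fin : FiniteIndex L) (s : ℕ) (0<s : 0 < s)
                       (stable : IsStable (syntacticMonoid L) id s) where

  module S = Monoid (syntacticMonoid L)

  _∼_ : Word n → Word n → Set
  _∼_ = SyntacticCongruence L

  open RegularLanguage fin

  T : Semigroup 0ℓ 0ℓ
  T = stableSemigroup (syntacticMonoid L) (syntacticMorphism L) (syntacticMorphism-isMorphism L) s stable

  module T = Semigroup T

  length-split : ∀ k (w : Word n) {m} → length w ≡ k + m → length (take k w) ≡ k × length (drop k w) ≡ m
  length-split k w {m} e =
    trans (length-take k w) (m≤n⇒m⊓n≡m (subst (k ≤_) (sym e) (m≤m+n k m))) ,
    trans (length-drop k w) (trans (cong (_∸ k) e) (m+n∸m≡n k m))

  abstract
    -- By stability an element has a representative of length `2 * s`; its second half has length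
    -- `s` and can be stretched again. Thus every element has representatives whose length is any
    -- positive multiple of `s`.
    stretch : ∀ k {m} → Image (syntacticMonoid L) id s m → Image (syntacticMonoid L) id (suc k * s) m
    stretch zero    (w , |w| , w∼m) = w , trans |w| (sym (+-identityʳ s)) , w∼m
    stretch (suc k) m∈ =
      let w , |w| , w∼m = proj₁ stable m∈
          |a| , |b| = length-split s w |w|
          b′ , |b′| , b′∼b = stretch k (drop s w , trans |b| (+-identityʳ s) , S.refl)
      in take s w ++ b′ , trans (length-++ (take s w)) (cong₂ _+_ |a| |b′|) ,
         S.trans (S.∙-congˡ {take s w} b′∼b) (S.trans (S.reflexive (take++drop≡id s w)) w∼m)

    element : Fin (length (words {n} s)) → T.Carrier
    element i = List.lookup (words s) i , List.lookup (words s) i , words-sound s (∈-lookup i) , S.refl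

    element-onto : ∀ t → ∃[ i ] element i T.≈ t
    element-onto (m , w , refl , w∼m) = Any.index w∈ , S.trans (S.reflexive (sym (lookup-index w∈))) w∼m
      where
      w∈ : w ∈ words (length w)
      w∈ = words-complete w

  module LocalMonoid (e : T.Carrier) (e∙e≈e : e T.∙ e T.≈ e) where

    eTe : Monoid 0ℓ 0ℓ
    eTe = localMonoid T e e∙e≈e

    module eTe = Monoid eTe

    cut : T.Carrier → eTe.Carrier
    cut t = e T.∙ t T.∙ e , t , T.refl {e T.∙ t T.∙ e}

    localMonoid-finite : IsFinite eTe.setoid
    localMonoid-finite = surjection⇒finite
      (record { isDecEquivalence = record { isEquivalence = eTe.isEquivalence ; _≟_ = λ x y →
          proj₁ (proj₁ x) ∼? proj₁ (proj₁ y) } })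
      (cut ∘ element)
      (λ (x , t , x≈ete) → let i , tᵢ≈t = element-onto t in
        i , S.trans (S.∙-congʳ {proj₁ e} (S.∙-congˡ {proj₁ e} tᵢ≈t)) (S.sym x≈ete))

  module _ {v} {V : Pred (Monoid 0ℓ 0ℓ) v} (isVariety : IsVariety V) where

    -- A long word E for e screens the encoding of a block between two copies of E
    -- from the rest of the word.
    captured⇒local : ∀ d → Captured V L d → LocalMonoidsIn T V
    captured⇒local d cap e e∙e≈e = IsVariety.≺-closed isVariety localMonoid-finite divides (HomInto.in-V N)
      where
      open Captured cap
      open LocalMonoid e e∙e≈e
      open HomInto J
      module J = Monoid target
      module H = MonoidMorphisms.IsMonoidHomomorphism isHom

      long : Image (syntacticMonoid L) id (suc K * suc d * s) (proj₁ e)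
      long = stretch (d + K * suc d) (proj₂ e)

      E : Word n
      E = proj₁ long

      E∼e : E ∼ proj₁ e
      E∼e = proj₂ (proj₂ long)

      multiple : ∀ k → (k * suc d * s) mod suc d ≡ 0 mod suc d
      multiple k = mod-% (k * suc d * s) 0
          (trans (cong (_% suc d)
          (trans (*-assoc k (suc d) s)
          (trans (cong (k *_) (*-comm (suc d) s)) (sym (*-assoc k s (suc d)))))) (m*n%n≡0 (k * s) (suc d)))

      K≤|E| : K ≤ length E
      K≤|E| = begin
        K                   ≤⟨ n≤1+n K ⟩
        suc K               ≤⟨ m≤m*n (suc K) (suc d) ⟩
        suc K * suc d       ≤⟨ m≤m*n (suc K * suc d) s {{>-nonZero 0<s}} ⟩
        suc K * suc d * s   ≡⟨ proj₁ (proj₂ long) ⟨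
        length E            ∎
        where open ≤-Reasoning

      E-multiple : length E mod suc d ≡ 0 mod suc d
      E-multiple = trans (cong (_mod suc d) (proj₁ (proj₂ long))) (multiple (suc K))

      -- The word chosen for the element has length divisible by the modulus, so that blocks do not
      -- shift the residues of what follows them.
      Block : Set
      Block = Σ[ t ∈ T.Carrier ] Image (syntacticMonoid L) id (1 * suc d * s) (proj₁ t)

      Blocks : Monoid 0ℓ 0ℓ
      Blocks = ++-monoid Block

      -- Each block comes with the `E` before it; the closing `E` is left to the context, which
      -- makes `body` a homomorphism.
      body : List Block → Word n
      body []                 = []
      body ((_ , w , _) ∷ bs) = E ++ w ++ body bs

      body-++ : ∀ bs cs → body (bs ++ cs) ≡ body bs ++ body cs
      body-++ []                 cs = refl
      body-++ ((_ , w , _) ∷ bs) cs = sym (trans (++-assoc E (w ++ body bs) (body cs))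
        (cong (E ++_) (trans (++-assoc w (body bs) (body cs)) (cong (w ++_) (sym (body-++ bs cs))))))

      body-multiple : ∀ bs → length (body bs) mod suc d ≡ 0 mod suc d
      body-multiple []                       = refl
      body-multiple ((_ , w , |w| , _) ∷ bs) =
        trans (cong (_mod suc d) (trans (length-++ E) (cong (length E +_) (length-++ w))))
          (mod-+ (length E) 0 (length w + length (body bs)) 0 E-multiple
            (mod-+ (length w) 0 (length (body bs)) 0 (trans (cong (_mod suc d) |w|) (multiple 1))
                (body-multiple bs)))

      body-front : ∀ bs z → take K (body bs ++ E ++ z) ≡ take K E
      body-front []                 z = take-++-≤ K E z K≤|E|
      body-front ((_ , w , _) ∷ bs) z = trans (cong (take K) (++-assoc E (w ++ body bs) (E ++ z)))
          (take-++-≤ K E _ K≤|E|)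

      π : List Block → eTe.Carrier
      π []       = eTe.ε
      π (b ∷ bs) = cut (proj₁ b) eTe.∙ π bs

      word : eTe.Carrier → Word n
      word x = proj₁ (proj₁ x)

      π-++ : ∀ bs cs → π (bs ++ cs) eTe.≈ π bs eTe.∙ π cs
      π-++ []       cs = S.sym {proj₁ e ++ word (π cs)} {word (π cs)} (eTe.identityˡ (π cs))
      π-++ (b ∷ bs) cs = S.trans {c ++ word (π (bs ++ cs))} {c ++ word (π bs) ++ word (π cs)}
        (S.∙-congˡ {c} {word (π (bs ++ cs))} {word (π bs) ++ word (π cs)} (π-++ bs cs))
            (S.sym (S.assoc c (word (π bs)) (word (π cs))))
        where c = word (cut (proj₁ b))

      π∼body : ∀ bs → word (π bs) ∼ (body bs ++ E)
      π∼body []                         = S.sym E∼e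
      π∼body ((t , w , |w| , w∼t) ∷ bs) = begin
        word (cut t) ++ word (π bs)                  ≈⟨ S.assoc (proj₁ e ++ proj₁ t) (proj₁ e) (word (π bs)) ⟩
        (proj₁ e ++ proj₁ t) ++ proj₁ e ++ word (π bs)
            ≈⟨ S.∙-congˡ {proj₁ e ++ proj₁ t} (eTe.identityˡ (π bs)) ⟩
        (proj₁ e ++ proj₁ t) ++ word (π bs)
            ≈⟨ S.∙-cong {proj₁ e ++ proj₁ t} {E ++ w} (S.∙-cong {proj₁ e} {E} (S.sym E∼e) (S.sym w∼t))
            (π∼body bs) ⟩
        (E ++ w) ++ body bs ++ E
            ≡⟨ trans (++-assoc E w _) (trans (cong (E ++_) (sym (++-assoc w (body bs) E)))
            (sym (++-assoc E (w ++ body bs) E))) ⟩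
        (E ++ w ++ body bs) ++ E                     ∎
        where open import Relation.Binary.Reasoning.Setoid S.setoid

      onto : ∀ x → ∃[ bs ] π bs eTe.≈ x
      onto (x , t , x≈ete) = (t , stretch d′ (proj₂ t)) ∷ [] ,
        S.trans (eTe.identityʳ (cut t)) (S.sym x≈ete)
        where d′ = d + 0 * suc d

      value : ℕ → List Block → J.Carrier
      value r bs = hom (enc d K r (body bs) E)

      -- Whatever blocks come next, the text after a block begins with `E`, and windows reach at
      -- most `K` letters into it. Since all lengths are divisible by the modulus, the second factor
      -- keeps its starting residue.
      value-++ : ∀ r bs cs → value r (bs ++ cs) J.≈ value r bs J.∙ value r cs
      value-++ r bs cs = J.trans (J.reflexive (cong hom eq))
          (H.homo (enc d K r (body bs) E) (enc d K r (body cs) E))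
        where
        eq : enc d K r (body (bs ++ cs)) E ≡ enc d K r (body bs) E ++ enc d K r (body cs) E
        eq = trans (cong (λ w → enc d K r w E) (body-++ bs cs)) (trans (enc-++ d K r (body bs) (body cs) E)
          (cong₂ _++_ (enc-context d K r (body bs)
              (trans (cong (take K) (cong (body cs ++_) (sym (++-identityʳ E)))) (body-front cs [])))
            (enc-residue d K (body cs) E (trans (mod-+ r r (length (body bs)) 0 refl (body-multiple bs))
                (cong (_mod suc d) (+-identityʳ r))))))

      -- The left context may have any length, so all starting residues are evaluated together.
      joint = jointHom isVariety {Blocks} (λ (r : Fin (suc d)) → record
        { target = target ; in-V = in-V ; hom = value (toℕ r)
        ; isHom = mkHom Blocks target (λ { refl → J.refl }) (value-++ (toℕ r)) H.ε-homo })

      N = proj₁ joint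

      value-cong : ∀ {bs cs} → HomInto.Kernel N bs cs → ∀ r → value r bs J.≈ value r cs
      value-cong {bs} {cs} ker r =
          J.trans (reduce bs) (J.trans (proj₂ joint ker (r mod suc d)) (J.sym (reduce cs)))
        where
        reduce : ∀ bs → value r bs J.≈ value (toℕ (r mod suc d)) bs
        reduce bs = J.reflexive (cong hom (enc-residue d K (body bs) E (mod-% r (toℕ (r mod suc d))
          (trans (sym (m%n%n≡m%n r (suc d))) (cong (_% suc d) (sym (toℕ-fromℕ< (m%n<n r (suc d)))))))))

      module Context (p q : Word n) where

        whole : List Block → Word n
        whole bs = p ++ body bs ++ E ++ q

        whole-value : ∀ bs → hom (enc d K 0 (whole bs) []) J.≈
                      hom (enc d K 0 p E) J.∙ (value (length p) bs J.∙ hom (enc d K (length p) (E ++ q) []))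
        whole-value bs = J.trans (J.reflexive (cong hom eq)) (J.trans (H.homo _ _) (J.∙-congˡ (H.homo _ _)))
          where
          eq : enc d K 0 (whole bs) [] ≡ enc d K 0 p E ++ enc d K (length p) (body bs) E ++ enc d K
              (length p) (E ++ q) []
          eq = trans (enc-++ d K 0 p (body bs ++ E ++ q) [])
            (cong₂ _++_
              (enc-context d K 0 p (trans (cong (take K) (++-identityʳ (body bs ++ E ++ q)))
                  (body-front bs q)))
              (trans (enc-++ d K (length p) (body bs) (E ++ q) [])
                (cong₂ _++_
                  (enc-context d K (length p) (body bs) (trans (cong (take K) (++-identityʳ (E ++ q)))
                      (take-++-≤ K E q K≤|E|)))
                  (enc-residue d K (E ++ q) []
                      (trans (mod-+ (length p) (length p) (length (body bs)) 0 refl (body-multiple bs))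
                      (cong (_mod suc d) (+-identityʳ (length p))))))))

        -- Whatever the blocks, the word begins with `p ++ E` and ends with `E ++ q`, and `E` has at
        -- least `K` letters: neither end shows the blocks.
        whole-info : ∀ bs cs → info d K (whole bs) ≡ info d K (whole cs)
        whole-info bs cs = info-cong d K
          (take-congʳ K p (trans (body-front bs q) (sym (body-front cs q))))
          (trans (ending bs) (sym (ending cs)))
          (trans (len bs) (sym (len cs)))
          where
          ending : ∀ bs → take K (reverse (whole bs)) ≡ take K (reverse (E ++ q))
          ending bs = trans (cong (take K) (trans (cong reverse (sym (++-assoc p (body bs) (E ++ q))))
              (reverse-++ (p ++ body bs) (E ++ q))))
            (take-++-≤ K (reverse (E ++ q)) _
                (≤-trans K≤|E| (subst (length E ≤_)
                (sym (trans (length-reverse (E ++ q)) (length-++ E))) (m≤m+n (length E) (length q)))))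

          len : ∀ bs → length (whole bs) mod suc d ≡ (length p + (0 + length (E ++ q))) mod suc d
          len bs = trans (cong (_mod suc d) (trans (length-++ p) (cong (length p +_) (length-++ (body bs)))))
            (mod-+ (length p) (length p) _ _ refl (mod-+ (length (body bs)) 0 (length (E ++ q))
                (length (E ++ q)) (body-multiple bs) refl))

        whole-∈ : ∀ bs → L (p ++ word (π bs) ++ q) ⇔ L (whole bs)
        whole-∈ bs = subst (λ w → L (p ++ word (π bs) ++ q) ⇔ L (p ++ w)) (++-assoc (body bs) E q)
            (π∼body bs p q)

        transport : ∀ {bs cs} → HomInto.Kernel N bs cs → L (p ++ word (π bs) ++ q) → L (p ++ word (π cs) ++ q)
        transport {bs} {cs} ker l = from (whole-∈ cs) (captures (whole bs) (whole cs) (whole-info bs cs)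
          (J.trans (whole-value bs)
              (J.trans (J.∙-congˡ (J.∙-congʳ (value-cong {bs} {cs} ker (length p))))
              (J.sym (whole-value cs))))
          (to (whole-∈ bs) l))

      divides : eTe ≺ HomInto.target N
      divides = ≺-intro Blocks π (HomInto.hom N) (mkHom Blocks eTe (λ { {x} refl → eTe.refl {π x} })
          π-++ (eTe.refl {eTe.ε})) (HomInto.isHom N) onto
        (λ {bs} {cs} ker p q → let open Context p q in
          mk⇔ (transport {bs} {cs} ker) (transport {cs} {bs} (Monoid.sym (HomInto.target N) ker)))

-- The category of idempotents of a finite semigroup

module Karoubi (T : Semigroup 0ℓ 0ℓ) (_≟ᵀ_ : Decidable₂ (Semigroup._≈_ T)) {k} (element : Fin k →
    Semigroup.Carrier T)
               (element-onto : ∀ t → ∃[ i ] Semigroup._≈_ T (element i) t) where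

  open Semigroup T using (Carrier; _≈_; _∙_; ∙-cong; ∙-congˡ; ∙-congʳ; assoc)
    renaming (refl to ≈-refl; sym to ≈-sym; trans to ≈-trans; setoid to ≈-setoid)
  open import Relation.Binary.Reasoning.Setoid ≈-setoid

  abstract
    idempotents : List Carrier
    idempotents = filter (λ t → (t ∙ t) ≟ᵀ t) (List.tabulate element)

    count : ℕ
    count = length idempotents

    ⟦_⟧ : Fin count → Carrier
    ⟦_⟧ = List.lookup idempotents

    idem : ∀ (i : Fin count) → ⟦ i ⟧ ∙ ⟦ i ⟧ ≈ ⟦ i ⟧
    idem i = All.lookupₛ ≈-setoid (λ x≈y p → ≈-trans (∙-cong (≈-sym x≈y) (≈-sym x≈y)) (≈-trans p x≈y))
      (all-filter (λ t → (t ∙ t) ≟ᵀ t) (List.tabulate element))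
          (SetoidMembershipₚ.∈-lookup ≈-setoid idempotents i)

    idempotent-onto : ∀ {e} → e ∙ e ≈ e → ∃[ i ] ⟦ i ⟧ ≈ e
    idempotent-onto {e} ee≈e = Any.index e∈ , ≈-sym (lookup-index e∈)
      where
      open SetoidMembership ≈-setoid using () renaming (_∈_ to _∈ₛ_)
      e∈ : e ∈ₛ idempotents
      e∈ = SetoidMembershipₚ.∈-filter⁺ ≈-setoid _ (λ x≈y p → ≈-trans (∙-cong (≈-sym x≈y) (≈-sym x≈y))
          (≈-trans p x≈y))
        (let i , tᵢ≈e = element-onto e in SetoidMembershipₚ.∈-resp-≈ ≈-setoid tᵢ≈e
            (SetoidMembershipₚ.∈-tabulate⁺ ≈-setoid i)) ee≈e

  Idempotent : Set
  Idempotent = Fin count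

  sandwich : Idempotent → Idempotent → Carrier → Carrier
  sandwich i j x = ⟦ i ⟧ ∙ x ∙ ⟦ j ⟧

  sandwich-cong : ∀ i j {x y} → x ≈ y → sandwich i j x ≈ sandwich i j y
  sandwich-cong i j p = ∙-congʳ (∙-congˡ p)

  -- Arrows are arbitrary elements of `T`, compared after sandwiching. As composition of arrows
  -- becomes multiplication in `T`, the laws of the category reduce to those of `T`.
  sandwich-∙ : ∀ i j k x y → sandwich i k (x ∙ ⟦ j ⟧ ∙ y) ≈ sandwich i j x ∙ sandwich j k y
  sandwich-∙ i j k x y = begin
    ⟦ i ⟧ ∙ (x ∙ ⟦ j ⟧ ∙ y) ∙ ⟦ k ⟧                ≈⟨ ∙-congʳ (∙-congˡ (∙-congʳ (∙-congˡ (idem j)))) ⟨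
    ⟦ i ⟧ ∙ (x ∙ (⟦ j ⟧ ∙ ⟦ j ⟧) ∙ y) ∙ ⟦ k ⟧      ≈⟨ ∙-congʳ (∙-congˡ (∙-congʳ (assoc x ⟦ j ⟧ ⟦ j ⟧))) ⟨
    ⟦ i ⟧ ∙ (x ∙ ⟦ j ⟧ ∙ ⟦ j ⟧ ∙ y) ∙ ⟦ k ⟧        ≈⟨ ∙-congʳ (∙-congˡ (assoc (x ∙ ⟦ j ⟧) ⟦ j ⟧ y)) ⟩
    ⟦ i ⟧ ∙ (x ∙ ⟦ j ⟧ ∙ (⟦ j ⟧ ∙ y)) ∙ ⟦ k ⟧      ≈⟨ ∙-congʳ (assoc ⟦ i ⟧ (x ∙ ⟦ j ⟧) (⟦ j ⟧ ∙ y)) ⟨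
    ⟦ i ⟧ ∙ (x ∙ ⟦ j ⟧) ∙ (⟦ j ⟧ ∙ y) ∙ ⟦ k ⟧      ≈⟨ assoc (⟦ i ⟧ ∙ (x ∙ ⟦ j ⟧)) (⟦ j ⟧ ∙ y) ⟦ k ⟧ ⟩
    ⟦ i ⟧ ∙ (x ∙ ⟦ j ⟧) ∙ (⟦ j ⟧ ∙ y ∙ ⟦ k ⟧)      ≈⟨ ∙-congʳ (assoc ⟦ i ⟧ x ⟦ j ⟧) ⟨
    ⟦ i ⟧ ∙ x ∙ ⟦ j ⟧ ∙ (⟦ j ⟧ ∙ y ∙ ⟦ k ⟧)        ∎

  sandwich-1 : ∀ i → sandwich i i ⟦ i ⟧ ≈ ⟦ i ⟧
  sandwich-1 i = ≈-trans (∙-congʳ (idem i)) (idem i)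

  sandwich-unitˡ : ∀ i j x → ⟦ i ⟧ ∙ sandwich i j x ≈ sandwich i j x
  sandwich-unitˡ i j x = ≈-trans (≈-sym (assoc _ _ _))
      (∙-congʳ (≈-trans (≈-sym (assoc _ _ _)) (∙-congʳ (idem i))))

  sandwich-unitʳ : ∀ i j x → sandwich i j x ∙ ⟦ j ⟧ ≈ sandwich i j x
  sandwich-unitʳ i j x = ≈-trans (assoc _ _ _) (∙-congˡ (idem j))

  -- Elements x and y are equal as arrows when e x f ≈ e y f.
  karoubi : Category
  karoubi = record
    { Obj = Idempotent
    ; Hom = λ i j → record
      { Carrier = Carrier
      ; _≈_ = λ x y → sandwich i j x ≈ sandwich i j y
      ; isEquivalence = record { refl = ≈-refl ; sym = ≈-sym ; trans = ≈-trans } }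
    ; 1# = ⟦_⟧
    ; _∙_ = λ {_} {j} x y → x ∙ ⟦ j ⟧ ∙ y
    ; ∙-cong = λ {i} {j} {k} {x} {x′} {y} {y′} p q →
        ≈-trans (sandwich-∙ i j k x y) (≈-trans (∙-cong p q) (≈-sym (sandwich-∙ i j k x′ y′)))
    ; assoc = λ {h} {i} {j} {k} x y z → sandwich-cong h k (begin
        (x ∙ ⟦ i ⟧ ∙ y) ∙ ⟦ j ⟧ ∙ z      ≈⟨ ∙-congʳ (assoc (x ∙ ⟦ i ⟧) y ⟦ j ⟧) ⟩
        x ∙ ⟦ i ⟧ ∙ (y ∙ ⟦ j ⟧) ∙ z      ≈⟨ assoc (x ∙ ⟦ i ⟧) (y ∙ ⟦ j ⟧) z ⟩
        x ∙ ⟦ i ⟧ ∙ (y ∙ ⟦ j ⟧ ∙ z)      ∎)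
    ; identityˡ = λ {i} {j} x → ≈-trans (sandwich-∙ i i j ⟦ i ⟧ x)
          (≈-trans (∙-congʳ (sandwich-1 i)) (sandwich-unitˡ i j x))
    ; identityʳ = λ {i} {j} x →
          ≈-trans (sandwich-∙ i j j x ⟦ j ⟧) (≈-trans (∙-congˡ (sandwich-1 j)) (sandwich-unitʳ i j x))
    }

  open Category karoubi using (Hom)

  arrow? : ∀ i j → Decidable₂ (Setoid._≈_ (Hom i j))
  arrow? i j x y = sandwich i j x ≟ᵀ sandwich i j y

  karoubi-finite : IsFiniteCategory karoubi
  karoubi-finite = (_ , idInverse _) , λ i j → surjection⇒finite
    (record { isDecEquivalence = record { isEquivalence = Setoid.isEquivalence (Hom i j) ; _≟_ =
        arrow? i j } })
    element (λ x → let t , p = element-onto x in t , sandwich-cong i j p)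

  endomorphisms≺local : ∀ i → endomorphisms karoubi i ≺ localMonoid T ⟦ i ⟧ (idem i)
  endomorphisms≺local i = ≺-intro End id (λ x → sandwich i i x , x , ≈-refl)
      (mkHom End End id (λ _ _ → ≈-refl) ≈-refl)
    (mkHom End (localMonoid T ⟦ i ⟧ (idem i)) id (λ x y → sandwich-∙ i i i x y) (sandwich-1 i))
        (λ x → x , ≈-refl) id
    where End = endomorphisms karoubi i

  -- Locality enters here: the endomorphism monoids of the category divide local monoids of `T`, so
  -- membership of the latter in `V` makes the whole category divide one monoid of `V`.
  local⇒divides : ∀ {v} {V : Pred (Monoid 0ℓ 0ℓ) v} → IsVariety V → IsLocal V → LocalMonoidsIn T V →
      DividesMonoidOf V karoubi
  local⇒divides isVariety isLocal local = from (isLocal karoubi karoubi-finite)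
    (λ i → IsVariety.≺-closed isVariety (proj₂ karoubi-finite i i) (endomorphisms≺local i)
        (local ⟦ i ⟧ (idem i)))

-- Cutting words into blocks

flat : ∀ {n s} → List (Vec (Fin n) s) → Word n
flat []      = []
flat (b ∷ X) = toList b ++ flat X

flat-++ : ∀ {n s} (X Y : List (Vec (Fin n) s)) → flat (X ++ Y) ≡ flat X ++ flat Y
flat-++ []      Y = refl
flat-++ (b ∷ X) Y = trans (cong (toList b ++_) (flat-++ X Y)) (sym (++-assoc (toList b) (flat X) (flat Y)))

length-flat : ∀ {n s} (X : List (Vec (Fin n) s)) → length (flat X) ≡ length X * s
length-flat []      = refl
length-flat (b ∷ X) = trans (length-++ (toList b)) (cong₂ _+_ (length-toList b) (length-flat X))

takeBlock : ∀ {n} s → Word n → Maybe (Vec (Fin n) s × Word n)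
takeBlock zero    u       = just ([] , u)
takeBlock (suc s) []      = nothing
takeBlock (suc s) (x ∷ u) = Maybe.map (λ (b , w) → x ∷ b , w) (takeBlock s u)

takeBlock-block : ∀ {n s} (b : Vec (Fin n) s) w → takeBlock s (toList b ++ w) ≡ just (b , w)
takeBlock-block []      w = refl
takeBlock-block (x ∷ b) w = cong (Maybe.map (λ (b , w) → x ∷ b , w)) (takeBlock-block b w)

takeBlock-short : ∀ {n} s (w : Word n) → length w < s → takeBlock s w ≡ nothing
takeBlock-short (suc s) []      _ = refl
takeBlock-short (suc s) (x ∷ w) (s≤s p) = cong (Maybe.map (λ (b , w) → x ∷ b , w)) (takeBlock-short s w p)

takeBlock-just : ∀ {n} s (u : Word n) {b w} → takeBlock s u ≡ just (b , w) → u ≡ toList b ++ w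
takeBlock-just zero    u refl = refl
takeBlock-just (suc s) (x ∷ u) p with takeBlock s u in eq
takeBlock-just (suc s) (x ∷ u) refl | just _ = cong (x ∷_) (takeBlock-just s u eq)

takeBlock-nothing : ∀ {n} s (u : Word n) → takeBlock s u ≡ nothing → length u < s
takeBlock-nothing (suc s) []      _ = s≤s z≤n
takeBlock-nothing (suc s) (x ∷ u) p with takeBlock s u in eq
... | nothing = s≤s (takeBlock-nothing s u eq)

chunk : ∀ {n} s → ℕ → Word n → List (Vec (Fin n) s)
chunk s zero    u = []
chunk s (suc m) u with takeBlock s u
... | nothing      = []
... | just (b , w) = b ∷ chunk s m w

take-flat : ∀ {n s} m (b : Vec (Fin n) s) w → take (s + m) (toList b ++ w) ≡ toList b ++ take m w
take-flat m []      w = refl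
take-flat m (x ∷ b) w = cong (x ∷_) (take-flat m b w)

-- A window of `m * s` letters at the start of a block shows the next `m` blocks, or all that are
-- left: the remainder `r` is too short to be taken for a block.
chunk-flat : ∀ {n s} m (X : List (Vec (Fin n) s)) r → length r < s →
    chunk s m (take (m * s) (flat X ++ r)) ≡ take m X
chunk-flat zero X r _ = refl
chunk-flat {s = s} (suc m) [] r |r|<s
  rewrite takeBlock-short s (take (s + m * s) r)
      (≤-trans (s≤s (≤-trans (≤-reflexive (length-take (s + m * s) r)) (m⊓n≤n _ _))) |r|<s) = refl
chunk-flat {s = s} (suc m) (b ∷ X) r |r|<s
  rewrite ++-assoc (toList b) (flat X) r | take-flat (m * s) b (flat X ++ r) | takeBlock-block b
      (take (m * s) (flat X ++ r)) =
  cong (b ∷_) (chunk-flat m X r |r|<s)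

chunk-all : ∀ {n s} m (X : List (Vec (Fin n) s)) r → length r < s → length X < m → chunk s m (flat X ++ r) ≡ X
chunk-all {s = s} m X r |r|<s |X|<m = trans
  (cong (chunk s m) (sym (take-all (m * s) (flat X ++ r) fits)))
  (trans (chunk-flat m X r |r|<s) (take-all m X (<⇒≤ |X|<m)))
  where
  fits : m * s ≥ length (flat X ++ r)
  fits = begin
    length (flat X ++ r)      ≡⟨ trans (length-++ (flat X)) (cong (_+ length r) (length-flat X)) ⟩
    length X * s + length r   ≤⟨ +-monoʳ-≤ (length X * s) (<⇒≤ |r|<s) ⟩
    length X * s + s          ≡⟨ +-comm (length X * s) s ⟩
    suc (length X) * s        ≤⟨ *-monoˡ-≤ s |X|<m ⟩
    m * s                     ∎
    where open ≤-Reasoning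

record Blocks {n} (s : ℕ) (u : Word n) : Set where
  constructor blocks
  field
    X     : List (Vec (Fin n) s)
    r     : Word n
    u≡    : u ≡ flat X ++ r
    |r|<s : length r < s

decompose : ∀ {n} d (u : Word n) → Blocks (suc d) u
decompose {n} d u = go (length u) u ≤-refl
  where
  go : ∀ k (u : Word n) → length u ≤ k → Blocks (suc d) u
  go k u |u|≤k with takeBlock (suc d) u in eq
  ... | nothing = blocks [] u refl (takeBlock-nothing (suc d) u eq)
  go zero    []      _           | just _ with () ← eq
  go (suc k) (x ∷ u) (s≤s |u|≤k) | just (x′ ∷ b , w) with takeBlock-just (suc d) (x ∷ u) eq
  ... | refl with go k w
      (≤-trans (≤-trans (m≤n+m (length w) (length (toList b)))
      (≤-reflexive (sym (length-++ (toList b))))) |u|≤k)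
  ...   | blocks X r refl |r| = blocks ((x ∷ b) ∷ X) r
      (cong (x ∷_) (sym (++-assoc (toList b) (flat X) r))) |r|

take-≤ : ∀ {A : Set} {k m} {u v : List A} → k ≤ m → take m u ≡ take m v → take k u ≡ take k v
take-≤ {k = k} {m} {u} {v} k≤m p = trans (sym (shrink u)) (trans (cong (take k) p) (shrink v))
  where
  shrink : ∀ w → take k (take m w) ≡ take k w
  shrink w = trans (take-take k m w) (cong (λ j → take j w) (m≤n⇒m⊓n≡m k≤m))

-- Serves to pass from a suffix of the first `m` blocks to the first `m` blocks of that suffix, for
-- properties preserved by adding blocks on the right.
take-drop-++ : ∀ {A : Set} j m (Z : List A) → ∃[ R ] take m (drop j Z) ≡ drop j (take m Z) ++ R
take-drop-++ zero    m       Z       = [] , sym (++-identityʳ (take m Z))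
take-drop-++ (suc j) zero    Z       = [] , refl
take-drop-++ (suc j) (suc m) []      = [] , refl
take-drop-++ (suc j) (suc m) (x ∷ Z) with take-drop-++ j m Z | longer m (drop j Z)
  where
  longer : ∀ {A : Set} m (Z : List A) → ∃[ R ] take (suc m) Z ≡ take m Z ++ R
  longer zero    Z       = take 1 Z , refl
  longer (suc m) []      = [] , refl
  longer (suc m) (x ∷ Z) = let R , e = longer m Z in R , cong (x ∷_) e
... | R , e | R′ , e′ = R ++ R′ , trans e′ (trans (cong (_++ R′) e) (++-assoc (drop j (take m Z)) R R′))

suffix-unique : ∀ {A : Set} k (x y x′ y′ : List A) → length y ≡ length y′ → length y ≤ k →
                take k (reverse (x ++ y)) ≡ take k (reverse (x′ ++ y′)) → y ≡ y′
suffix-unique k x y x′ y′ |y|≡|y′| |y|≤k p = reverse-injective (begin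
  reverse y                                        ≡⟨ front x y refl ⟨
  take (length y) (reverse (x ++ y))               ≡⟨ take-≤ |y|≤k p ⟩
  take (length y) (reverse (x′ ++ y′))             ≡⟨ front x′ y′ |y|≡|y′| ⟩
  reverse y′                                       ∎)
  where
  open ≡-Reasoning
  front : ∀ x z → length y ≡ length z → take (length y) (reverse (x ++ z)) ≡ reverse z
  front x z e = trans (cong (take (length y)) (reverse-++ x z))
    (trans (take-++-≤ (length y) (reverse z) (reverse x) (≤-reflexive (trans e (sym (length-reverse z)))))
      (take-all (length y) (reverse z) (≤-reflexive (trans (length-reverse z) (sym e)))))

private
  just≢nothing : ∀ {A : Set} {x : A} → ¬ just x ≡ nothing
  just≢nothing ()

  regroup : ∀ {A : Set} (t u v w x y : List A) →
      t ++ u ++ ((v ++ w) ++ x) ++ y ≡ ((t ++ (u ++ v) ++ w) ++ x) ++ y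
  regroup t u v w x y rewrite ++-assoc (v ++ w) x y | ++-assoc v w (x ++ y) | ++-assoc
      (t ++ (u ++ v) ++ w) x y
    | ++-assoc t ((u ++ v) ++ w) (x ++ y) | ++-assoc (u ++ v) w (x ++ y) | ++-assoc u v (w ++ x ++ y) = refl

-- Good places in a sequence of blocks, and the arrows between them

module Delay {n} (L : Language n) (fin : FiniteIndex L) (d : ℕ)
    (stable : IsStable (syntacticMonoid L) id (suc d)) where

  open StableSemigroup L fin (suc d) (s≤s z≤n) stable
  open RegularLanguage fin
  open Karoubi T (λ x y → proj₁ x ∼? proj₁ y) element element-onto
  module C = Category karoubi

  private
    Block : Set
    Block = Vec (Fin n) (suc d)

  ⟪_⟫ : Idempotent → Word n
  ⟪ i ⟫ = proj₁ ⟦ i ⟧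

  span : ℕ
  span = suc index

  power : Word n → ℕ → Word n
  power w zero    = []
  power w (suc k) = w ++ power w k

  power-+ : ∀ w a b → power w a ++ power w b ≡ power w (a + b)
  power-+ w zero    b = refl
  power-+ w (suc a) b = trans (++-assoc w (power w a) (power w b)) (cong (w ++_) (power-+ w a b))

  powerᵀ : T.Carrier → ℕ → T.Carrier
  powerᵀ t zero    = t
  powerᵀ t (suc k) = t T.∙ powerᵀ t k

  powerᵀ-power : ∀ t k → proj₁ (powerᵀ t k) ≡ power (proj₁ t) (suc k)
  powerᵀ-power t zero    = sym (++-identityʳ (proj₁ t))
  powerᵀ-power t (suc k) = cong (proj₁ t ++_) (powerᵀ-power t k)

  -- If `t` fixes `y`, so do all powers of `t`, one of which is idempotent. `powerᵀ t m` has
  -- exponent `suc m`, hence the match on a successor.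
  fixed-by-idempotent : ∀ t {y} → (proj₁ t ++ y) ∼ y → ∃[ i ] (⟪ i ⟫ ++ y) ∼ y
  fixed-by-idempotent t {y} ty∼y with idempotentIndex (λ a b → power (proj₁ t) a ∼ power (proj₁ t) b)
      (ψ ∘ power (proj₁ t)) S.trans ψ⇒∼ (S.∙-congˡ {proj₁ t})
  ... | suc m , _ , p with idempotent-onto {powerᵀ t m} e∙e≈e
    where
    e = powerᵀ-power t m
    e∙e≈e : powerᵀ t m T.∙ powerᵀ t m T.≈ powerᵀ t m
    e∙e≈e = S.trans (S.reflexive
        (trans (cong₂ _++_ e e) (trans (power-+ (proj₁ t) (suc m) (suc m))
        (cong (power (proj₁ t)) (cong (suc m +_) (sym (+-identityʳ (suc m))))))))
      (S.trans (S.sym p) (S.reflexive (sym e)))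
  ... | i , i≈e = i , S.trans (S.∙-congʳ {y} i≈e)
      (S.trans (S.∙-congʳ {y} (S.reflexive (powerᵀ-power t m))) (fixed (suc m)))
    where
    fixed : ∀ k → (power (proj₁ t) k ++ y) ∼ y
    fixed zero    = S.refl
    fixed (suc k) = S.trans (S.assoc (proj₁ t) (power (proj₁ t) k) y)
        (S.trans (S.∙-congˡ {proj₁ t} (fixed k)) ty∼y)

  product : Block → List Block → T.Carrier
  product b []      = toList b , toList b , length-toList b , S.refl
  product b (c ∷ X) = product b [] T.∙ product c X

  product-flat : ∀ b X → proj₁ (product b X) ≡ flat (b ∷ X)
  product-flat b []      = sym (++-identityʳ (toList b))
  product-flat b (c ∷ X) = cong (toList b ++_) (product-flat c X)

  -- A suffix of the sequence of blocks is good when its first span blocks are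
  -- fixed by an idempotent; this only depends on a bounded look-ahead.

  Fixed : Idempotent → List Block → Set
  Fixed i Y = (⟪ i ⟫ ++ flat Y) ∼ flat Y

  abstract
    fixed? : ∀ Y → Dec (∃[ i ] Fixed i Y)
    fixed? Y = Fin.any? (λ i → fixedBy? i)
      where
      fixedBy? : ∀ i → Dec (Fixed i Y)
      fixedBy? i = (⟪ i ⟫ ++ flat Y) ∼? flat Y

  choose : ∀ {Y} → Dec (∃[ i ] Fixed i Y) → Maybe Idempotent
  choose (yes (i , _)) = just i
  choose (no _)        = nothing

  -- The empty sequence is never good: an arrow that starts at a good place needs a first block,
  -- since `T` need not contain a unit.
  goodWindow : List Block → Maybe Idempotent
  goodWindow []      = nothing
  goodWindow (b ∷ Y) = choose {b ∷ Y} (fixed? (b ∷ Y))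

  good : List Block → Maybe Idempotent
  good Z = goodWindow (take span Z)

  choose-sound : ∀ {Y i} (D : Dec (∃[ i ] Fixed i Y)) → choose {Y} D ≡ just i → Fixed i Y
  choose-sound (yes (i , fixed)) refl = fixed

  choose-complete : ∀ {Y i} (D : Dec (∃[ i ] Fixed i Y)) → Fixed i Y → choose {Y} D ≢ nothing
  choose-complete {i = i} (no ¬fixed) fixed p = ¬fixed (i , fixed)

  goodWindow-sound : ∀ Y {i} → goodWindow Y ≡ just i → Fixed i Y
  goodWindow-sound (b ∷ Y) = choose-sound {b ∷ Y} (fixed? (b ∷ Y))

  goodWindow-complete : ∀ Y {i} → 0 < length Y → Fixed i Y → goodWindow Y ≢ nothing
  goodWindow-complete (b ∷ Y) {i} _ = choose-complete {b ∷ Y} {i} (fixed? (b ∷ Y))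

  fixed-++ : ∀ i Y R → Fixed i Y → Fixed i (Y ++ R)
  fixed-++ i Y R fixed rewrite flat-++ Y R = S.trans (S.sym (S.assoc ⟪ i ⟫ (flat Y) (flat R)))
      (S.∙-congʳ {flat R} fixed)

  good-sound : ∀ Z {i} → good Z ≡ just i → Fixed i Z
  good-sound Z {i} p = subst (Fixed i) (take++drop≡id span Z)
    (fixed-++ i (take span Z) (drop span Z) (goodWindow-sound (take span Z) p))

  -- Let the suffixes at `j < j′` of the first `span` blocks have equal images. The product of the
  -- blocks between them fixes the later one, hence so does an idempotent. That suffix is nonempty
  -- and lies within the look-ahead at `j′`, whose further blocks do no harm.
  good-nearby : ∀ Z → span ≤ length Z → ∃[ j ] (j < span × good (drop j Z) ≢ nothing)
  good-nearby Z span≤|Z| with pigeonhole (n<1+n index) (λ j → ψ (flat (drop (toℕ j) (take span Z))))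
  ... | j , j′ , j<j′ , same = toℕ j′ , Fin.toℕ<n j′ , isGood
    where
    Y : List Block
    Y = take span Z

    |Y| : length Y ≡ span
    |Y| = trans (length-take span Z) (m≤n⇒m⊓n≡m span≤|Z|)

    nonempty : ∀ (i : Fin span) → 0 < length (drop (toℕ i) Y)
    nonempty i = subst (0 <_) (sym (trans (length-drop (toℕ i) Y) (cong (_∸ toℕ i) |Y|)))
        (m<n⇒0<n∸m (Fin.toℕ<n i))

    absorb : ∀ c W → 0 < c → 0 < length W → flat W ∼ flat (drop c W) → ∃[ i ] Fixed i (drop c W)
    absorb (suc c) (b ∷ W) _ _ p = fixed-by-idempotent (product b (take c W))
      (S.trans (S.reflexive (trans (cong (_++ flat (drop c W)) (product-flat b (take c W)))
        (trans (sym (flat-++ (b ∷ take c W) (drop c W))) (cong (flat ∘ (b ∷_)) (take++drop≡id c W))))) p)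

    j+c : drop (toℕ j′ ∸ toℕ j) (drop (toℕ j) Y) ≡ drop (toℕ j′) Y
    j+c = trans (drop-drop (toℕ j) (toℕ j′ ∸ toℕ j) Y) (cong (λ k → drop k Y) (m+[n∸m]≡n (<⇒≤ j<j′)))

    fixed : ∃[ i ] Fixed i (drop (toℕ j′) Y)
    fixed = subst (λ W → ∃[ i ] Fixed i W) j+c
      (absorb (toℕ j′ ∸ toℕ j) (drop (toℕ j) Y) (m<n⇒0<n∸m j<j′) (nonempty j)
        (S.trans (ψ⇒∼ same) (S.reflexive (cong flat (sym j+c)))))

    isGood : good (drop (toℕ j′) Z) ≢ nothing
    isGood with take-drop-++ (toℕ j′) span Z
    ... | R , e rewrite e = goodWindow-complete (drop (toℕ j′) Y ++ R)
      (subst (0 <_) (sym (length-++ (drop (toℕ j′) Y))) (≤-trans (nonempty j′) (m≤m+n _ (length R))))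
      (fixed-++ (proj₁ fixed) (drop (toℕ j′) Y) R (proj₂ fixed))

  firstStep : Maybe Idempotent → Maybe (ℕ × Idempotent) → Maybe (ℕ × Idempotent)
  firstStep (just i) _ = just (0 , i)
  firstStep nothing  r = Maybe.map (λ (j , i) → suc j , i) r

  first : ℕ → List Block → Maybe (ℕ × Idempotent)
  first zero    Z       = nothing
  first (suc k) []      = nothing
  first (suc k) (b ∷ Z) = firstStep (good (b ∷ Z)) (first k Z)

  -- The suffixes inspected start before place `k`, and goodness of each takes `span` blocks of
  -- look-ahead.
  first-local : ∀ k {Y Z} → take (k + span) Y ≡ take (k + span) Z → first k Y ≡ first k Z
  first-local zero    p = refl
  first-local (suc k) {[]}    {[]}    p = refl
  first-local (suc k) {[]}    {_ ∷ _} ()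
  first-local (suc k) {_ ∷ _} {[]}    ()
  first-local (suc k) {b ∷ Y} {c ∷ Z} p =
    cong₂ firstStep (cong goodWindow (take-≤ (m≤n+m span (suc k)) p)) (first-local k (cong (drop 1) p))

  first-nothing : ∀ k Z → first k Z ≡ nothing → ∀ {j} → j < k → good (drop j Z) ≡ nothing
  first-nothing (suc k) []      p {zero}  _         = refl
  first-nothing (suc k) []      p {suc j} _         = refl
  first-nothing (suc k) (b ∷ Z) p {j}     j<k with good (b ∷ Z) in eq
  first-nothing (suc k) (b ∷ Z) p {zero}  _         | nothing = eq
  first-nothing (suc k) (b ∷ Z) p {suc j} (s≤s j<k) | nothing with first k Z in eq′
  ... | nothing = first-nothing k Z eq′ j<k

  first-mono : ∀ k Z {r} → first k Z ≡ just r → first (suc k) Z ≡ just r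
  first-mono (suc k) (b ∷ Z) p with good (b ∷ Z)
  ... | just i  = p
  ... | nothing with first k Z in eq
  ...   | just r rewrite first-mono k Z eq = p

  first-short : ∀ k Z → length Z ≤ k → first (suc k) Z ≡ first k Z
  first-short zero    []      _ = refl
  first-short (suc k) []      _ = refl
  first-short (suc k) (b ∷ Z) (s≤s p) = cong (firstStep (good (b ∷ Z))) (first-short k Z p)

  first-< : ∀ k Z {j i} → first k Z ≡ just (j , i) → j < k
  first-< (suc k) (b ∷ Z) p with good (b ∷ Z)
  first-< (suc k) (b ∷ Z) refl | just i = s≤s z≤n
  first-< (suc k) (b ∷ Z) p    | nothing with first k Z in eq
  first-< (suc k) (b ∷ Z) refl | nothing | just _ = s≤s (first-< k Z eq)

  first-exists : ∀ Z → span ≤ length Z → first span Z ≢ nothing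
  first-exists Z span≤|Z| p = let j , j<span , isGood = good-nearby Z span≤|Z| in isGood
      (first-nothing span Z p j<span)

  lastStep : Maybe (Idempotent × List Block) → Maybe Idempotent → List Block → Maybe (Idempotent × List Block)
  lastStep (just r) _        Z = just r
  lastStep nothing  (just i) Z = just (i , Z)
  lastStep nothing  nothing  Z = nothing

  last : List Block → Maybe (Idempotent × List Block)
  last []      = nothing
  last (b ∷ Z) = lastStep (last Z) (good (b ∷ Z)) (b ∷ Z)

  last-++ : ∀ Y Z {r} → last Z ≡ just r → last (Y ++ Z) ≡ just r
  last-++ []      Z p = p
  last-++ (b ∷ Y) Z p rewrite last-++ Y Z p = refl

  module Values (N : Monoid 0ℓ 0ℓ) (division : karoubi ≺ᶜ oneObject N) where
    module N = Monoid N
    open _≺ᶜ_ division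

    -- A good place contributes an image of the arrow to the next good place, spelled by the blocks
    -- up to there. All other places contribute the unit, and so does the last good place, after
    -- which no arrow starts.
    edgeStep : Block → List Block → Maybe Idempotent → Maybe (ℕ × Idempotent) → N.Carrier
    edgeStep b Z nothing  _              = N.ε
    edgeStep b Z (just i) nothing        = N.ε
    edgeStep b Z (just i) (just (j , k)) = proj₁ (τ-total {i} {k} (product b (take j Z)))

    edge : List Block → N.Carrier
    edge []      = N.ε
    edge (b ∷ Z) = edgeStep b Z (good (b ∷ Z)) (first span Z)

    -- One block for the place itself; the next good place starts fewer than `span` blocks into the
    -- rest, and recognising it takes `span` blocks more.
    reach : ℕ
    reach = suc (span + span)

    edgeStep-local : ∀ b {Y Z} g f → first span Z ≡ f → take (span + span) Y ≡ take (span + span) Z →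
        edgeStep b Y g f ≡ edgeStep b Z g f
    edgeStep-local b nothing  _              _ _ = refl
    edgeStep-local b (just i) nothing        _ _ = refl
    edgeStep-local b {Y} {Z} (just i) (just (j , k)) e p = cong (λ W → proj₁ (τ-total {i} {k} (product b W)))
      (take-≤ (≤-trans (<⇒≤ (first-< span Z e)) (m≤m+n span span)) p)

    edge-local : ∀ Y Z → take reach Y ≡ take reach Z → edge Y ≡ edge Z
    edge-local []      []      p = refl
    edge-local []      (_ ∷ _) ()
    edge-local (_ ∷ _) []      ()
    edge-local (b ∷ Y) (c ∷ Z) p = trans
      (cong₂ (edgeStep b Y)
          (cong goodWindow (take-≤ {k = span} (≤-trans (m≤m+n span span) (n≤1+n (span + span))) p))
                            (first-local span (∷-injectiveʳ p)))
      (trans (edgeStep-local b (good (c ∷ Z)) (first span Z) refl (∷-injectiveʳ p))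
        (cong (λ b → edgeStep b Z (good (c ∷ Z)) (first span Z)) (∷-injectiveˡ p)))

    val : List Block → N.Carrier
    val []      = N.ε
    val (b ∷ Z) = edge (b ∷ Z) N.∙ val Z

    -- The invariant of the evaluation from right to left: `val Z` is an image of an arrow `a` from
    -- the first to the last good idempotent, and `Z` is, up to syntactic congruence, its blocks
    -- before the first good place, then `a` sandwiched, then its suffix at the last good place.
    data Summary (Z : List Block) : Set where
      none : first span Z ≡ nothing → last Z ≡ nothing → val Z N.≈ N.ε → Summary Z
      some : ∀ j i k Y (a : T.Carrier) → first span Z ≡ just (j , i) → last Z ≡ just (k , Y) →
          τ {i} {k} a (val Z) →
             flat Z ∼ (flat (take j Z) ++ proj₁ (sandwich i k a) ++ flat Y) → Summary Z

    edge≡ : ∀ b Z {g f} → good (b ∷ Z) ≡ g → first span Z ≡ f → edge (b ∷ Z) ≡ edgeStep b Z g f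
    edge≡ b Z p q = cong₂ (edgeStep b Z) p q

    first≡ : ∀ b Z {g f} → good (b ∷ Z) ≡ g → first index Z ≡ f → first span (b ∷ Z) ≡ firstStep g f
    first≡ b Z p q = cong₂ firstStep p q

    last≡ : ∀ b Z {l g} → last Z ≡ l → good (b ∷ Z) ≡ g → last (b ∷ Z) ≡ lastStep l g (b ∷ Z)
    last≡ b Z p q = cong₂ (λ l g → lastStep l g (b ∷ Z)) p q

    extend : ∀ b Z g → good (b ∷ Z) ≡ g → ∀ f → first index Z ≡ f → Summary Z → Summary (b ∷ Z)
    -- The only good place is both the first and the last: the arrow is an identity, which `τ-1`
    -- relates to the unit.
    extend b Z (just i) isGood _ _ (none firstZ lastZ val≈) =
      some 0 i i (b ∷ Z) ⟦ i ⟧ (first≡ b Z isGood refl) (last≡ b Z lastZ isGood)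
        (τ-resp {i} {i} {⟦ i ⟧} {⟦ i ⟧} (T.refl {sandwich i i ⟦ i ⟧})
          (N.sym (N.trans (N.∙-cong (N.reflexive (edge≡ b Z isGood firstZ)) val≈) (N.identityˡ N.ε))) (τ-1 i))
        (S.sym (S.trans (S.∙-congʳ {flat (b ∷ Z)} (sandwich-1 i)) (good-sound (b ∷ Z) isGood)))
    extend b Z (just i) isGood _ _ (some j′ i′ k Y a firstZ lastZ τa flatZ) =
      some 0 i k Y pa (first≡ b Z isGood refl) (last≡ b Z lastZ isGood)
        τ″ flat∼
      where
      p pa : T.Carrier
      p = product b (take j′ Z)
      pa = C._∙_ {i} {i′} {k} p a

      τ′ : τ {i} {k} pa (proj₁ (τ-total {i} {i′} p) N.∙ val Z)
      τ′ = τ-∙ {i} {i′} {k} {p} {a} (proj₂ (τ-total {i} {i′} p)) τa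
      τ″ : τ {i} {k} pa (val (b ∷ Z))
      τ″ = subst (λ z → τ {i} {k} pa (z N.∙ val Z)) (sym (edge≡ b Z isGood firstZ)) τ′
      flat∼ : flat (b ∷ Z) ∼ (proj₁ (sandwich i k pa) ++ flat Y)
      -- At a good place `⟪ i ⟫` may be inserted in front; together with the `⟪ i′ ⟫` already
      -- present at the next good place it turns the blocks between into an arrow composed with `a`.
      flat∼ = begin
        flat (b ∷ Z)                                                        ≈⟨ good-sound (b ∷ Z) isGood ⟨
        ⟪ i ⟫ ++ toList b ++ flat Z
            ≈⟨ S.∙-congˡ {⟪ i ⟫} (S.∙-congˡ {toList b} flatZ) ⟩
        ⟪ i ⟫ ++ toList b ++ flat (take j′ Z) ++ proj₁ (sandwich i′ k a) ++ flat Y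
          ≡⟨ cong (⟪ i ⟫ ++_) (trans
              (sym (++-assoc (toList b) (flat (take j′ Z)) (proj₁ (sandwich i′ k a) ++ flat Y)))
               (cong (_++ proj₁ (sandwich i′ k a) ++ flat Y) (sym (product-flat b (take j′ Z))))) ⟩
        ⟪ i ⟫ ++ proj₁ p ++ proj₁ (sandwich i′ k a) ++ flat Y
            ≡⟨ regroup ⟪ i ⟫ (proj₁ p) ⟪ i′ ⟫ (proj₁ a) ⟪ k ⟫ (flat Y) ⟩
        proj₁ (sandwich i k pa) ++ flat Y                                   ∎
        where open import Relation.Binary.Reasoning.Setoid S.setoid
    extend b Z nothing isBad (just r) firstZ (none first≡nothing _ _) =
      ⊥-elim (just≢nothing (trans (sym (first-mono index Z firstZ)) first≡nothing))
    extend b Z nothing isBad (just r) firstZ (some j i k Y a firstZ′ lastZ τa flatZ) =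
      some (suc j) i k Y a
          (first≡ b Z isBad (trans firstZ (trans (sym (first-mono index Z firstZ)) firstZ′)))
          (last≡ b Z lastZ isBad)
        (τ-resp {i} {k} {a} {a} (T.refl {sandwich i k a})
          (N.sym (N.trans (N.∙-congʳ (N.reflexive (edge≡ b Z isBad refl))) (N.identityˡ (val Z)))) τa)
        (S.trans (S.∙-congˡ {toList b} flatZ) (S.reflexive (sym (++-assoc (toList b) (flat (take j Z)) _))))
    extend b Z nothing isBad nothing firstZ (none _ lastZ val≈) =
      none (first≡ b Z isBad firstZ) (last≡ b Z lastZ isBad)
        (N.trans (N.∙-cong (N.reflexive (edge≡ b Z isBad refl)) val≈) (N.identityˡ N.ε))
    -- Only the larger bound finds a good place in `Z`. By `first-short` this forces `Z` to have at
    -- least `index` blocks, so `b ∷ Z` has at least `span`, and `first-exists` contradicts that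
    -- none is found there.
    extend b Z nothing isBad nothing firstZ (some _ _ _ _ _ firstZ′ _ _ _) =
      ⊥-elim (first-exists (b ∷ Z) (≮⇒≥ short) (first≡ b Z isBad firstZ))
      where
      short : ¬ suc (length Z) < span
      short p = just≢nothing (trans (sym firstZ′) (trans (first-short index Z (<⇒≤ (≤-pred p))) firstZ))

    summary : ∀ Z → Summary Z
    summary []      = none refl refl N.refl
    summary (b ∷ Z) = extend b Z (good (b ∷ Z)) refl (first index Z) refl (summary Z)

-- From local monoids in the variety to capture

module _ {v} {V : Pred (Monoid 0ℓ 0ℓ) v} (isVariety : IsVariety V) (isLocal : IsLocal V)
         {n} (L : Language n) (fin : FiniteIndex L) (d : ℕ) (stable : IsStable (syntacticMonoid L) id
             (suc d)) where

  open StableSemigroup L fin (suc d) (s≤s z≤n) stable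
  open RegularLanguage fin
  open Karoubi T (λ x y → proj₁ x ∼? proj₁ y) element element-onto
  open Delay L fin d stable

  local⇒captured : LocalMonoidsIn T V → Captured V L d
  local⇒captured local = record
    { K = K
    ; J = record { target = N ; in-V = proj₁ (proj₂ divides) ; hom = hom
                 ; isHom = mkHom (++-monoid (Fin (Mark {n} d K))) N (λ { refl → N.refl }) hom-++ N.refl }
    ; captures = λ u v same≡ same≈ Lu → subst L (++-identityʳ v)
          (to (captures u v same≡ same≈ [] []) (subst L (sym (++-identityʳ u)) Lu))
    }
    where
    divides : DividesMonoidOf V karoubi
    divides = local⇒divides isVariety isLocal local

    N : Monoid 0ℓ 0ℓ
    N = proj₁ divides

    open Values N (proj₂ (proj₂ divides))
    open _≺ᶜ_ (proj₂ (proj₂ divides))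

    s K : ℕ
    s = suc d
    K = reach * s

    -- Residue zero marks the beginning of a block; the window there shows the `reach` blocks on
    -- which `edge` depends. Positions inside a block count as the unit.
    weight : Fin s → Fin (size n K) → N.Carrier
    weight zero    c = edge (chunk s reach (unwindow K c))
    weight (suc _) c = N.ε

    letterValue : Fin (Mark {n} d K) → N.Carrier
    letterValue b = let r , c = remQuot {s} (size n K) b in weight r c

    hom : Word (Mark {n} d K) → N.Carrier
    hom []      = N.ε
    hom (b ∷ w) = letterValue b N.∙ hom w

    hom-++ : ∀ w w′ → hom (w ++ w′) N.≈ hom w N.∙ hom w′
    hom-++ []      w′ = N.sym (N.identityˡ (hom w′))
    hom-++ (b ∷ w) w′ = N.trans (N.∙-congˡ (hom-++ w w′)) (N.sym (N.assoc (letterValue b) (hom w) (hom w′)))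

    letterValue≡ : ∀ r u → letterValue (combine r (window K u)) ≡ weight r (window K u)
    letterValue≡ r u = cong (λ (r , c) → weight r c) (remQuot-combine r (window K u))

    weight-positive : ∀ i c → 0 < toℕ i → weight i c ≡ N.ε
    weight-positive (suc _) c _ = refl

    weight-inner : ∀ r c → 0 < r → r < s → weight (r mod s) c ≡ N.ε
    weight-inner r c 0<r r<s = weight-positive (r mod s) c
      (subst (0 <_) (sym (trans (toℕ-fromℕ< (m%n<n r s)) (m<n⇒m%n≡m r<s))) 0<r)

    inner : ∀ r w z → 0 < r → r + length w ≤ s → hom (enc d K r w z) N.≈ N.ε
    inner r []      z 0<r p = N.refl
    inner r (x ∷ w) z 0<r p = N.trans
      (N.∙-cong (N.reflexive (trans (letterValue≡ (r mod s) (x ∷ w ++ z))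
          (weight-inner r _ 0<r (≤-trans (s≤s (m≤m+n r (length w))) (subst (_≤ s) (+-suc r (length w)) p)))))
                (inner (suc r) w z (s≤s z≤n) (subst (_≤ s) (+-suc r (length w)) p)))
      (N.identityˡ N.ε)

    letterValue-0 : ∀ u → letterValue (combine (0 mod s) (window K u)) ≡ edge (chunk s reach (take K u))
    letterValue-0 u = trans (letterValue≡ zero u) (cong (λ w → edge (chunk s reach w)) (unwindow-window K u))

    hom-val : ∀ X r → length r < s → hom (enc d K 0 (flat X ++ r) []) N.≈ val X
    hom-val []      []      _     = N.refl
    -- The remainder also starts at residue zero, but its window contains no complete block, and
    -- `edge []` is the unit.
    hom-val []      (x ∷ r) |r|<s = N.trans
      (N.∙-cong (N.reflexive (trans (letterValue-0 (x ∷ r ++ [])) (cong edge short)))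
          (inner 1 r [] (s≤s z≤n) (<⇒≤ |r|<s)))
      (N.identityˡ N.ε)
      where
      short : chunk s reach (take K (x ∷ r ++ [])) ≡ []
      short = trans (cong (λ w → chunk s reach (take K (x ∷ w))) (++-identityʳ r))
          (chunk-flat reach [] (x ∷ r) |r|<s)
    hom-val (b@(x ∷ b′) ∷ X) r |r|<s = N.trans (N.reflexive (cong hom eq))
        (N.trans (hom-++ (enc d K 0 (toList b) rest) (enc d K 0 (flat X ++ r) []))
      (N.∙-cong (N.trans (N.∙-cong (N.reflexive front)
          (inner 1 (toList b′) rest (s≤s z≤n) (≤-reflexive (cong suc (length-toList b′))))) (N.identityʳ _))
                (hom-val X r |r|<s)))
      where
      rest : Word n
      rest = (flat X ++ r) ++ []

      eq : enc d K 0 ((toList b ++ flat X) ++ r) [] ≡ enc d K 0 (toList b) rest ++ enc d K 0 (flat X ++ r) []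
      eq = trans (cong (λ w → enc d K 0 w []) (++-assoc (toList b) (flat X) r))
          (trans (enc-++ d K 0 (toList b) (flat X ++ r) [])
        (cong (enc d K 0 (toList b) rest ++_) (enc-residue d K (flat X ++ r) []
          (trans (cong (_mod s) (length-toList b)) (mod-% s 0 (n%n≡0 s))))))

      front : letterValue (combine (0 mod s) (window K (x ∷ toList b′ ++ rest))) ≡ edge (b ∷ X)
      front = trans (letterValue-0 (x ∷ toList b′ ++ rest))
          (trans (cong edge chunk≡) (edge-local (take reach (b ∷ X)) (b ∷ X)
        (trans (take-take reach reach (b ∷ X)) (cong (λ m → take m (b ∷ X)) (⊓-idem reach)))))
        where
        chunk≡ : chunk s reach (take K (x ∷ toList b′ ++ rest)) ≡ take reach (b ∷ X)
        chunk≡ = trans (cong (λ w → chunk s reach (take K w))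
            (trans (cong (toList b ++_) (++-identityʳ (flat X ++ r))) (sym (++-assoc (toList b) (flat X) r))))
                       (chunk-flat reach (b ∷ X) r |r|<s)

    -- `τ-disjoint` only separates distinct arrows; as equality of arrows is decidable, this yields
    -- equality of arrows with a common image.
    arrow-unique : ∀ i k a a′ {z z′} → τ {i} {k} a z → τ {i} {k} a′ z′ → z N.≈ z′ →
        sandwich i k a T.≈ sandwich i k a′
    arrow-unique i k a a′ {z} {z′} τa τa′ z≈z′ = decidable-stable (arrow? i k a a′) (λ a≉a′ →
      τ-disjoint {i} {k} {a} {a′} a≉a′ z′ (τ-resp {i} {k} {a} {a} (T.refl {sandwich i k a}) z≈z′ τa , τa′))

    record LastBlocks (X : List (Vec (Fin n) s)) : Set where
      field
        init final : List (Vec (Fin n) s)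
        X≡         : X ≡ init ++ final
        |final|    : length final ≡ span

    lastBlocks : ∀ X → span ≤ length X → LastBlocks X
    lastBlocks X span≤|X| = record
      { init = take (length X ∸ span) X ; final = drop (length X ∸ span) X ; X≡ =
            sym (take++drop≡id (length X ∸ span) X)
      ; |final| = trans (length-drop (length X ∸ span) X) (m∸[m∸n]≡n span≤|X|) }

    -- The prefix shows the first good place and the blocks before it, the suffix shows the last
    -- good place, and the value determines the arrow between them. The remainders have equal length
    -- by the residue and are read from the suffix.
    captures-long : ∀ X r Y t → length r < s → length t < s → reach ≤ length X → reach ≤ length Y →
                    info d K (flat X ++ r) ≡ info d K (flat Y ++ t) → val X N.≈ val Y →
                        (flat X ++ r) ∼ (flat Y ++ t)
    captures-long X r Y t |r|<s |t|<s reach≤|X| reach≤|Y| same val≈ =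
      subst (λ w → (flat X ++ r) ∼ (flat Y ++ w)) r≡t (S.∙-congʳ {r} (conclude (summary X) (summary Y)))
      where
      span≤reach : span ≤ reach
      span≤reach = ≤-trans (m≤m+n span span) (n≤1+n (span + span))

      open LastBlocks (lastBlocks X (≤-trans span≤reach reach≤|X|)) renaming
          (init to X₁; final to X₂; |final| to |X₂|)
      open LastBlocks (lastBlocks Y (≤-trans span≤reach reach≤|Y|)) renaming
          (init to Y₁; final to Y₂; |final| to |Y₂|; X≡ to Y≡)

      heads : take reach X ≡ take reach Y
      heads = trans (sym (chunk-flat reach X r |r|<s)) (trans (cong (chunk s reach)
        (trans (sym (prefixOf-info d K (flat X ++ r)))
            (trans (cong (prefixOf d K) same) (prefixOf-info d K (flat Y ++ t)))))
        (chunk-flat reach Y t |t|<s))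

      residue : ∀ Z (w : Word n) → length w < s → toℕ (length (flat {n} {s} Z ++ w) mod s) ≡ length w
      residue Z w |w|<s = trans (toℕ-fromℕ< (m%n<n (length (flat Z ++ w)) s)) (trans (cong (_% s)
        (trans (length-++ (flat Z)) (trans (cong (_+ length w) (length-flat Z))
            (+-comm (length Z * s) (length w)))))
        (trans ([m+kn]%n≡m%n (length w) (length Z) s) (m<n⇒m%n≡m |w|<s)))

      |r|≡|t| : length r ≡ length t
      |r|≡|t| = trans (sym (residue X r |r|<s)) (trans (cong toℕ
        (trans (sym (residueOf-info d K (flat X ++ r)))
            (trans (cong (residueOf {n} d K) same) (residueOf-info d K (flat Y ++ t)))))
        (residue Y t |t|<s))

      split-flat : ∀ {Z Z₁ Z₂} (w : Word n) → Z ≡ Z₁ ++ Z₂ → flat {n} {s} Z ++ w ≡ flat Z₁ ++ flat Z₂ ++ w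
      split-flat {Z₁ = Z₁} {Z₂} w refl = trans (cong (_++ w) (flat-++ Z₁ Z₂)) (++-assoc (flat Z₁) (flat Z₂) w)

      length-tail : ∀ Z (w : Word n) → length Z ≡ span → length (flat {n} {s} Z ++ w) ≡ span * s + length w
      length-tail Z w e = trans (length-++ (flat Z))
          (cong (_+ length w) (trans (length-flat Z) (cong (_* s) e)))

      short-tail : length (flat X₂ ++ r) ≤ K
      short-tail = begin
        length (flat X₂ ++ r)  ≡⟨ length-tail X₂ r |X₂| ⟩
        span * s + length r    ≤⟨ +-monoʳ-≤ (span * s) (<⇒≤ |r|<s) ⟩
        span * s + s           ≡⟨ +-comm (span * s) s ⟩
        suc span * s           ≤⟨ *-monoˡ-≤ s (s≤s (m≤m+n span span)) ⟩
        K                      ∎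
        where open ≤-Reasoning

      tails : flat X₂ ++ r ≡ flat Y₂ ++ t
      tails = suffix-unique K (flat X₁) (flat X₂ ++ r) (flat Y₁) (flat Y₂ ++ t)
        (trans (length-tail X₂ r |X₂|)
            (trans (cong (span * s +_) |r|≡|t|) (sym (length-tail Y₂ t |Y₂|)))) short-tail
        (subst₂ (λ x y → take K (reverse x) ≡ take K (reverse y)) (split-flat {X} {X₁} {X₂} r X≡)
            (split-flat {Y} {Y₁} {Y₂} t Y≡)
          (trans (sym (suffixOf-info d K (flat X ++ r)))
              (trans (cong (suffixOf d K) same) (suffixOf-info d K (flat Y ++ t)))))

      X₂≡Y₂ : X₂ ≡ Y₂
      X₂≡Y₂ = trans (sym (chunk-all (suc span) X₂ r |r|<s (s≤s (≤-reflexive |X₂|))))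
        (trans (cong (chunk s (suc span)) tails) (chunk-all (suc span) Y₂ t |t|<s (s≤s (≤-reflexive |Y₂|))))

      r≡t : r ≡ t
      r≡t = ++-cancelˡ (flat X₂) r t (trans tails (cong (λ Z → flat Z ++ t) (sym X₂≡Y₂)))

      -- A tail of `span` blocks contains a good place, so the last good place of the whole sequence
      -- is found within the known suffix.
      has-last : Summary X₂ → ∃[ p ] last X₂ ≡ just p
      has-last (none firstNothing _ _)    = ⊥-elim (first-exists X₂ (≤-reflexive (sym |X₂|)) firstNothing)
      has-last (some _ _ k Z _ _ sameLast _ _) = (k , Z) , sameLast

      last-exists : ∃[ p ] last X₂ ≡ just p
      last-exists = has-last (summary X₂)

      sameLast : last X ≡ last Y
      sameLast = trans (trans (cong last X≡) (last-++ X₁ X₂ (proj₂ last-exists)))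
        (sym (trans (cong last Y≡)
            (last-++ Y₁ Y₂ (subst (λ Z → last Z ≡ just (proj₁ last-exists)) X₂≡Y₂ (proj₂ last-exists)))))

      sameFirst : first span X ≡ first span Y
      sameFirst = first-local span (take-≤ (n≤1+n (span + span)) heads)

      agree : ∀ {j i k Z a j′ i′ k′ Z′ a′} → (j , i) ≡ (j′ , i′) → (k , Z) ≡ (k′ , Z′) → j ≤ reach →
              τ {i} {k} a (val X) → τ {i′} {k′} a′ (val Y) →
              flat X ∼ (flat (take j X) ++ proj₁ (sandwich i k a) ++ flat Z) →
              flat Y ∼ (flat (take j′ Y) ++ proj₁ (sandwich i′ k′ a′) ++ flat Z′) → flat X ∼ flat Y
      agree {j} {i} {k} {Z} {a} {a′ = a′} refl refl j≤reach τa τa′ flatX flatY =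
        S.trans flatX (S.trans (S.∙-cong {flat (take j X)} (S.reflexive (cong flat (take-≤ j≤reach heads)))
          (S.∙-congʳ {flat Z} (arrow-unique i k a a′ τa τa′ val≈))) (S.sym flatY))

      conclude : Summary X → Summary Y → flat X ∼ flat Y
      conclude (none p _ _) _ = ⊥-elim (first-exists X (≤-trans span≤reach reach≤|X|) p)
      conclude _ (none p _ _) = ⊥-elim (first-exists Y (≤-trans span≤reach reach≤|Y|) p)
      conclude (some j i k Z a p q τa flatX) (some j′ i′ k′ Z′ a′ p′ q′ τa′ flatY) =
        agree (just-injective (trans (sym p) (trans sameFirst p′)))
            (just-injective (trans (sym q) (trans sameLast q′)))
          (<⇒≤ (≤-trans (first-< span X p) span≤reach)) τa τa′ flatX flatY

    many : ∀ X (r : Word n) → length r < s → K ≤ length (flat {n} {s} X ++ r) → reach ≤ length X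
    many X r |r|<s p = ≤-pred (*-cancelʳ-< s reach (suc (length X)) (begin-strict
      K                          ≤⟨ p ⟩
      length (flat X ++ r)       ≡⟨ trans (length-++ (flat X)) (cong (_+ length r) (length-flat X)) ⟩
      length X * s + length r    <⟨ +-monoʳ-< (length X * s) |r|<s ⟩
      length X * s + s           ≡⟨ +-comm (length X * s) s ⟩
      suc (length X) * s         ∎))
      where open ≤-Reasoning

    unequal : ∀ {u v : Word n} → K ≤ length u → ¬ K ≤ length v → take K u ≢ take K v
    unequal {u} {v} K≤|u| K≰|v| same = K≰|v| (begin
      K                     ≡⟨ trans (length-take K u) (m≤n⇒m⊓n≡m K≤|u|) ⟨
      length (take K u)     ≡⟨ trans (cong length same) (length-take K v) ⟩
      K ⊓ length v          ≤⟨ m⊓n≤n K (length v) ⟩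
      length v              ∎)
      where open ≤-Reasoning

    captures : ∀ u v → info d K u ≡ info d K v → hom (enc d K 0 u []) N.≈ hom (enc d K 0 v []) → u ∼ v
    captures u v same≡ same≈ = cases (K ≤? length u) (K ≤? length v) (decompose d u) (decompose d v)
      where
      same : take K u ≡ take K v
      same = trans (sym (prefixOf-info d K u)) (trans (cong (prefixOf d K) same≡) (prefixOf-info d K v))

      long : K ≤ length u → K ≤ length v → ∀ X r Y t → u ≡ flat X ++ r → v ≡ flat Y ++ t →
          length r < s → length t < s → u ∼ v
      long K≤|u| K≤|v| X r Y t refl refl |r|<s |t|<s =
        captures-long X r Y t |r|<s |t|<s (many X r |r|<s K≤|u|) (many Y t |t|<s K≤|v|) same≡
          (N.trans (N.sym (hom-val X r |r|<s)) (N.trans same≈ (hom-val Y t |t|<s)))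

      cases : Dec (K ≤ length u) → Dec (K ≤ length v) → Blocks s u → Blocks s v → u ∼ v
      -- A word shorter than `K` is its own prefix of length `K`, so here the two words are equal.
      cases (no K≰|u|)  (no K≰|v|)  _ _ =
          S.reflexive (trans (sym (take-all K u (<⇒≤ (≰⇒> K≰|u|))))
          (trans same (take-all K v (<⇒≤ (≰⇒> K≰|v|)))))
      cases (yes K≤|u|) (no K≰|v|)  _ _ = ⊥-elim (unequal {u} {v} K≤|u| K≰|v| same)
      cases (no K≰|u|)  (yes K≤|v|) _ _ = ⊥-elim (unequal {v} {u} K≤|v| K≰|u| (sym same))
      cases (yes K≤|u|) (yes K≤|v|) (blocks X r u≡ |r|<s) (blocks Y t v≡ |t|<s) = long K≤|u| K≤|v| X r Y
          t u≡ v≡ |r|<s |t|<s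

-- From one modulus to all moduli

module _ (σ : Signature) (d : ℕ) where

  generalise : Interpretation (numerical σ ∪ᴾ (LOC ∪ᴾ MOD^ (suc d))) (LocMod σ)
  generalise = record
    { letterᴵ = letterQF
    ; predᴵ   = λ { (inj₁ R) → predQF (inj₁ R) ; (inj₂ (inj₁ R)) → predQF (inj₂ (inj₁ R)) ;
          (inj₂ (inj₂ R)) → predQF (inj₂ (inj₂ (d , R))) }
    }

  generalise-faithful : ∀ {n} (u : Word n) → Faithful u u refl generalise (λ _ → ⊤)
  generalise-faithful u ρ ρ′ θ θ′ s =
    (λ a x → subst (λ y → toℕ (List.lookup u (lookup ρ x)) ≡ a ⇔ toℕ (List.lookup u y) ≡ a)
        (sym (same x)) (mk⇔ id id)) ,
    λ { (inj₁ R) xs _ → along (Predicates.Holds (numerical σ) R u) xs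
      ; (inj₂ (inj₁ R)) xs _ → along (Predicates.Holds LOC R u) xs
      ; (inj₂ (inj₂ R)) xs _ → along (Predicates.Holds (MOD^ (suc d)) R u) xs }
    where
    same : ∀ i → lookup ρ′ i ≡ lookup ρ i
    same i = Fin.toℕ-injective (s i)

    along : ∀ {k} (H : Vec (Position u) k → Set) xs → H (Vec.map (lookup ρ) xs) ⇔ H (Vec.map (lookup ρ′) xs)
    along H xs = subst (λ ys → H (Vec.map (lookup ρ) xs) ⇔ H ys) (map-cong (λ i → sym (same i)) xs)
        (mk⇔ id id)

  generalise-enrich : ∀ {f} {F : Pred (Closed (numerical σ)) f} → IsFragment σ F → ∀ {φ} →
                      Enrich F (LOC ∪ᴾ MOD^ (suc d)) φ → Enrich F (LOC ∪ᴾ MOD) (sub generalise φ)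
  generalise-enrich {F = F} isFragment (base {φ} φ∈) =
    subst (Enrich F (LOC ∪ᴾ MOD)) (sym (sub-embed generalise φ))
        (enrich-sub isFragment (generalise ∘embed) φ∈)
  generalise-enrich isFragment (step r φ∈) = step (sub-⟿ generalise r) (generalise-enrich isFragment φ∈)

  generalise-definable : ∀ {f} {F : Pred (Closed (numerical σ)) f} → IsFragment σ F → ∀ {n} {L : Language n} →
                         Definable (Enrich F (LOC ∪ᴾ MOD^ (suc d))) L → Definable (Enrich F (LOC ∪ᴾ MOD)) L
  generalise-definable isFragment (φ , φ∈ , L⇔φ) = sub generalise φ , generalise-enrich isFragment φ∈ , λ u →
    let e = sub-⊨ u u refl generalise (λ _ → ⊤) (generalise-faithful u) φ (over-all (λ _ → tt) φ)
    in mk⇔ (λ Lu → to e (to (L⇔φ u) Lu)) (λ s → from (L⇔φ u) (from e s))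

-- Deciding membership in the variety

module _ {f v} (σ : Signature) (F : Pred (Closed (numerical σ)) f) (V : Pred (Monoid 0ℓ 0ℓ) v)
         (isVariety : IsVariety V) (corresponds : Corresponds F V) where

  -- M divides a product of monoids recognizing the inverse images of its
  -- elements under the evaluation of words over M.
  V-decidable : DecidableFragment F → ∀ M → IsFinite (Monoid.setoid M) → Dec (V M)
  V-decidable F? M finite@(k , inv) =
    map′ (λ definable → IsVariety.≺-closed isVariety finite (divides definable)
        (HomInto.in-V (proj₁ (joint definable))))
         (λ M∈V i → from (corresponds (Fiber i)) (M , M∈V , recognized i))
         (Fin.all? (λ i → F? (Fiber i) (M , finite , recognized i)))
    where
    module M = Monoid M
    module I = Inverse inv

    eval : Word k → M.Carrier
    eval []      = M.ε
    eval (i ∷ w) = I.from i M.∙ eval w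

    eval-++ : ∀ w w′ → eval (w ++ w′) M.≈ eval w M.∙ eval w′
    eval-++ []      w′ = M.sym (M.identityˡ (eval w′))
    eval-++ (i ∷ w) w′ = M.trans (M.∙-congˡ (eval-++ w w′)) (M.sym (M.assoc (I.from i) (eval w) (eval w′)))

    eval-hom : IsHom (++-monoid (Fin k)) M eval
    eval-hom = mkHom (++-monoid (Fin k)) M (λ { refl → M.refl }) eval-++ M.refl

    Fiber : Fin k → Language k
    Fiber i w = I.to (eval w) ≡ i

    recognized : ∀ i → M Recognizes Fiber i
    recognized i = record
      { φ = eval ; φ-morphism = eval-hom ; Accept = λ m → I.to m ≡ i
      ; Accept-resp = λ x≈y p → trans (sym (I.to-cong x≈y)) p
      ; Accept? = λ m → I.to m Fin.≟ i ; recognizes = λ _ → mk⇔ id id }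

    module _ (definable : ∀ i → Definable F (Fiber i)) where

      recognizer : ∀ i → ∃[ N ] (V N × N Recognizes Fiber i)
      recognizer i = to (corresponds (Fiber i)) (definable i)

      joint = jointHom isVariety {++-monoid (Fin k)} (λ i → let N , N∈V , rec = recognizer i in record
        { target = N ; in-V = N∈V ; hom = _Recognizes_.φ rec ; isHom = _Recognizes_.φ-morphism rec })

      -- It is enough to look at the monoid chosen for the fiber that contains `w`: equal images
      -- there put `w′` in the same fiber.
      kernel : ∀ {w w′} → HomInto.Kernel (proj₁ joint) w w′ → eval w M.≈ eval w′
      kernel {w} {w′} ker = M.trans (M.sym (I.strictlyInverseʳ (eval w)))
          (M.trans (I.from-cong (sym same)) (I.strictlyInverseʳ (eval w′)))
        where
        open _Recognizes_ (proj₂ (proj₂ (recognizer (I.to (eval w)))))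
        same : I.to (eval w′) ≡ I.to (eval w)
        same = from (recognizes w′) (Accept-resp (proj₂ joint ker (I.to (eval w))) (to (recognizes w) refl))

      divides : M ≺ HomInto.target (proj₁ joint)
      divides = ≺-intro (++-monoid (Fin k)) eval (HomInto.hom (proj₁ joint)) eval-hom
          (HomInto.isHom (proj₁ joint))
        (λ m → I.to m ∷ [] , M.trans (M.identityʳ _) (I.strictlyInverseʳ m)) (λ {w} {w′} → kernel {w} {w′})

-- Deciding whether the local monoids are in the variety

module _ {v} {V : Pred (Monoid 0ℓ 0ℓ) v} (isVariety : IsVariety V)
    (V? : ∀ M → IsFinite (Monoid.setoid M) → Dec (V M))
         {n} (L : Language n) (fin : FiniteIndex L) (s : ℕ) (0<s : 0 < s)
             (stable : IsStable (syntacticMonoid L) id s) where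

  open StableSemigroup L fin s 0<s stable
  open RegularLanguage fin

  private
    -- Equal elements of `T` may be given by different words and yield formally different local
    -- monoids. Carrying membership in `V` between them reduces all idempotents to the enumerated
    -- ones.
    local-resp : ∀ {e e′} (p : e T.∙ e T.≈ e) (p′ : e′ T.∙ e′ T.≈ e′) → e T.≈ e′ →
        V (localMonoid T e p) → V (localMonoid T e′ p′)
    local-resp {e} {e′} p p′ e≈e′ = IsVariety.≺-closed isVariety (LocalMonoid.localMonoid-finite e′ p′)
      (≺-intro X id h (mkHom X X id (λ x y → Monoid.refl X {Monoid._∙_ X x y}) (Monoid.refl X {Monoid.ε X}))
        (mkHom X Y id (λ x y → Monoid.refl X {Monoid._∙_ X x y}) (T.sym {e} {e′} e≈e′))
            (λ x → x , Monoid.refl X {x}) id)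
      where
      X Y : Monoid 0ℓ 0ℓ
      X = localMonoid T e′ p′
      Y = localMonoid T e p
      h : Monoid.Carrier X → Monoid.Carrier Y
      h (x , t , x≈) = x , t , T.trans {x} {e′ T.∙ t T.∙ e′} {e T.∙ t T.∙ e} x≈
        (S.∙-cong {proj₁ e′ ++ proj₁ t} {proj₁ e ++ proj₁ t}
            (S.∙-congʳ {proj₁ t} (S.sym {proj₁ e} {proj₁ e′} e≈e′)) (S.sym {proj₁ e} {proj₁ e′} e≈e′))

    LocalAt : Fin (length (words {n} s)) → Set v
    LocalAt i = (p : element i T.∙ element i T.≈ element i) → V (localMonoid T (element i) p)

    localAt? : ∀ i → Dec (element i T.∙ element i T.≈ element i) → Dec (LocalAt i)
    localAt? i (no ¬p) = yes (λ p → ⊥-elim (¬p p))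
    localAt? i (yes p) = map′ (λ V∋ p′ → local-resp p p′ (T.refl {element i}) V∋) (λ h → h p)
      (V? (localMonoid T (element i) p) (LocalMonoid.localMonoid-finite (element i) p))

  localMonoidsIn? : Dec (LocalMonoidsIn T V)
  localMonoidsIn? = map′ everywhere (λ local i p → local (element i) p)
    (Fin.all? (λ i → localAt? i (proj₁ (element i T.∙ element i) ∼? proj₁ (element i))))
    where
    everywhere : (∀ i → LocalAt i) → LocalMonoidsIn T V
    everywhere h e p = local-resp {element (proj₁ onto)} p′ p (proj₂ onto) (h (proj₁ onto) p′)
      where
      onto = element-onto e
      t = element (proj₁ onto)
      p′ : t T.∙ t T.≈ t
      p′ = S.trans (S.∙-cong {proj₁ t} (proj₂ onto) (proj₂ onto)) (S.trans p (S.sym (proj₂ onto)))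

-- Definability with all moduli implies the condition on local monoids, which implies definability
-- with modulus `s`; this is a case of the former after renaming predicates. For decidability, `V`
-- inherits a decision procedure from `F`, and the condition is tested on the finitely many
-- idempotents of the stable semigroup.
theorem7 : ∀ {f v} (σ : Signature) (F : Pred (Closed (numerical σ)) f) (V : Pred (Monoid 0ℓ 0ℓ) v) →
    IsFragment σ F → IsVariety V → IsLocal V → Corresponds F V →
    (∀ {n} (L : Language n) → Regular L → ∀ s (isIndex : StabilityIndexOf L s) →
    (Definable (Enrich F (LOC ∪ᴾ MOD)) L ⇔ Definable (Enrich F (LOC ∪ᴾ MOD^ s)) L) ×
    (Definable (Enrich F (LOC ∪ᴾ MOD^ s)) L ⇔ LocalMonoidsIn (stableSemigroupOf L isIndex) V)) ×
    (DecidableFragment F → DecidableFragment (Enrich F (LOC ∪ᴾ MOD)))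
theorem7 {f} {v} σ F V isFragment isVariety isLocal corresponds = characterisation , decidability
  where
  definable⇒local : ∀ {n} (L : Language n) (fin : FiniteIndex L) s (0<s : 0 < s)
      (stable : IsStable (syntacticMonoid L) id s) →
                    Definable (Enrich F (LOC ∪ᴾ MOD)) L →
                        LocalMonoidsIn (StableSemigroup.T L fin s 0<s stable) V
  definable⇒local L fin s 0<s stable definable =
    let d , captured = definable⇒captured σ F V isFragment isVariety corresponds L definable
    in StableSemigroup.captured⇒local L fin s 0<s stable isVariety d captured

  local⇒definable : ∀ {n} (L : Language n) (fin : FiniteIndex L) d
      (stable : IsStable (syntacticMonoid L) id (suc d)) →
                    LocalMonoidsIn (StableSemigroup.T L fin (suc d) (s≤s z≤n) stable) V →
                        Definable (Enrich F (LOC ∪ᴾ MOD^ (suc d))) L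
  local⇒definable L fin d stable local =
    captured⇒definable σ F V isFragment isVariety corresponds L fin d
        (local⇒captured isVariety isLocal L fin d stable local)

  characterisation : ∀ {n} (L : Language n) → Regular L → ∀ s (isIndex : StabilityIndexOf L s) →
    (Definable (Enrich F (LOC ∪ᴾ MOD)) L ⇔ Definable (Enrich F (LOC ∪ᴾ MOD^ s)) L) ×
    (Definable (Enrich F (LOC ∪ᴾ MOD^ s)) L ⇔ LocalMonoidsIn (stableSemigroupOf L isIndex) V)
  characterisation L regular zero    isIndex = ⊥-elim (case (IsStabilityIndex.positive isIndex))
    where
    case : ¬ 0 < 0
    case ()
  characterisation L regular (suc d) isIndex =
    mk⇔ (λ definable → local⇒definable L fin d stable (definable⇒local L fin (suc d) (s≤s z≤n) stable
        definable)) one⇒all ,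
    mk⇔ (λ definable → definable⇒local L fin (suc d) (s≤s z≤n) stable (one⇒all definable))
        (local⇒definable L fin d stable)
    where
    fin = regular⇒finiteIndex regular
    stable = IsStabilityIndex.stable isIndex

    one⇒all : Definable (Enrich F (LOC ∪ᴾ MOD^ (suc d))) L → Definable (Enrich F (LOC ∪ᴾ MOD)) L
    one⇒all = generalise-definable σ d isFragment

  decidability : DecidableFragment F → DecidableFragment (Enrich F (LOC ∪ᴾ MOD))
  decidability F? L regular = decide (RegularLanguage.stableIndex fin)
    where
    fin = regular⇒finiteIndex regular

    decide : ∃[ s ] (0 < s × IsStable (syntacticMonoid L) id s) → Dec (Definable (Enrich F (LOC ∪ᴾ MOD)) L)
    decide (suc d , 0<s , stable) = map′
      (λ local → generalise-definable σ d isFragment (local⇒definable L fin d stable local))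
      (definable⇒local L fin (suc d) 0<s stable)
      (localMonoidsIn? isVariety (V-decidable σ F V isVariety corresponds F?) L fin (suc d) 0<s stable)
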